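{- Every triangulation $G$ of the projective plane has a bipartite subgraph $H$ with $|E(H)|\ge \frac{2}{3}|E(G)|-1$.
   Context: A triangulation of a surface is a simple graph 2-cell embedded on the surface such that every facial closed walk has length 3. -}

module Defs where

open import Data.Nat using (ℕ; _+_; _*_; _≤_)
open import Data.Fin using (Fin)
open import Data.Fin.Subset using (Subset; _∈_; ∣_∣)
open import Data.Bool using (Bool)
open import Data.List using (List; []; _∷_)
open import Data.Product using (Σ; ∃; _×_; _,_)
open import Relation.Binary.PropositionalEquality using (_≡_; _≢_)
open import Function.Bundles using (_⇔_)
import Data.List.Membership.Propositional as LM

-- Reachability of flags under a list of permutations (orbit relation of the
-- generated group; all generators used below are involutions, so this is an
-- equivalence relation).
data Orb {n : ℕ} (gs : List (Fin n → Fin n)) (x : Fin n) : Fin n → Set where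
  here : Orb gs x x
  step : ∀ {y} (g : Fin n → Fin n) → g LM.∈ gs → Orb gs x y → Orb gs x (g y)

-- A (connected) combinatorial map in the flag representation (generalised
-- rotation system; equivalent to a 2-cell embedding of a connected graph
-- in a closed surface, orientable or not), with its vertices, edges and faces
-- given as explicit quotients Fin V, Fin E, Fin F of the flag set by the orbits
-- of ⟨α₁,α₂⟩, ⟨α₀,α₂⟩, ⟨α₀,α₁⟩ respectively.
record Map : Set where
  field
    nFlags : ℕ
    α₀ α₁ α₂ : Fin nFlags → Fin nFlags
    α₀-inv : ∀ x → α₀ (α₀ x) ≡ x
    α₁-inv : ∀ x → α₁ (α₁ x) ≡ x
    α₂-inv : ∀ x → α₂ (α₂ x) ≡ x
    α₀-fpf : ∀ x → α₀ x ≢ x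
    α₁-fpf : ∀ x → α₁ x ≢ x
    α₂-fpf : ∀ x → α₂ x ≢ x
    α₀α₂-comm : ∀ x → α₀ (α₂ x) ≡ α₂ (α₀ x)
    α₀α₂-fpf : ∀ x → α₀ (α₂ x) ≢ x
    connected : ∀ x y → Orb (α₀ ∷ α₁ ∷ α₂ ∷ []) x y
    V E F : ℕ
    vtx : Fin nFlags → Fin V
    edg : Fin nFlags → Fin E
    fac : Fin nFlags → Fin F
    vtx-surj : ∀ v → ∃ λ x → vtx x ≡ v
    edg-surj : ∀ e → ∃ λ x → edg x ≡ e
    fac-surj : ∀ f → ∃ λ x → fac x ≡ f
    vtx-orb : ∀ x y → (vtx x ≡ vtx y) ⇔ Orb (α₁ ∷ α₂ ∷ []) x y
    edg-orb : ∀ x y → (edg x ≡ edg y) ⇔ Orb (α₀ ∷ α₂ ∷ []) x y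
    fac-orb : ∀ x y → (fac x ≡ fac y) ⇔ Orb (α₀ ∷ α₁ ∷ []) x y

open Map public

Simple : Map → Set
Simple M = (∀ x → vtx M x ≢ vtx M (α₀ M x))
         × (∀ x y → vtx M x ≡ vtx M y → vtx M (α₀ M x) ≡ vtx M (α₀ M y)
                  → edg M x ≡ edg M y)

-- Every facial walk has length 3: α₁α₀ rotates each face with period
-- equal to the face length.
AllFacesTriangles : Map → Set
AllFacesTriangles M =
  ∀ x → (α₁ M (α₀ M (α₁ M (α₀ M (α₁ M (α₀ M x)))))) ≡ x
      × α₁ M (α₀ M x) ≢ x

-- The surface is the projective plane: by the classification of closed
-- surfaces, a connected map lives on the projective plane iff its Euler
-- characteristic V - E + F equals 1.
OnProjectivePlane : Map → Set
OnProjectivePlane M = V M + F M ≡ E M + 1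

record TriangulationOfProjectivePlane : Set where
  field
    map : Map
    simple : Simple map
    triangular : AllFacesTriangles map
    projective : OnProjectivePlane map

BipartiteEdgeSet : (M : Map) → Subset (E M) → Set
BipartiteEdgeSet M S =
  Σ (Fin (V M) → Bool) λ c →
    ∀ x → edg M x ∈ S → c (vtx M x) ≢ c (vtx M (α₀ M x))

{-# OPTIONS --safe #-}

-- The dual of the triangulation is a cubic graph without bridges. A coloring c of the vertices of G corresponds
-- to the edge set N = δc of G; viewed in the dual, N is an even subgraph, i.e. a disjoint union of cycles, and
-- E(G) − N is minimal when N is a 2-factor. As the Euler characteristic is 1, the even subgraphs of the form δc
-- are those that contain an even number of negative edges, for a suitable signing of the edges. So we look for
-- an even 2-factor of a signed cubic graph, and the bound leaves room for it to miss one vertex: if 3F = 2E and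
-- |N| ≥ F − 1, then 2E ≤ 3|N| + 3.
--
-- Such a factor exists in every 2-edge-connected signed cubic graph. More precisely, it can be chosen to contain
-- a prescribed edge e, unless e is the only negative edge up to switching. This follows by induction with Frink's
-- reduction: for an edge f = xy adjacent to e, delete x and y and join their other neighbours by two new edges,
-- in one of the two ways, at least one of which keeps the graph 2-edge-connected; a factor of the smaller graph through the new edge
-- made from e lifts. The signs of the new edges are chosen so that parities are preserved. If the smaller graph
-- is exceptional, then up to switching the larger one has a single negative edge g, at distance one from e. In
-- that case the end of g is slid into e: a 2-factor of the resulting graph through both halves of e avoids g, and
-- it gives a factor of the original graph that avoids g, contains e and misses at most one vertex. It exists by
-- Plesník's theorem (a 2-factor through two prescribed edges), proved by the same reduction.
module Submission where

open import Defs
open import Data.Nat using (ℕ; zero; suc; _+_; _*_; _≤_; _<_; z≤n; s≤s; s≤s⁻¹)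
open import Data.Fin.Subset using (Subset; ∣_∣)
open import Data.Product using (Σ; _×_; ∃; ∃₂; _,_; proj₁; proj₂)
import Data.Nat.Properties as ℕ
open import Data.Nat.Tactic.RingSolver using (solve-∀)
open import Data.Fin using (Fin; zero; suc; _≟_; splitAt; join)
open import Data.Fin.Properties using (any?; injective⇒≤; join-splitAt)
open import Data.Fin.Subset.Properties using (anySubset?)
open import Data.Bool using (Bool; true; false; _xor_; _∧_; _∨_; not; if_then_else_)
import Data.Bool.Properties as 𝔹
open import Data.Bool.Solver using (module xor-∧-Solver)
open import Data.List using (List; []; _∷_; length; tabulate)
open import Data.List.Relation.Unary.Any using () renaming (here to hd; there to tl)
import Data.Vec as Vec
open import Data.Vec.Properties using (lookup∘tabulate; []=⇒lookup)
open import Data.Vec.Functional using () renaming (_∷_ to _◂_)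
open import Data.Sum using (_⊎_; inj₁; inj₂; [_,_]′)
open import Data.Empty using (⊥; ⊥-elim)
open import Algebra.Bundles using (CommutativeRing)
import Algebra.Properties.CommutativeMonoid.Sum
open import Relation.Nullary using (¬_; Dec; yes; no; does)
open import Relation.Nullary.Decidable using (_×-dec_; ¬?; dec-true; dec-false; map′; decidable-stable)
open import Relation.Binary.PropositionalEquality
open import Function using (_∘_; case_of_)
open import Function.Bundles using (module Equivalence)

-- The lost vertex cannot be avoided: for K₆ in the projective plane, whose dual is the Petersen
-- graph, E = 15 and F = 10, while no cut has more than 9 edges.
--
-- The prescribed edge is what drives the induction. A factor of the reduced graph that uses neither
-- new edge would leave x and y uncovered, and one that uses only the second would lift to a factor
-- that avoids e.
--
-- The reduction may create parallel edges, so graphs are lists of edges. Besides the generic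
-- position there are two degenerate ones: x and y joined by two edges (a digon), and a component
-- that consists of three parallel edges (the theta graph).

private
  variable
    n : ℕ

-- Signed multigraphs as lists of edges, and weights summed over them

⟦_⟧ : Bool → ℕ
⟦ false ⟧ = 0
⟦ true ⟧ = 1

-- A signed edge; `req` marks the edges that a factor is required to contain.
record Edge (n : ℕ) : Set where
  constructor edge
  field
    src tgt : Fin n
    sgn req : Bool
open Edge

flip : Edge n → Edge n
flip (edge a b s r) = edge b a s r

infix 4 _≈_
-- Two lists of the same multigraph: edges may be permuted and reversed. Degrees, cuts, signs and
-- marks are all sums of symmetric weights, so `∑-≈` transports each of them.
data _≈_ {n : ℕ} : List (Edge n) → List (Edge n) → Set where
  ≈-refl : ∀ {es} → es ≈ es
  ≈-prep : ∀ {e es fs} → es ≈ fs → e ∷ es ≈ e ∷ fs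
  ≈-swap : ∀ {e f es} → e ∷ f ∷ es ≈ f ∷ e ∷ es
  ≈-flip : ∀ {e es} → e ∷ es ≈ flip e ∷ es
  ≈-trans : ∀ {es fs gs} → es ≈ fs → fs ≈ gs → es ≈ gs

∑ : (Edge n → ℕ) → List (Edge n) → ℕ
∑ φ [] = 0
∑ φ (e ∷ es) = φ e + ∑ φ es

Symmetric : (Edge n → ℕ) → Set
Symmetric φ = ∀ e → φ (flip e) ≡ φ e

∑-≈ : {φ : Edge n → ℕ} → Symmetric φ → {es fs : List (Edge n)} → es ≈ fs → ∑ φ es ≡ ∑ φ fs
∑-≈ sym-φ ≈-refl = refl
∑-≈ {φ = φ} sym-φ (≈-prep {e} p) = cong (φ e +_) (∑-≈ sym-φ p)
∑-≈ {φ = φ} sym-φ (≈-swap {e} {f} {es}) = lemma (φ e) (φ f) (∑ φ es)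
  where
  lemma : ∀ a b c → a + (b + c) ≡ b + (a + c)
  lemma = solve-∀
∑-≈ {φ = φ} sym-φ (≈-flip {e} {es}) = cong (_+ ∑ φ es) (sym (sym-φ e))
∑-≈ sym-φ (≈-trans p q) = trans (∑-≈ sym-φ p) (∑-≈ sym-φ q)

≈-length : {es fs : List (Edge n)} → es ≈ fs → length es ≡ length fs
≈-length ≈-refl = refl
≈-length (≈-prep p) = cong suc (≈-length p)
≈-length ≈-swap = refl
≈-length ≈-flip = refl
≈-length (≈-trans p q) = trans (≈-length p) (≈-length q)

abstract
  δ : Fin n → Fin n → ℕ
  δ v a = ⟦ does (v ≟ a) ⟧

  δ-refl : (v : Fin n) → δ v v ≡ 1
  δ-refl v = cong ⟦_⟧ (dec-true (v ≟ v) refl)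

  δ-≢ : {v a : Fin n} → v ≢ a → δ v a ≡ 0
  δ-≢ {v = v} {a} v≢a = cong ⟦_⟧ (dec-false (v ≟ a) v≢a)

  δ-0 : {v a : Fin n} → δ v a ≡ 0 → v ≢ a
  δ-0 {v = v} eq refl with trans (sym (δ-refl v)) eq
  ... | ()

-- A sum rather than a disjunction, so that a loop contributes 2 to the degree.
inc : Fin n → Edge n → ℕ
inc v (edge a b _ _) = δ v a + δ v b

cut : (Fin n → Bool) → Edge n → ℕ
cut c (edge a b _ _) = ⟦ c a xor c b ⟧

-- The sign of the edge after switching at the vertices of colour `true`.
violated : (Fin n → Bool) → Edge n → ℕ
violated c (edge a b s _) = ⟦ s xor (c a xor c b) ⟧

required : Edge n → ℕ
required e = ⟦ req e ⟧

negative : Edge n → ℕ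
negative e = ⟦ sgn e ⟧

inc-sym : (v : Fin n) → Symmetric (inc v)
inc-sym v (edge a b _ _) = ℕ.+-comm (δ v b) (δ v a)

cut-sym : (c : Fin n → Bool) → Symmetric (cut c)
cut-sym c (edge a b _ _) = cong ⟦_⟧ (𝔹.xor-comm (c b) (c a))

violated-sym : (c : Fin n → Bool) → Symmetric (violated c)
violated-sym c (edge a b s _) = cong (λ t → ⟦ s xor t ⟧) (𝔹.xor-comm (c b) (c a))

required-sym : Symmetric (required {n})
required-sym _ = refl

negative-sym : Symmetric (negative {n})
negative-sym _ = refl

deg : Fin n → List (Edge n) → ℕ
deg v = ∑ (inc v)

data Select {n : ℕ} : List (Edge n) → List (Edge n) → Set where
  [] : Select [] []
  keep : ∀ {e es N} → Select es N → Select (e ∷ es) (e ∷ N)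
  drop : ∀ {e es N} → req e ≡ false → Select es N → Select (e ∷ es) N

Select-≈ : {es fs N : List (Edge n)} → es ≈ fs → Select fs N → ∃ λ N′ → Select es N′ × N′ ≈ N
Select-≈ ≈-refl S = _ , S , ≈-refl
Select-≈ (≈-prep p) (keep S) with N′ , S′ , q ← Select-≈ p S = _ , keep S′ , ≈-prep q
Select-≈ (≈-prep p) (drop r S) with N′ , S′ , q ← Select-≈ p S = _ , drop r S′ , q
Select-≈ ≈-swap (keep (keep S)) = _ , keep (keep S) , ≈-swap
Select-≈ ≈-swap (keep (drop r S)) = _ , drop r (keep S) , ≈-refl
Select-≈ ≈-swap (drop r (keep S)) = _ , keep (drop r S) , ≈-refl
Select-≈ ≈-swap (drop r (drop t S)) = _ , drop t (drop r S) , ≈-refl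
Select-≈ ≈-flip (keep S) = _ , keep S , ≈-flip
Select-≈ ≈-flip (drop r S) = _ , drop r S , ≈-refl
Select-≈ (≈-trans p q) S with N₁ , S₁ , r₁ ← Select-≈ q S with N₂ , S₂ , r₂ ← Select-≈ p S₁ =
  N₂ , S₂ , ≈-trans r₂ r₁

Select-∑ : {φ : Edge n → ℕ} {es N : List (Edge n)} → Select es N → ∑ φ N ≤ ∑ φ es
Select-∑ [] = z≤n
Select-∑ {φ = φ} (keep {e} S) = ℕ.+-monoʳ-≤ (φ e) (Select-∑ S)
Select-∑ {φ = φ} (drop {e} _ S) = ℕ.≤-trans (Select-∑ S) (ℕ.m≤n+m _ (φ e))

Select-zero : {φ : Edge n → ℕ} {es N : List (Edge n)} → Select es N → ∑ φ es ≡ 0 → ∑ φ N ≡ 0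
Select-zero {φ = φ} {N = N} S eq = ℕ.n≤0⇒n≡0 (subst (∑ φ N ≤_) eq (Select-∑ S))

-- Cubic graphs, small cuts and factors

record Cubic {n : ℕ} (es : List (Edge n)) : Set where
  constructor mkCubic
  field degrees : ∀ v → deg v es ≡ 0 ⊎ deg v es ≡ 3
open Cubic

-- Vertices of degree 0 are not considered part of the graph: deleting a vertex means deleting its edges.
record TwoEdgeConnected {n : ℕ} (es : List (Edge n)) : Set where
  constructor mkConnected
  field constant : ∀ c → ∑ (cut c) es ≤ 1 → ∀ v w → deg v es ≢ 0 → deg w es ≢ 0 → c v ≡ c w
open TwoEdgeConnected

-- `Z` describes the vertices that may be left out: none for a 2-factor, a single one for an even
-- factor. Deleted vertices, of degree 0 in `es`, are exempt as well.
record Factor {n : ℕ} (Z : Fin n → Set) (es N : List (Edge n)) : Set where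
  constructor mkFactor
  field covers : ∀ v → deg v N ≡ 2 ⊎ (deg v N ≡ 0 × (deg v es ≡ 0 ⊎ Z v))
open Factor

module _ {es fs : List (Edge n)} (p : es ≈ fs) where

  deg-≈ : ∀ v → deg v es ≡ deg v fs
  deg-≈ v = ∑-≈ (inc-sym v) p

  Cubic-≈ : Cubic es → Cubic fs
  Cubic-≈ cubic .degrees v = subst (λ d → d ≡ 0 ⊎ d ≡ 3) (deg-≈ v) (cubic .degrees v)

  TwoEdgeConnected-≈ : TwoEdgeConnected es → TwoEdgeConnected fs
  TwoEdgeConnected-≈ conn .constant c small v w v-live w-live =
    conn .constant c (subst (_≤ 1) (sym (∑-≈ (cut-sym c) p)) small) v w
      (v-live ∘ trans (sym (deg-≈ v))) (w-live ∘ trans (sym (deg-≈ w)))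

Factor-deg : {Z : Fin n → Set} {es es′ N N′ : List (Edge n)} → (∀ v → deg v es ≡ deg v es′) →
             (∀ v → deg v N ≡ deg v N′) → Factor Z es′ N′ → Factor Z es N
Factor-deg p q F .covers v with F .covers v
... | inj₁ eq = inj₁ (trans (q v) eq)
... | inj₂ (eq , inj₁ dead) = inj₂ (trans (q v) eq , inj₁ (trans (p v) dead))
... | inj₂ (eq , inj₂ z) = inj₂ (trans (q v) eq , inj₂ z)

Factor-≈ : {Z : Fin n → Set} {es fs N M : List (Edge n)} → es ≈ fs → N ≈ M → Factor Z fs M → Factor Z es N
Factor-≈ p q = Factor-deg (deg-≈ p) (deg-≈ q)

extract : (φ : Edge n → ℕ) (es : List (Edge n)) → ∑ φ es ≢ 0 → ∃₂ λ e R → es ≈ e ∷ R × φ e ≢ 0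
extract φ [] nz = ⊥-elim (nz refl)
extract φ (e ∷ es) nz with φ e in eq
... | suc _ = e , es , ≈-refl , λ eq′ → case trans (sym eq) eq′ of λ ()
... | zero with f , R , p , nz′ ← extract φ es nz = f , e ∷ R , ≈-trans (≈-prep p) ≈-swap , nz′

extract-at : (x : Fin n) (es : List (Edge n)) → deg x es ≢ 0 → ∃₂ λ a s → ∃₂ λ r R → es ≈ edge x a s r ∷ R
extract-at x es nz with extract (inc x) es nz
... | edge a b s r , R , p , nz′ with x ≟ a
...   | yes refl = b , s , r , R , p
...   | no x≢a with x ≟ b
...     | yes refl = a , s , r , R , ≈-trans p ≈-flip
...     | no x≢b = ⊥-elim (nz′ (cong₂ _+_ (δ-≢ x≢a) (δ-≢ x≢b)))

-- The ends of a listed edge are live, so colourings may be changed freely at deleted vertices. This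
-- is what allows colours for x and y to be added to a colouring of the reduced graph.
∑-cong-live : (φ ψ : Edge n → ℕ) (es : List (Edge n)) →
              (∀ e → deg (src e) es ≢ 0 → deg (tgt e) es ≢ 0 → φ e ≡ ψ e) → ∑ φ es ≡ ∑ ψ es
∑-cong-live φ ψ [] h = refl
∑-cong-live φ ψ (e@(edge a b _ _) ∷ es) h =
  cong₂ _+_ (h e (λ eq → δ-0 {v = a} (ℕ.m+n≡0⇒m≡0 _ (ℕ.m+n≡0⇒m≡0 _ eq)) refl)
                 (λ eq → δ-0 {v = b} (ℕ.m+n≡0⇒n≡0 (δ b a) (ℕ.m+n≡0⇒m≡0 _ eq)) refl))
            (∑-cong-live φ ψ es λ f p q → h f (p ∘ ℕ.m+n≡0⇒n≡0 _) (q ∘ ℕ.m+n≡0⇒n≡0 _))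

cut-cong : {c d : Fin n → Bool} (es : List (Edge n)) → (∀ v → deg v es ≢ 0 → c v ≡ d v) → ∑ (cut c) es ≡ ∑ (cut d) es
cut-cong es agree = ∑-cong-live _ _ es λ e p q → cong ⟦_⟧ (cong₂ _xor_ (agree _ p) (agree _ q))

violated-cong : {c d : Fin n → Bool} (es : List (Edge n)) → (∀ v → deg v es ≢ 0 → c v ≡ d v) →
                ∑ (violated c) es ≡ ∑ (violated d) es
violated-cong es agree = ∑-cong-live _ _ es λ e p q → cong (λ t → ⟦ sgn e xor t ⟧) (cong₂ _xor_ (agree _ p) (agree _ q))

SmallCut : List (Edge n) → (Fin n → Bool) → Set
SmallCut es c = ∑ (cut c) es ≤ 1 × ∃₂ λ v w → deg v es ≢ 0 × deg w es ≢ 0 × c v ≢ c w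

-- The search runs over tables of colourings; the second argument carries `P` across the pointwise
-- equality between a colouring and its table.
search : {P : (Fin n → Bool) → Set} → (∀ c → Dec (P c)) → (∀ {c d} → (∀ v → c v ≡ d v) → P c → P d) → Dec (∃ P)
search P? ext = map′ (λ (S , p) → Vec.lookup S , p)
  (λ (c , p) → Vec.tabulate c , ext (λ v → sym (lookup∘tabulate c v)) p)
  (anySubset? (λ S → P? (Vec.lookup S)))

-- A failure has to come with an explicit bad cut, because `frink` plays two such cuts against each
-- other.
twoEdgeConnected? : (es : List (Edge n)) → TwoEdgeConnected es ⊎ ∃ (SmallCut es)
twoEdgeConnected? {n} es with search small? small-ext
  where
  small? : ∀ c → Dec (SmallCut es c)
  small? c = (∑ (cut c) es ℕ.≤? 1) ×-dec any? λ v → any? λ w →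
    ¬? (deg v es ℕ.≟ 0) ×-dec ¬? (deg w es ℕ.≟ 0) ×-dec ¬? (c v 𝔹.≟ c w)
  small-ext : ∀ {c d} → (∀ v → c v ≡ d v) → SmallCut es c → SmallCut es d
  small-ext eq (small , v , w , p , q , ne) =
    subst (_≤ 1) (cut-cong es (λ v _ → eq v)) small , v , w , p , q , λ e → ne (trans (eq v) (trans e (sym (eq w))))
... | yes found = inj₂ found
... | no none = inj₁ conn
  where
  conn : TwoEdgeConnected es
  conn .constant c small v w p q with c v 𝔹.≟ c w
  ... | yes eq = eq
  ... | no ne = ⊥-elim (none (c , small , v , w , p , q , ne))

sum-≡0 : ∀ {a b} → a + b ≡ 0 → a ≡ 0 × b ≡ 0
sum-≡0 {a} eq = ℕ.m+n≡0⇒m≡0 a eq , ℕ.m+n≡0⇒n≡0 a eq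

indicator : Fin n → Fin n → Bool
indicator x v = does (v ≟ x)

indicator-refl : (x : Fin n) → indicator x x ≡ true
indicator-refl x = dec-true (x ≟ x) refl

indicator-≢ : {x v : Fin n} → v ≢ x → indicator x v ≡ false
indicator-≢ {x = x} {v} ne = dec-false (v ≟ x) ne

live : {x v : Fin n} {es : List (Edge n)} → deg x es ≡ 0 → deg v es ≢ 0 → v ≢ x
live eq nz refl = nz eq

∑-const-0 : (φ : Edge n → ℕ) (es : List (Edge n)) → (∀ e → φ e ≡ 0) → ∑ φ es ≡ 0
∑-const-0 φ [] h = refl
∑-const-0 φ (e ∷ es) h = cong₂ _+_ (h e) (∑-const-0 φ es h)

cut-constant : (κ : Bool) (es : List (Edge n)) → ∑ (cut (λ _ → κ)) es ≡ 0
cut-constant κ es = ∑-const-0 _ es λ e → cong ⟦_⟧ (𝔹.xor-same κ)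

-- With a loop at x, the remaining third edge at x would be a bridge.
loop-bridge : {x a : Fin n} {s r t u : Bool} {R : List (Edge n)} → x ≢ a → deg x R ≡ 0 →
              ¬ TwoEdgeConnected (edge x x s r ∷ edge x a t u ∷ R)
loop-bridge {x = x} {a} {R = R} x≢a x∉R conn = false≢true (trans (sym (indicator-≢ (x≢a ∘ sym)))
  (trans (sym (conn .constant (indicator x) (ℕ.≤-reflexive small) x a
                (pos ((δ x x + δ x a) + deg x R) (δ-refl x))
                (λ eq → δ-0 (proj₂ (sum-≡0 {δ a x} (proj₁ (sum-≡0 (proj₂ (sum-≡0 {δ a x + δ a x} eq)))))) refl)))
         (indicator-refl x)))
  where
  false≢true : false ≢ true
  false≢true ()
  pos : ∀ {m} k → m ≡ 1 → (m + m) + k ≢ 0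
  pos k refl ()
  small : ∑ (cut (indicator x)) (edge x x false false ∷ edge x a false false ∷ R) ≡ 1
  small = cong₂ _+_ (cong ⟦_⟧ (𝔹.xor-same (indicator x x)))
            (cong₂ _+_ (cong ⟦_⟧ (cong₂ _xor_ (indicator-refl x) (indicator-≢ (x≢a ∘ sym))))
              (trans (cut-cong {d = λ _ → false} R (λ v nz → indicator-≢ (live {es = R} x∉R nz)))
                     (cut-constant false R)))

loopless : {a b : Fin n} {s r : Bool} {R : List (Edge n)} →
           Cubic (edge a b s r ∷ R) → TwoEdgeConnected (edge a b s r ∷ R) → a ≢ b
loopless {a = x} {s = s} {r} {R} cubic conn refl = go (cubic .degrees x)
  where
  two : (δ x x + δ x x) + deg x R ≡ 2 + deg x R
  two = cong (λ t → (t + t) + deg x R) (δ-refl x)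
  go : deg x (edge x x s r ∷ R) ≡ 0 ⊎ deg x (edge x x s r ∷ R) ≡ 3 → ⊥
  go (inj₁ eq) = case trans (sym two) eq of λ ()
  go (inj₂ eq) = third (ℕ.suc-injective (ℕ.suc-injective (trans (sym two) eq)))
    where
    third : deg x R ≡ 1 → ⊥
    third one with extract-at x R (λ z → case trans (sym z) one of λ ())
    ... | a , t , u , R′ , p = loop-bridge (δ-0 (proj₁ (sum-≡0 rest))) (proj₂ (sum-≡0 {δ x a} rest))
                                 (TwoEdgeConnected-≈ (≈-prep p) conn)
      where
      rest : δ x a + deg x R′ ≡ 0
      rest = ℕ.suc-injective (trans (cong (λ t → (t + δ x a) + deg x R′) (sym (δ-refl x))) (trans (sym (deg-≈ p x)) one))

-- The surroundings of an edge in a 2-edge-connected cubic graph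

record Star (x x₁ : Fin n) (R : List (Edge n)) : Set where
  constructor star
  field
    {a b} : Fin n
    {s r t u} : Bool
    {R₂} : List (Edge n)
    split : R ≈ edge x a s r ∷ edge x b t u ∷ R₂
    x≢x₁ : x ≢ x₁
    x≢a : x ≢ a
    x≢b : x ≢ b
    x∉R₂ : deg x R₂ ≡ 0

deg-one : {x a : Fin n} {R : List (Edge n)} → x ≢ a → deg x (edge x a false false ∷ R) ≡ suc (deg x R)
deg-one {x = x} {a} {R = R} ne = cong (_+ deg x R) (cong₂ _+_ (δ-refl x) (δ-≢ ne))

deg-none : {v a b : Fin n} {R : List (Edge n)} → v ≢ a → v ≢ b → deg v (edge a b false false ∷ R) ≡ deg v R
deg-none {v = v} {R = R} p q = cong (_+ deg v R) (cong₂ _+_ (δ-≢ p) (δ-≢ q))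

-- `R` is a part of `es` that contains two of the edges at x. The hypothesis on `R ≈ e ∷ R′` brings
-- an edge of `R` to the front of `es`, where `loopless` applies to it.
star-at : (x x₁ : Fin n) (es R : List (Edge n)) → x ≢ x₁ → Cubic es → TwoEdgeConnected es →
          (∀ {e R′} → R ≈ e ∷ R′ → ∃ λ R″ → es ≈ e ∷ R″) → deg x R ≡ 2 → Star x x₁ R
star-at x x₁ es R x≢x₁ cubic conn sub two = first (extract-at x R (λ z → case trans (sym z) two of λ ()))
  where
  no-loop : ∀ {a b s r R′} → R ≈ edge a b s r ∷ R′ → a ≢ b
  no-loop p = loopless (Cubic-≈ (proj₂ (sub p)) cubic) (TwoEdgeConnected-≈ (proj₂ (sub p)) conn)
  first : (∃₂ λ a s → ∃₂ λ r R₁ → R ≈ edge x a s r ∷ R₁) → Star x x₁ R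
  first (a , s , r , R₁ , p) = second (extract-at x R₁ (λ z → case trans (sym z) one of λ ()))
    where
    one : deg x R₁ ≡ 1
    one = ℕ.suc-injective (trans (sym (deg-one {R = R₁} (no-loop p))) (trans (sym (deg-≈ p x)) two))
    second : (∃₂ λ b t → ∃₂ λ u R₂ → R₁ ≈ edge x b t u ∷ R₂) → Star x x₁ R
    second (b , t , u , R₂ , q) = star (≈-trans p (≈-prep q)) x≢x₁ (no-loop p) x≢b
      (ℕ.suc-injective (trans (sym (deg-one {R = R₂} x≢b)) (trans (sym (deg-≈ q x)) one)))
      where
      x≢b : x ≢ b
      x≢b = no-loop (≈-trans p (≈-trans (≈-prep q) ≈-swap))

star-of : {x x₁ : Fin n} {s r : Bool} {R : List (Edge n)} →
          Cubic (edge x x₁ s r ∷ R) → TwoEdgeConnected (edge x x₁ s r ∷ R) → Star x x₁ R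
star-of {x = x} {x₁} {s} {r} {R} cubic conn =
  star-at x x₁ _ R x≢x₁ cubic conn (λ p → _ , ≈-trans (≈-prep p) ≈-swap) (two (cubic .degrees x))
  where
  x≢x₁ : x ≢ x₁
  x≢x₁ = loopless cubic conn
  two : deg x (edge x x₁ s r ∷ R) ≡ 0 ⊎ deg x (edge x x₁ s r ∷ R) ≡ 3 → deg x R ≡ 2
  two (inj₁ eq) = ⊥-elim (case trans (sym (deg-one {R = R} x≢x₁)) eq of λ ())
  two (inj₂ eq) = ℕ.suc-injective (trans (sym (deg-one {R = R} x≢x₁)) eq)

-- The generic position for the edge f = xy: x₁, x₂ are the other neighbours of x, and y₁, y₂ those
-- of y. These four may coincide with each other; only x and y, which are to be deleted, must differ
-- from everything else.
record Hub (x y x₁ x₂ y₁ y₂ : Fin n) (R : List (Edge n)) : Set where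
  field
    x≢y : x ≢ y
    x≢x₁ : x ≢ x₁
    x≢x₂ : x ≢ x₂
    x≢y₁ : x ≢ y₁
    x≢y₂ : x ≢ y₂
    y≢x₁ : y ≢ x₁
    y≢x₂ : y ≢ x₂
    y≢y₁ : y ≢ y₁
    y≢y₂ : y ≢ y₂
    x∉R : deg x R ≡ 0
    y∉R : deg y R ≡ 0

hub-swap : {x y x₁ x₂ y₁ y₂ : Fin n} {R : List (Edge n)} → Hub x y x₁ x₂ y₁ y₂ R → Hub x y x₁ x₂ y₂ y₁ R
hub-swap h = record
  { x≢y = x≢y ; x≢x₁ = x≢x₁ ; x≢x₂ = x≢x₂ ; x≢y₁ = x≢y₂ ; x≢y₂ = x≢y₁
  ; y≢x₁ = y≢x₁ ; y≢x₂ = y≢x₂ ; y≢y₁ = y≢y₂ ; y≢y₂ = y≢y₁ ; x∉R = x∉R ; y∉R = y∉R }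
  where open Hub h

recolour : Fin n → Fin n → Bool → Bool → (Fin n → Bool) → Fin n → Bool
recolour x y p q c v = if does (v ≟ x) then p else if does (v ≟ y) then q else c v

module _ {x y : Fin n} {p q : Bool} {c : Fin n → Bool} where
  recolour-x : recolour x y p q c x ≡ p
  recolour-x rewrite dec-true (x ≟ x) refl = refl

  recolour-y : x ≢ y → recolour x y p q c y ≡ q
  recolour-y ne rewrite dec-false (y ≟ x) (ne ∘ sym) | dec-true (y ≟ y) refl = refl

  recolour-≢ : {v : Fin n} → x ≢ v → y ≢ v → recolour x y p q c v ≡ c v
  recolour-≢ {v = v} ne ne′ rewrite dec-false (v ≟ x) (ne ∘ sym) | dec-false (v ≟ y) (ne′ ∘ sym) = refl

  recolour-live : {v : Fin n} (R : List (Edge n)) → deg x R ≡ 0 → deg y R ≡ 0 → deg v R ≢ 0 → recolour x y p q c v ≡ c v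
  recolour-live R x∉ y∉ nz = recolour-≢ (live {es = R} x∉ nz ∘ sym) (live {es = R} y∉ nz ∘ sym)

  cut-recolour : (R : List (Edge n)) → deg x R ≡ 0 → deg y R ≡ 0 → ∑ (cut (recolour x y p q c)) R ≡ ∑ (cut c) R
  cut-recolour R x∉ y∉ = cut-cong R λ v nz → recolour-live R x∉ y∉ nz

  violated-recolour : (R : List (Edge n)) → deg x R ≡ 0 → deg y R ≡ 0 →
                      ∑ (violated (recolour x y p q c)) R ≡ ∑ (violated c) R
  violated-recolour R x∉ y∉ = violated-cong R λ v nz → recolour-live R x∉ y∉ nz

module _ {x y x₁ x₂ y₁ y₂ : Fin n} {R : List (Edge n)} where

  private
    hubCut : Bool → Bool → (Fin n → Bool) → ℕ
    hubCut p q c = ⟦ p xor c x₁ ⟧ + (⟦ p xor q ⟧ + (⟦ p xor c x₂ ⟧ + (⟦ q xor c y₁ ⟧ + (⟦ q xor c y₂ ⟧ + ∑ (cut c) R))))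

  module _ (h : Hub x y x₁ x₂ y₁ y₂ R) {s₁ r₁ sf rf s₂ r₂ t₁ u₁ t₂ u₂ : Bool} where
    open Hub h

    private
      H : List (Edge n)
      H = edge x x₁ s₁ r₁ ∷ edge x y sf rf ∷ edge x x₂ s₂ r₂ ∷ edge y y₁ t₁ u₁ ∷ edge y y₂ t₂ u₂ ∷ R

    cut-hub : ∀ p q c → ∑ (cut (recolour x y p q c)) H ≡ hubCut p q c
    cut-hub p q c
      rewrite recolour-x {x = x} {y} {p} {q} {c} | recolour-y {x = x} {y} {p} {q} {c} x≢y
            | recolour-≢ {x = x} {y} {p} {q} {c} x≢x₁ y≢x₁ | recolour-≢ {x = x} {y} {p} {q} {c} x≢x₂ y≢x₂
            | recolour-≢ {x = x} {y} {p} {q} {c} x≢y₁ y≢y₁ | recolour-≢ {x = x} {y} {p} {q} {c} x≢y₂ y≢y₂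
            | cut-recolour {x = x} {y} {p} {q} {c} R x∉R y∉R = refl

    deg-hub : ∀ v → deg v H ≡ deg v (edge x₁ y₁ false false ∷ edge x₂ y₂ false false ∷ R) + (3 * δ v x + 3 * δ v y)
    deg-hub v = lemma (δ v x) (δ v y) (δ v x₁) (δ v x₂) (δ v y₁) (δ v y₂) (deg v R)
      where
      lemma : ∀ a b c d e f r → (a + c) + ((a + b) + ((a + d) + ((b + e) + ((b + f) + r)))) ≡
                                ((c + e) + ((d + f) + r)) + (3 * a + 3 * b)
      lemma = solve-∀

    reduced-x : deg x (edge x₁ y₁ false false ∷ edge x₂ y₂ false false ∷ R) ≡ 0
    reduced-x = cong₂ _+_ (cong₂ _+_ (δ-≢ x≢x₁) (δ-≢ x≢y₁)) (cong₂ _+_ (cong₂ _+_ (δ-≢ x≢x₂) (δ-≢ x≢y₂)) x∉R)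

    reduced-y : deg y (edge x₁ y₁ false false ∷ edge x₂ y₂ false false ∷ R) ≡ 0
    reduced-y = cong₂ _+_ (cong₂ _+_ (δ-≢ y≢x₁) (δ-≢ y≢y₁)) (cong₂ _+_ (cong₂ _+_ (δ-≢ y≢x₂) (δ-≢ y≢y₂)) y∉R)

    hub-live : ∀ {v} → deg v (edge x₁ y₁ false false ∷ edge x₂ y₂ false false ∷ R) ≢ 0 → deg v H ≢ 0
    hub-live {v} nz eq = nz (proj₁ (sum-≡0 (trans (sym (deg-hub v)) eq)))

    -- With the colours p and q at x and y, the colouring c becomes a small cut of `H`, hence is
    -- constant there, and the vertices of the reduced graph keep their colours.
    hub-constant : TwoEdgeConnected H → ∀ p q c → hubCut p q c ≤ 1 →
                   ∀ {v w} → deg v (edge x₁ y₁ false false ∷ edge x₂ y₂ false false ∷ R) ≢ 0 →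
                             deg w (edge x₁ y₁ false false ∷ edge x₂ y₂ false false ∷ R) ≢ 0 → c v ≡ c w
    hub-constant conn p q c small {v} {w} v-live w-live =
      trans (sym (fixes v-live))
        (trans (conn .constant (recolour x y p q c) (subst (_≤ 1) (sym (cut-hub p q c)) small) v w (hub-live v-live) (hub-live w-live))
               (fixes w-live))
      where
      fixes : ∀ {v} → deg v (edge x₁ y₁ false false ∷ edge x₂ y₂ false false ∷ R) ≢ 0 → recolour x y p q c v ≡ c v
      fixes nz = recolour-live {x = x} {y} {p} {q} {c} (edge x₁ y₁ false false ∷ edge x₂ y₂ false false ∷ R) reduced-x reduced-y nz

-- A small cut of the reduced graph extends to a small cut of the hub, unless it separates x₁, y₁ from x₂, y₂.
extend-cut : (X₁ X₂ Y₁ Y₂ : Bool) (r : ℕ) → ⟦ X₁ xor Y₁ ⟧ + (⟦ X₂ xor Y₂ ⟧ + r) ≤ 1 →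
  (∃₂ λ p q → ⟦ p xor X₁ ⟧ + (⟦ p xor q ⟧ + (⟦ p xor X₂ ⟧ + (⟦ q xor Y₁ ⟧ + (⟦ q xor Y₂ ⟧ + r)))) ≤ 1) ⊎
  (Y₁ ≡ X₁ × X₂ ≡ not X₁ × Y₂ ≡ not X₁ × r ≤ 1)
extend-cut false false false false r small = inj₁ (false , false , small)
extend-cut false false false true  r small = inj₁ (false , false , small)
extend-cut false false true  false r small = inj₁ (false , false , small)
extend-cut false false true  true  r (s≤s ())
extend-cut false true  false false r small = inj₁ (false , false , small)
extend-cut false true  false true  r small = inj₂ (refl , refl , refl , small)
extend-cut false true  true  false r (s≤s ())
extend-cut false true  true  true  r small = inj₁ (true , true , small)
extend-cut true  false false false r small = inj₁ (false , false , small)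
extend-cut true  false false true  r (s≤s ())
extend-cut true  false true  false r small = inj₂ (refl , refl , refl , small)
extend-cut true  false true  true  r small = inj₁ (true , true , small)
extend-cut true  true  false false r (s≤s ())
extend-cut true  true  false true  r small = inj₁ (true , true , small)
extend-cut true  true  true  false r small = inj₁ (true , true , small)
extend-cut true  true  true  true  r small = inj₁ (true , true , small)

-- Frink's reduction

-- `not (a xor b)` is the equality test on booleans. The four quadrants are the classes of the
-- common refinement of the cuts c and d.
quadrant : (c d : Fin n → Bool) → Bool → Bool → Fin n → Bool
quadrant c d i j v = not (c v xor i) ∧ not (d v xor j)

-- The at most two edges of two small cuts miss the boundary of one of the four quadrants.
module _ (c d : Fin n → Bool) where
  private
    -- `α j` marks the edges that cross c within side j of d, and `β i` those that cross d within
    -- side i of c. `γ k` marks the edges that cross both; they join the two opposite quadrants with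
    -- i xor j ≡ k.
    α : Bool → Edge n → ℕ
    α j (edge a b _ _) = ⟦ (c a xor c b) ∧ (not (d a xor j) ∧ not (d b xor j)) ⟧
    β : Bool → Edge n → ℕ
    β i (edge a b _ _) = ⟦ (d a xor d b) ∧ (not (c a xor i) ∧ not (c b xor i)) ⟧
    γ : Bool → Edge n → ℕ
    γ k (edge a b _ _) = ⟦ (c a xor c b) ∧ ((d a xor d b) ∧ not ((c a xor d a) xor k)) ⟧

    cut-c : ∀ e → cut c e ≡ α false e + (α true e + (γ false e + γ true e))
    cut-c (edge a b _ _) = go (c a) (c b) (d a) (d b)
      where
      go : ∀ C C′ D D′ → ⟦ C xor C′ ⟧ ≡ ⟦ (C xor C′) ∧ (not (D xor false) ∧ not (D′ xor false)) ⟧ +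
        (⟦ (C xor C′) ∧ (not (D xor true) ∧ not (D′ xor true)) ⟧ +
        (⟦ (C xor C′) ∧ ((D xor D′) ∧ not ((C xor D) xor false)) ⟧ + ⟦ (C xor C′) ∧ ((D xor D′) ∧ not ((C xor D) xor true)) ⟧))
      go false false _ _ = refl
      go true true _ _ = refl
      go false true false false = refl
      go false true false true = refl
      go false true true false = refl
      go false true true true = refl
      go true false false false = refl
      go true false false true = refl
      go true false true false = refl
      go true false true true = refl

    cut-d : ∀ e → cut d e ≡ β false e + (β true e + (γ false e + γ true e))
    cut-d (edge a b _ _) = go (c a) (c b) (d a) (d b)
      where
      go : ∀ C C′ D D′ → ⟦ D xor D′ ⟧ ≡ ⟦ (D xor D′) ∧ (not (C xor false) ∧ not (C′ xor false)) ⟧ +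
        (⟦ (D xor D′) ∧ (not (C xor true) ∧ not (C′ xor true)) ⟧ +
        (⟦ (C xor C′) ∧ ((D xor D′) ∧ not ((C xor D) xor false)) ⟧ + ⟦ (C xor C′) ∧ ((D xor D′) ∧ not ((C xor D) xor true)) ⟧))
      go false false false false = refl
      go false false false true = refl
      go false false true false = refl
      go false false true true = refl
      go true true false false = refl
      go true true false true = refl
      go true true true false = refl
      go true true true true = refl
      go false true false false = refl
      go false true false true = refl
      go false true true false = refl
      go false true true true = refl
      go true false false false = refl
      go true false false true = refl
      go true false true false = refl
      go true false true true = refl

    cut-quadrant : ∀ i j e → cut (quadrant c d i j) e ≡ α j e + (β i e + γ (i xor j) e)
    cut-quadrant i j (edge a b _ _) = go i j (c a) (c b) (d a) (d b)
      where
      go : ∀ i j C C′ D D′ → ⟦ (not (C xor i) ∧ not (D xor j)) xor (not (C′ xor i) ∧ not (D′ xor j)) ⟧ ≡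
        ⟦ (C xor C′) ∧ (not (D xor j) ∧ not (D′ xor j)) ⟧ +
        (⟦ (D xor D′) ∧ (not (C xor i) ∧ not (C′ xor i)) ⟧ + ⟦ (C xor C′) ∧ ((D xor D′) ∧ not ((C xor D) xor (i xor j))) ⟧)
      go false false false false false false = refl
      go false false false false false true = refl
      go false false false false true false = refl
      go false false false false true true = refl
      go false false false true false false = refl
      go false false false true false true = refl
      go false false false true true false = refl
      go false false false true true true = refl
      go false false true false false false = refl
      go false false true false false true = refl
      go false false true false true false = refl
      go false false true false true true = refl
      go false false true true false false = refl
      go false false true true false true = refl
      go false false true true true false = refl
      go false false true true true true = refl
      go false true false false false false = refl
      go false true false false false true = refl
      go false true false false true false = refl
      go false true false false true true = refl
      go false true false true false false = refl
      go false true false true false true = refl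
      go false true false true true false = refl
      go false true false true true true = refl
      go false true true false false false = refl
      go false true true false false true = refl
      go false true true false true false = refl
      go false true true false true true = refl
      go false true true true false false = refl
      go false true true true false true = refl
      go false true true true true false = refl
      go false true true true true true = refl
      go true false false false false false = refl
      go true false false false false true = refl
      go true false false false true false = refl
      go true false false false true true = refl
      go true false false true false false = refl
      go true false false true false true = refl
      go true false false true true false = refl
      go true false false true true true = refl
      go true false true false false false = refl
      go true false true false false true = refl
      go true false true false true false = refl
      go true false true false true true = refl
      go true false true true false false = refl
      go true false true true false true = refl
      go true false true true true false = refl
      go true false true true true true = refl
      go true true false false false false = refl
      go true true false false false true = refl
      go true true false false true false = refl
      go true true false false true true = refl
      go true true false true false false = refl
      go true true false true false true = refl
      go true true false true true false = refl
      go true true false true true true = refl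
      go true true true false false false = refl
      go true true true false false true = refl
      go true true true false true false = refl
      go true true true false true true = refl
      go true true true true false false = refl
      go true true true true false true = refl
      go true true true true true false = refl
      go true true true true true true = refl

    ∑-+ : (φ ψ : Edge n → ℕ) (es : List (Edge n)) → ∑ (λ e → φ e + ψ e) es ≡ ∑ φ es + ∑ ψ es
    ∑-+ φ ψ [] = refl
    ∑-+ φ ψ (e ∷ es) rewrite ∑-+ φ ψ es = lemma (φ e) (ψ e) (∑ φ es) (∑ ψ es)
      where
      lemma : ∀ a b c d → (a + b) + (c + d) ≡ (a + c) + (b + d)
      lemma = solve-∀

    ∑-cong : {φ ψ : Edge n → ℕ} → (∀ e → φ e ≡ ψ e) → ∀ es → ∑ φ es ≡ ∑ ψ es
    ∑-cong eq es = ∑-cong-live _ _ es λ e _ _ → eq e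

    -- a, b: the edges crossing exactly one of the cuts; g: the edges crossing both.
    count : ∀ a₀ a₁ b₀ b₁ g₀ g₁ → a₀ + (a₁ + (g₀ + g₁)) ≤ 1 → b₀ + (b₁ + (g₀ + g₁)) ≤ 1 →
            (a₀ + (b₀ + g₀) ≡ 0 ⊎ a₁ + (b₀ + g₁) ≡ 0) ⊎ (a₀ + (b₁ + g₁) ≡ 0 ⊎ a₁ + (b₁ + g₀) ≡ 0)
    count a₀ a₁ b₀ b₁ g₀ g₁ p q = go (at a₀ p) (at b₀ q)
      where
      at : ∀ m {k} → m + k ≤ 1 → (m ≡ 0 × k ≤ 1) ⊎ k ≡ 0
      at zero p = inj₁ (refl , p)
      at (suc m) (s≤s p) = inj₂ (proj₂ (sum-≡0 {m} (ℕ.n≤0⇒n≡0 p)))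
      go : (a₀ ≡ 0 × a₁ + (g₀ + g₁) ≤ 1) ⊎ a₁ + (g₀ + g₁) ≡ 0 → (b₀ ≡ 0 × b₁ + (g₀ + g₁) ≤ 1) ⊎ b₁ + (g₀ + g₁) ≡ 0 →
           (a₀ + (b₀ + g₀) ≡ 0 ⊎ a₁ + (b₀ + g₁) ≡ 0) ⊎ (a₀ + (b₁ + g₁) ≡ 0 ⊎ a₁ + (b₁ + g₀) ≡ 0)
      go (inj₂ eq) (inj₁ (refl , _)) with refl , eq′ ← sum-≡0 {a₁} eq = inj₁ (inj₂ (proj₂ (sum-≡0 {g₀} eq′)))
      go (inj₂ eq) (inj₂ eq′) with refl , eq₁ ← sum-≡0 {a₁} eq | refl , _ ← sum-≡0 {b₁} eq′ =
        inj₂ (inj₂ (proj₁ (sum-≡0 {g₀} eq₁)))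
      go (inj₁ (refl , p)) r with at a₁ p
      go (inj₁ (refl , p)) (inj₁ (refl , _)) | inj₂ eq = inj₁ (inj₁ (proj₁ (sum-≡0 {g₀} eq)))
      go (inj₁ (refl , p)) (inj₂ eq′) | inj₂ eq with refl , _ ← sum-≡0 {b₁} eq′ = inj₂ (inj₁ (proj₂ (sum-≡0 {g₀} eq)))
      go (inj₁ (refl , p)) r | inj₁ (refl , p′) with at g₀ p′
      go (inj₁ (refl , p)) (inj₁ (refl , _)) | inj₁ (refl , p′) | inj₁ (refl , _) = inj₁ (inj₁ refl)
      go (inj₁ (refl , p)) (inj₁ (refl , _)) | inj₁ (refl , p′) | inj₂ eq = inj₁ (inj₂ eq)
      go (inj₁ (refl , p)) (inj₂ eq) | inj₁ (refl , p′) | _ with refl , eq′ ← sum-≡0 {b₁} eq =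
        inj₂ (inj₂ (proj₁ (sum-≡0 {g₀} eq′)))

  missed-quadrant : (es : List (Edge n)) → ∑ (cut c) es ≤ 1 → ∑ (cut d) es ≤ 1 →
                    ∃₂ λ i j → ∑ (cut (quadrant c d i j)) es ≡ 0
  missed-quadrant es small-c small-d = choose (count (∑ (α false) es) (∑ (α true) es) (∑ (β false) es) (∑ (β true) es)
      (∑ (γ false) es) (∑ (γ true) es)
      (subst (_≤ 1) (trans (∑-cong cut-c es) (split₄ (α false) (α true) (γ false) (γ true))) small-c)
      (subst (_≤ 1) (trans (∑-cong cut-d es) (split₄ (β false) (β true) (γ false) (γ true))) small-d))
    where
    split₃ : ∀ φ ψ χ → ∑ (λ e → φ e + (ψ e + χ e)) es ≡ ∑ φ es + (∑ ψ es + ∑ χ es)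
    split₃ φ ψ χ = trans (∑-+ φ _ es) (cong (∑ φ es +_) (∑-+ ψ χ es))
    split₄ : ∀ φ ψ χ ω → ∑ (λ e → φ e + (ψ e + (χ e + ω e))) es ≡ ∑ φ es + (∑ ψ es + (∑ χ es + ∑ ω es))
    split₄ φ ψ χ ω = trans (∑-+ φ _ es) (cong (∑ φ es +_) (split₃ ψ χ ω))
    crossing : ∀ i j → ∑ (cut (quadrant c d i j)) es ≡ ∑ (α j) es + (∑ (β i) es + ∑ (γ (i xor j)) es)
    crossing i j = trans (∑-cong (cut-quadrant i j) es) (split₃ (α j) (β i) (γ (i xor j)))
    choose : _ → ∃₂ λ i j → ∑ (cut (quadrant c d i j)) es ≡ 0
    choose (inj₁ (inj₁ eq)) = false , false , trans (crossing false false) eq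
    choose (inj₁ (inj₂ eq)) = false , true , trans (crossing false true) eq
    choose (inj₂ (inj₁ eq)) = true , false , trans (crossing true false) eq
    choose (inj₂ (inj₂ eq)) = true , true , trans (crossing true true) eq

module _ {x y x₁ x₂ y₁ y₂ : Fin n} {s₁ r₁ sf rf s₂ r₂ t₁ u₁ t₂ u₂ : Bool} {R : List (Edge n)}
         (h : Hub x y x₁ x₂ y₁ y₂ R)
         (conn : TwoEdgeConnected (edge x x₁ s₁ r₁ ∷ edge x y sf rf ∷ edge x x₂ s₂ r₂ ∷
                                   edge y y₁ t₁ u₁ ∷ edge y y₂ t₂ u₂ ∷ R)) where
  private
    pairing : Fin n → Fin n → List (Edge n)
    pairing a b = edge x₁ a false false ∷ edge x₂ b false false ∷ R

    swapped : TwoEdgeConnected (edge x x₁ s₁ r₁ ∷ edge x y sf rf ∷ edge x x₂ s₂ r₂ ∷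
                                edge y y₂ t₂ u₂ ∷ edge y y₁ t₁ u₁ ∷ R)
    swapped = TwoEdgeConnected-≈ (≈-prep (≈-prep (≈-prep ≈-swap))) conn

    cell : Bool → Bool → Bool → Bool → Bool
    cell i j C D = not (C xor i) ∧ not (D xor j)

    one-true : ∀ C D i j →
      ⟦ cell i j C D ⟧ + (⟦ cell i j (not C) (not D) ⟧ + (⟦ cell i j C (not D) ⟧ + (⟦ cell i j (not C) D ⟧ + 0))) ≤ 1 ×
      (cell i j C D ≡ cell i j (not C) (not D) → cell i j C D ≡ cell i j C (not D) → cell i j C D ≡ cell i j (not C) D → ⊥)
    one-true false false false false = s≤s z≤n , λ ()
    one-true false false false true = s≤s z≤n , λ _ ()
    one-true false false true false = s≤s z≤n , λ _ _ ()
    one-true false false true true = s≤s z≤n , λ ()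
    one-true false true false false = s≤s z≤n , λ _ ()
    one-true false true false true = s≤s z≤n , λ ()
    one-true false true true false = s≤s z≤n , λ ()
    one-true false true true true = s≤s z≤n , λ _ _ ()
    one-true true false false false = s≤s z≤n , λ _ _ ()
    one-true true false false true = s≤s z≤n , λ ()
    one-true true false true false = s≤s z≤n , λ ()
    one-true true false true true = s≤s z≤n , λ _ ()
    one-true true true false false = s≤s z≤n , λ ()
    one-true true true false true = s≤s z≤n , λ _ _ ()
    one-true true true true false = s≤s z≤n , λ _ ()
    one-true true true true true = s≤s z≤n , λ ()

    -- A quadrant contains exactly one of x₁, x₂, y₁, y₂, so it has a second boundary edge in the hub, which lies in R.
    quadrants-met : (c d : Fin n → Bool) → c y₁ ≡ c x₁ → c x₂ ≡ not (c x₁) → c y₂ ≡ not (c x₁) →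
                    d y₂ ≡ d x₁ → d x₂ ≡ not (d x₁) → d y₁ ≡ not (d x₁) →
                    ∀ i j → ∑ (cut (quadrant c d i j)) R ≢ 0
    quadrants-met c d cy₁ cx₂ cy₂ dy₂ dx₂ dy₁ i j none =
      proj₂ (one-true (c x₁) (d x₁) i j)
        (trans (same x₁-live x₂-live) at-x₂) (trans (same x₁-live y₁-live) at-y₁) (trans (same x₁-live y₂-live) at-y₂)
      where
      at-x₂ = cong₂ (cell i j) cx₂ dx₂
      at-y₁ = cong₂ (cell i j) cy₁ dy₁
      at-y₂ = cong₂ (cell i j) cy₂ dy₂
      small : ⟦ quadrant c d i j x₁ ⟧ + (0 + (⟦ quadrant c d i j x₂ ⟧ + (⟦ quadrant c d i j y₁ ⟧ +
                (⟦ quadrant c d i j y₂ ⟧ + ∑ (cut (quadrant c d i j)) R)))) ≤ 1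
      small = subst (_≤ 1) (cong (⟦ quadrant c d i j x₁ ⟧ +_) (sym (cong₂ _+_ (cong ⟦_⟧ at-x₂)
                (cong₂ _+_ (cong ⟦_⟧ at-y₁) (cong₂ _+_ (cong ⟦_⟧ at-y₂) none)))))
                (proj₁ (one-true (c x₁) (d x₁) i j))
      same : ∀ {v w} → deg v (pairing y₁ y₂) ≢ 0 → deg w (pairing y₁ y₂) ≢ 0 → quadrant c d i j v ≡ quadrant c d i j w
      same = hub-constant h conn false false (quadrant c d i j) small
      x₁-live : deg x₁ (pairing y₁ y₂) ≢ 0
      x₁-live eq = δ-0 (proj₁ (sum-≡0 (proj₁ (sum-≡0 eq)))) refl
      y₁-live : deg y₁ (pairing y₁ y₂) ≢ 0
      y₁-live eq = δ-0 (proj₂ (sum-≡0 {δ y₁ x₁} (proj₁ (sum-≡0 eq)))) refl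
      x₂-live : deg x₂ (pairing y₁ y₂) ≢ 0
      x₂-live eq = δ-0 (proj₁ (sum-≡0 (proj₁ (sum-≡0 (proj₂ (sum-≡0 {δ x₂ x₁ + δ x₂ y₁} eq)))))) refl
      y₂-live : deg y₂ (pairing y₁ y₂) ≢ 0
      y₂-live eq = δ-0 (proj₂ (sum-≡0 {δ y₂ x₂} (proj₁ (sum-≡0 (proj₂ (sum-≡0 {δ y₂ x₁ + δ y₂ y₁} eq)))))) refl

  -- If both pairings fail, the bad cut c of the first separates x₁, y₁ from x₂, y₂, and the bad cut
  -- d of the second separates x₁, y₂ from x₂, y₁, as they would extend to the hub otherwise. Each
  -- has at most one edge in `R`, so some quadrant of c and d has no boundary edge in `R`. But it
  -- contains exactly one of the four neighbours, whose edge to x or y would be a bridge.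
  frink : TwoEdgeConnected (pairing y₁ y₂) ⊎ TwoEdgeConnected (pairing y₂ y₁)
  frink with twoEdgeConnected? (pairing y₁ y₂) | twoEdgeConnected? (pairing y₂ y₁)
  ... | inj₁ good | _ = inj₁ good
  ... | inj₂ _ | inj₁ good = inj₂ good
  ... | inj₂ (c , small-c , v , w , v-live , w-live , ne) | inj₂ (d , small-d , v′ , w′ , v′-live , w′-live , ne′)
    with extend-cut (c x₁) (c x₂) (c y₁) (c y₂) (∑ (cut c) R) small-c
       | extend-cut (d x₁) (d x₂) (d y₂) (d y₁) (∑ (cut d) R) small-d
  ... | inj₁ (p , q , small) | _ = ⊥-elim (ne (hub-constant h conn p q c small v-live w-live))
  ... | inj₂ _ | inj₁ (p , q , small) = ⊥-elim (ne′ (hub-constant (hub-swap h) swapped p q d small v′-live w′-live))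
  ... | inj₂ (cy₁ , cx₂ , cy₂ , small) | inj₂ (dy₂ , dx₂ , dy₁ , small′)
    with i , j , none ← missed-quadrant c d R small small′ = ⊥-elim (quadrants-met c d cy₁ cx₂ cy₂ dy₂ dx₂ dy₁ i j none)

-- Parities, and lifting factors through the reductions

odd : ℕ → Bool
odd zero = false
odd (suc m) = not (odd m)

odd-⟦⟧ : ∀ b → odd ⟦ b ⟧ ≡ b
odd-⟦⟧ false = refl
odd-⟦⟧ true = refl

odd-+ : ∀ m k → odd (m + k) ≡ odd m xor odd k
odd-+ zero k = refl
odd-+ (suc m) k = trans (cong not (odd-+ m k)) (𝔹.not-distribˡ-xor (odd m) (odd k))

odd-∷ : ∀ b m → odd (⟦ b ⟧ + m) ≡ b xor odd m
odd-∷ b m = trans (odd-+ ⟦ b ⟧ m) (cong (_xor odd m) (odd-⟦⟧ b))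

oddly : List (Edge n) → Bool
oddly N = odd (∑ negative N)

oddly-∷ : (e : Edge n) (N : List (Edge n)) → oddly (e ∷ N) ≡ sgn e xor oddly N
oddly-∷ e N = odd-∷ (sgn e) (∑ negative N)

-- es arises from es′ by inserting the two cubic vertices x and y, and N from N′ by inserting them with degree 2.
record Inserts {n : ℕ} (x y : Fin n) (es es′ : List (Edge n)) : Set where
  constructor inserts
  field
    distinct : x ≢ y
    x-new : deg x es′ ≡ 0
    y-new : deg y es′ ≡ 0
    degree : ∀ v → deg v es ≡ deg v es′ + (3 * δ v x + 3 * δ v y)

record Lifts {n : ℕ} (x y : Fin n) (es N′ : List (Edge n)) : Set where
  constructor lifts
  field
    {N} : List (Edge n)
    select : Select es N
    degree : ∀ v → deg v N ≡ deg v N′ + (2 * δ v x + 2 * δ v y)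
    parity : oddly N ≡ oddly N′

module _ {x y : Fin n} {es es′ : List (Edge n)} (ins : Inserts x y es es′) where
  open Inserts ins

  private
    at-x : ∀ k → k * δ x x + k * δ x y ≡ k
    at-x k = trans (cong₂ (λ a b → k * a + k * b) (δ-refl x) (δ-≢ distinct)) (lemma k)
      where
      lemma : ∀ k → k * 1 + k * 0 ≡ k
      lemma = solve-∀

    at-y : ∀ k → k * δ y x + k * δ y y ≡ k
    at-y k = trans (cong₂ (λ a b → k * a + k * b) (δ-≢ (distinct ∘ sym)) (δ-refl y)) (lemma k)
      where
      lemma : ∀ k → k * 0 + k * 1 ≡ k
      lemma = solve-∀

    elsewhere : ∀ k m {v} → v ≢ x → v ≢ y → m + (k * δ v x + k * δ v y) ≡ m
    elsewhere k m p q = trans (cong₂ (λ a b → m + (k * a + k * b)) (δ-≢ p) (δ-≢ q)) (lemma k m)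
      where
      lemma : ∀ k m → m + (k * 0 + k * 0) ≡ m
      lemma = solve-∀

  Cubic-reduced : Cubic es → Cubic es′
  Cubic-reduced cubic .degrees v with v ≟ x | v ≟ y
  ... | yes refl | _ = inj₁ x-new
  ... | no _ | yes refl = inj₁ y-new
  ... | no p | no q = subst (λ d → d ≡ 0 ⊎ d ≡ 3) (trans (degree v) (elsewhere 3 (deg v es′) p q)) (cubic .degrees v)

  Factor-lift : {Z : Fin n → Set} {N N′ : List (Edge n)} → Select es′ N′ →
                (∀ v → deg v N ≡ deg v N′ + (2 * δ v x + 2 * δ v y)) → Factor Z es′ N′ → Factor Z es N
  Factor-lift {N′ = N′} S degN factor .covers v with v ≟ x | v ≟ y
  ... | yes refl | _ = inj₁ (trans (degN x) (cong₂ _+_ (Select-zero S x-new) (at-x 2)))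
  ... | no _ | yes refl = inj₁ (trans (degN y) (cong₂ _+_ (Select-zero S y-new) (at-y 2)))
  ... | no p | no q with factor .covers v
  ...   | inj₁ eq = inj₁ (trans (degN v) (trans (elsewhere 2 (deg v N′) p q) eq))
  ...   | inj₂ (eq , inj₁ dead) = inj₂ (trans (degN v) (trans (elsewhere 2 (deg v N′) p q) eq) ,
                                        inj₁ (trans (degree v) (trans (elsewhere 3 (deg v es′) p q) dead)))
  ...   | inj₂ (eq , inj₂ z) = inj₂ (trans (degN v) (trans (elsewhere 2 (deg v N′) p q) eq) , inj₂ z)

hub-inserts : {x y x₁ x₂ y₁ y₂ : Fin n} {s₁ r₁ sf rf s₂ r₂ t₁ u₁ t₂ u₂ s r s′ r′ : Bool} {R : List (Edge n)} →
  Hub x y x₁ x₂ y₁ y₂ R →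
  Inserts x y (edge x x₁ s₁ r₁ ∷ edge x y sf rf ∷ edge x x₂ s₂ r₂ ∷ edge y y₁ t₁ u₁ ∷ edge y y₂ t₂ u₂ ∷ R)
              (edge x₁ y₁ s r ∷ edge x₂ y₂ s′ r′ ∷ R)
hub-inserts h = inserts (Hub.x≢y h) (reduced-x h {false} {false} {false} {false} {false} {false} {false} {false} {false} {false})
  (reduced-y h {false} {false} {false} {false} {false} {false} {false} {false} {false} {false})
  (deg-hub h {false} {false} {false} {false} {false} {false} {false} {false} {false} {false})

-- Each new edge has the sign of the path of length 3 that it replaces. If the factor uses x₁y₁
-- only, this edge is expanded into the path x₁xyy₁. If it uses both new edges, they become x₁xx₂
-- and y₁yy₂, and `sf`, counted twice, cancels. Both lifts contain xx₁ and yy₁; the mark `r₂ ∨ u₂`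
-- forces the second case as soon as xx₂ or yy₂ is required.
hub-lift : {x y x₁ x₂ y₁ y₂ : Fin n} {s₁ r₁ sf s₂ r₂ t₁ u₁ t₂ u₂ : Bool} {R N′ : List (Edge n)} →
  Select (edge x₁ y₁ (s₁ xor (sf xor t₁)) true ∷ edge x₂ y₂ (s₂ xor (sf xor t₂)) (r₂ ∨ u₂) ∷ R) N′ →
  Lifts x y (edge x x₁ s₁ r₁ ∷ edge x y sf false ∷ edge x x₂ s₂ r₂ ∷ edge y y₁ t₁ u₁ ∷ edge y y₂ t₂ u₂ ∷ R) N′
hub-lift {x = x} {y} {x₁} {x₂} {y₁} {y₂} {s₁} {r₁} {sf} {s₂} {r₂} {t₁} {u₁} {t₂} {u₂} (keep (keep {N = N} S)) =
  lifts (keep (drop refl (keep (keep (keep S))))) (λ v → lemma (δ v x) (δ v y) (δ v x₁) (δ v x₂) (δ v y₁) (δ v y₂) (deg v N)) signs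
  where
  lemma : ∀ a b c d e f r → (a + c) + ((a + d) + ((b + e) + ((b + f) + r))) ≡ ((c + e) + ((d + f) + r)) + (2 * a + 2 * b)
  lemma = solve-∀
  signs : oddly (edge x x₁ s₁ r₁ ∷ edge x x₂ s₂ r₂ ∷ edge y y₁ t₁ u₁ ∷ edge y y₂ t₂ u₂ ∷ N) ≡
          oddly (edge x₁ y₁ (s₁ xor (sf xor t₁)) true ∷ edge x₂ y₂ (s₂ xor (sf xor t₂)) (r₂ ∨ u₂) ∷ N)
  signs rewrite odd-∷ s₁ (⟦ s₂ ⟧ + (⟦ t₁ ⟧ + (⟦ t₂ ⟧ + ∑ negative N))) | odd-∷ s₂ (⟦ t₁ ⟧ + (⟦ t₂ ⟧ + ∑ negative N))
              | odd-∷ t₁ (⟦ t₂ ⟧ + ∑ negative N) | odd-∷ t₂ (∑ negative N)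
              | odd-∷ (s₁ xor (sf xor t₁)) (⟦ s₂ xor (sf xor t₂) ⟧ + ∑ negative N)
              | odd-∷ (s₂ xor (sf xor t₂)) (∑ negative N) =
    solve 6 (λ a f c d e m → (a :+ (c :+ (d :+ (e :+ m)))) := ((a :+ (f :+ d)) :+ ((c :+ (f :+ e)) :+ m))) refl
      s₁ sf s₂ t₁ t₂ (oddly N)
    where open xor-∧-Solver
hub-lift {x = x} {y} {x₁} {x₂} {y₁} {y₂} {s₁} {r₁} {sf} {s₂} {false} {t₁} {u₁} {t₂} {false} (keep (drop {N = N} refl S)) =
  lifts (keep (keep (drop refl (keep (drop refl S))))) (λ v → lemma (δ v x) (δ v y) (δ v x₁) (δ v y₁) (deg v N)) signs
  where
  lemma : ∀ a b c e r → (a + c) + ((a + b) + ((b + e) + r)) ≡ ((c + e) + r) + (2 * a + 2 * b)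
  lemma = solve-∀
  signs : oddly (edge x x₁ s₁ r₁ ∷ edge x y sf false ∷ edge y y₁ t₁ u₁ ∷ N) ≡
          oddly (edge x₁ y₁ (s₁ xor (sf xor t₁)) true ∷ N)
  signs rewrite odd-∷ s₁ (⟦ sf ⟧ + (⟦ t₁ ⟧ + ∑ negative N)) | odd-∷ sf (⟦ t₁ ⟧ + ∑ negative N)
              | odd-∷ t₁ (∑ negative N) | odd-∷ (s₁ xor (sf xor t₁)) (∑ negative N) =
    solve 4 (λ a f d m → (a :+ (f :+ (d :+ m))) := ((a :+ (f :+ d)) :+ m)) refl s₁ sf t₁ (oddly N)
    where open xor-∧-Solver

-- x and y are joined by two parallel edges, and u, w are their third neighbours. The reduction
-- replaces all four edges by a single edge uw.
record Digon {n : ℕ} (x y u w : Fin n) (R : List (Edge n)) : Set where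
  constructor digon
  field
    x≢y : x ≢ y
    x≢u : x ≢ u
    y≢u : y ≢ u
    x≢w : x ≢ w
    y≢w : y ≢ w
    x∉R : deg x R ≡ 0
    y∉R : deg y R ≡ 0

module _ {x y u w : Fin n} {R : List (Edge n)} (dig : Digon x y u w R) where
  open Digon dig

  digon-inserts : ∀ {s₀ r₀ s₁ r₁ s₂ r₂ t v s r} →
    Inserts x y (edge x u s₀ r₀ ∷ edge x y s₁ r₁ ∷ edge x y s₂ r₂ ∷ edge y w t v ∷ R) (edge u w s r ∷ R)
  digon-inserts = inserts x≢y (cong₂ _+_ (cong₂ _+_ (δ-≢ x≢u) (δ-≢ x≢w)) x∉R) (cong₂ _+_ (cong₂ _+_ (δ-≢ y≢u) (δ-≢ y≢w)) y∉R)
    λ v → lemma (δ v x) (δ v y) (δ v u) (δ v w) (deg v R)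
    where
    lemma : ∀ a b c d r → (a + c) + ((a + b) + ((a + b) + ((b + d) + r))) ≡ ((c + d) + r) + (3 * a + 3 * b)
    lemma = solve-∀

  -- If x and y get the colour of u, then yw is cut exactly when the new edge uw is, and the other
  -- three edges are not cut.
  digon-connected : ∀ {s₀ r₀ s₁ r₁ s₂ r₂ t v} →
    TwoEdgeConnected (edge x u s₀ r₀ ∷ edge x y s₁ r₁ ∷ edge x y s₂ r₂ ∷ edge y w t v ∷ R) →
    TwoEdgeConnected (edge u w false false ∷ R)
  digon-connected conn .constant c small v v′ v-live v′-live =
    trans (sym (fixes v-live)) (trans (conn .constant c′ (subst (_≤ 1) (sym cuts) small) v v′ (lives v-live) (lives v′-live))
                                      (fixes v′-live))
    where
    c′ : Fin _ → Bool
    c′ = recolour x y (c u) (c u) c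
    ins : Inserts x y (edge x u false false ∷ edge x y false false ∷ edge x y false false ∷ edge y w false false ∷ R)
                      (edge u w false false ∷ R)
    ins = digon-inserts
    fixes : ∀ {v} → deg v (edge u w false false ∷ R) ≢ 0 → c′ v ≡ c v
    fixes = recolour-live {x = x} {y} {c u} {c u} {c} (edge u w false false ∷ R) (Inserts.x-new ins) (Inserts.y-new ins)
    lives : ∀ {v} → deg v (edge u w false false ∷ R) ≢ 0 →
            deg v (edge x u false false ∷ edge x y false false ∷ edge x y false false ∷ edge y w false false ∷ R) ≢ 0
    lives {v} nz eq = nz (proj₁ (sum-≡0 (trans (sym (Inserts.degree ins v)) eq)))
    cx : c′ x ≡ c u
    cx = recolour-x {x = x} {y} {c u} {c u} {c}
    cy : c′ y ≡ c u
    cy = recolour-y {x = x} {y} {c u} {c u} {c} x≢y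
    same : ∀ a b → c′ a ≡ c u → c′ b ≡ c u → ⟦ c′ a xor c′ b ⟧ ≡ 0
    same a b p q = cong ⟦_⟧ (trans (cong₂ _xor_ p q) (𝔹.xor-same (c u)))
    cuts : ∑ (cut c′) (edge x u false false ∷ edge x y false false ∷ edge x y false false ∷ edge y w false false ∷ R) ≡
           ∑ (cut c) (edge u w false false ∷ R)
    cuts = cong₂ _+_ (same x u cx (recolour-≢ {x = x} {y} {c u} {c u} {c} x≢u y≢u)) (cong₂ _+_ (same x y cx cy) (cong₂ _+_ (same x y cx cy)
             (cong₂ _+_ (cong ⟦_⟧ (cong₂ _xor_ cy (recolour-≢ {x = x} {y} {c u} {c u} {c} x≢w y≢w)))
                        (cut-recolour {x = x} {y} {c u} {c u} {c} R x∉R y∉R))))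

  digon-lift : ∀ {s₀ r₀ s₁ r₁ s₂ t v N′} →
    Select (edge u w (s₀ xor (s₁ xor t)) true ∷ R) N′ →
    Lifts x y (edge x u s₀ r₀ ∷ edge x y s₁ r₁ ∷ edge x y s₂ false ∷ edge y w t v ∷ R) N′
  digon-lift {s₀} {r₀} {s₁} {r₁} {s₂} {t} {v} (keep {N = N} S) =
    lifts (keep (keep (drop refl (keep S)))) (λ v → lemma (δ v x) (δ v y) (δ v u) (δ v w) (deg v N)) signs
    where
    lemma : ∀ a b c d r → (a + c) + ((a + b) + ((b + d) + r)) ≡ ((c + d) + r) + (2 * a + 2 * b)
    lemma = solve-∀
    signs : oddly (edge x u s₀ r₀ ∷ edge x y s₁ r₁ ∷ edge y w t v ∷ N) ≡ oddly (edge u w (s₀ xor (s₁ xor t)) true ∷ N)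
    signs rewrite odd-∷ s₀ (⟦ s₁ ⟧ + (⟦ t ⟧ + ∑ negative N)) | odd-∷ s₁ (⟦ t ⟧ + ∑ negative N)
                | odd-∷ t (∑ negative N) | odd-∷ (s₀ xor (s₁ xor t)) (∑ negative N) =
      solve 4 (λ a f d m → (a :+ (f :+ (d :+ m))) := ((a :+ (f :+ d)) :+ m)) refl s₀ s₁ t (oddly N)
      where open xor-∧-Solver

no-edges : (R : List (Edge n)) → (∀ v → deg v R ≡ 0) → R ≡ []
no-edges [] dead = refl
no-edges (edge a b s r ∷ R) dead = ⊥-elim (δ-0 (proj₁ (sum-≡0 (proj₁ (sum-≡0 (dead a))))) refl)

-- The three edges use up the degrees of x and y, so no edge leaves this pair, and by connectedness
-- nothing else is there.
theta-alone : {x y : Fin n} {s₀ r₀ s₁ r₁ s₂ r₂ : Bool} {R : List (Edge n)} → x ≢ y →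
  Cubic (edge x y s₀ r₀ ∷ edge x y s₁ r₁ ∷ edge x y s₂ r₂ ∷ R) →
  TwoEdgeConnected (edge x y s₀ r₀ ∷ edge x y s₁ r₁ ∷ edge x y s₂ r₂ ∷ R) → deg x R ≡ 0 → R ≡ []
theta-alone {n} {x} {y} {R = R} x≢y cubic conn x∉R = no-edges R dead
  where
  H : List (Edge n)
  H = edge x y false false ∷ edge x y false false ∷ edge x y false false ∷ R
  three : deg y H ≡ 3 + deg y R
  three = cong (λ t → t + (t + (t + deg y R))) (cong₂ _+_ (δ-≢ (x≢y ∘ sym)) (δ-refl y))
  y∉R : deg y R ≡ 0
  y∉R with cubic .degrees y
  ... | inj₁ eq = ⊥-elim (case trans (sym three) eq of λ ())
  ... | inj₂ eq = ℕ.suc-injective (ℕ.suc-injective (ℕ.suc-injective (trans (sym three) eq)))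
  c : Fin n → Bool
  c = recolour x y true true (λ _ → false)
  cx : c x ≡ true
  cx = recolour-x {x = x} {y} {true} {true} {λ _ → false}
  cy : c y ≡ true
  cy = recolour-y {x = x} {y} {true} {true} {λ _ → false} x≢y
  uncut : ∑ (cut c) H ≡ 0
  uncut = cong₂ _+_ flat (cong₂ _+_ flat (cong₂ _+_ flat
            (trans (cut-recolour {x = x} {y} {true} {true} {λ _ → false} R x∉R y∉R) (cut-constant false R))))
    where
    flat : ⟦ c x xor c y ⟧ ≡ 0
    flat = cong ⟦_⟧ (cong₂ _xor_ cx cy)
  x-live : deg x H ≢ 0
  x-live eq = δ-0 (proj₁ (sum-≡0 (proj₁ (sum-≡0 eq)))) refl
  dead : ∀ v → deg v R ≡ 0
  dead v with deg v R ℕ.≟ 0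
  ... | yes eq = eq
  ... | no nz = ⊥-elim (case trans (sym cx) (trans (conn .constant c (ℕ.≤-trans (ℕ.≤-reflexive uncut) z≤n) x v x-live
                              (nz ∘ λ eq → proj₂ (sum-≡0 {inc v (edge x y false false)} (proj₂ (sum-≡0 {inc v (edge x y false false)}
                                 (proj₂ (sum-≡0 {inc v (edge x y false false)} eq)))))))
                              (recolour-live {x = x} {y} {true} {true} {λ _ → false} R x∉R y∉R nz)) of λ ())

record Corner {n : ℕ} (x x₁ : Fin n) (R : List (Edge n)) : Set where
  constructor corner
  field
    {y x₂} : Fin n
    {sf s₂ r₂} : Bool
    {R₂} : List (Edge n)
    split : R ≈ edge x y sf false ∷ edge x x₂ s₂ r₂ ∷ R₂
    x≢x₁ : x ≢ x₁
    x≢y : x ≢ y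
    x≢x₂ : x ≢ x₂
    x∉R₂ : deg x R₂ ≡ 0
    few : ⟦ r₂ ⟧ + ∑ required R₂ ≤ ∑ required R

-- Besides e at most one edge is required, so the two other edges at x are not both required.
corner-of : {x x₁ : Fin n} {s r : Bool} {R : List (Edge n)} → ∑ required R ≤ 1 →
            Cubic (edge x x₁ s r ∷ R) → TwoEdgeConnected (edge x x₁ s r ∷ R) → Corner x x₁ R
corner-of {x = x} {x₁} {R = R} few cubic conn = arrange (star-of cubic conn)
  where
  arrange : Star x x₁ R → Corner x x₁ R
  arrange (star {r = false} p x≢x₁ x≢a x≢b x∉) =
    corner p x≢x₁ x≢a x≢b x∉ (ℕ.≤-reflexive (sym (∑-≈ required-sym p)))
  arrange (star {r = true} {u = false} p x≢x₁ x≢a x≢b x∉) =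
    corner (≈-trans p ≈-swap) x≢x₁ x≢b x≢a x∉ (ℕ.≤-reflexive (sym (∑-≈ required-sym p)))
  arrange (star {r = true} {u = true} p x≢x₁ x≢a x≢b x∉) =
    case subst (_≤ 1) (∑-≈ required-sym p) few of λ { (s≤s ()) }

-- Frink's reduction at f = xy: one of the two ways of joining x₁, x₂ to the other neighbours of y works.
record Reducible {n : ℕ} (x y x₁ x₂ : Fin n) (R₂ : List (Edge n)) : Set where
  constructor reducible
  field
    {y₁ y₂} : Fin n
    {t₁ u₁ t₂ u₂} : Bool
    {R} : List (Edge n)
    split : R₂ ≈ edge y y₁ t₁ u₁ ∷ edge y y₂ t₂ u₂ ∷ R
    isHub : Hub x y x₁ x₂ y₁ y₂ R
    connected : TwoEdgeConnected (edge x₁ y₁ false false ∷ edge x₂ y₂ false false ∷ R)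

module _ {x y x₁ x₂ : Fin n} {s₁ r₁ sf rf s₂ r₂ : Bool} {R₂ : List (Edge n)}
         (cubic : Cubic (edge x x₁ s₁ r₁ ∷ edge x y sf rf ∷ edge x x₂ s₂ r₂ ∷ R₂))
         (conn : TwoEdgeConnected (edge x x₁ s₁ r₁ ∷ edge x y sf rf ∷ edge x x₂ s₂ r₂ ∷ R₂))
         (x≢x₁ : x ≢ x₁) (x≢y : x ≢ y) (x≢x₂ : x ≢ x₂) (x∉R₂ : deg x R₂ ≡ 0) (y≢x₁ : y ≢ x₁) where

  private
    shift : ∀ {e R′} → R₂ ≈ e ∷ R′ →
            ∃ λ R″ → edge x x₁ s₁ r₁ ∷ edge x y sf rf ∷ edge x x₂ s₂ r₂ ∷ R₂ ≈ e ∷ R″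
    shift p = _ , ≈-trans (≈-prep (≈-prep (≈-prep p))) (≈-trans (≈-prep (≈-prep ≈-swap)) (≈-trans (≈-prep ≈-swap) ≈-swap))

    away : ∀ {a b s t} {e : Edge n} {R′} → R₂ ≈ edge y a s t ∷ e ∷ R′ → e ≡ edge y b (sgn e) (req e) →
           x ≢ a × x ≢ b × deg x R′ ≡ 0
    away {a} {b} p refl with sum-≡0 {inc x (edge y a false false)} (trans (sym (deg-≈ p x)) x∉R₂)
    ... | e₁ , e₂ with sum-≡0 {inc x (edge y b false false)} e₂
    ...   | e₃ , e₄ = δ-0 (proj₂ (sum-≡0 {δ x y} e₁)) , δ-0 (proj₂ (sum-≡0 {δ x y} e₃)) , e₄

  reduce-hub : y ≢ x₂ → Reducible x y x₁ x₂ R₂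
  reduce-hub y≢x₂ = build (star-at y x _ R₂ (x≢y ∘ sym) cubic conn shift (two (cubic .degrees y)))
    where
    one-left : deg y (edge x x₁ s₁ r₁ ∷ edge x y sf rf ∷ edge x x₂ s₂ r₂ ∷ R₂) ≡ suc (deg y R₂)
    one-left = trans (deg-none {R = edge x y sf rf ∷ edge x x₂ s₂ r₂ ∷ R₂} (x≢y ∘ sym) y≢x₁)
      (trans (cong (_+ deg y (edge x x₂ s₂ r₂ ∷ R₂)) (cong₂ _+_ (δ-≢ (x≢y ∘ sym)) (δ-refl y)))
             (cong suc (deg-none {R = R₂} (x≢y ∘ sym) y≢x₂)))
    two : deg y (edge x x₁ s₁ r₁ ∷ edge x y sf rf ∷ edge x x₂ s₂ r₂ ∷ R₂) ≡ 0 ⊎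
          deg y (edge x x₁ s₁ r₁ ∷ edge x y sf rf ∷ edge x x₂ s₂ r₂ ∷ R₂) ≡ 3 → deg y R₂ ≡ 2
    two (inj₁ eq) = ⊥-elim (case trans (sym one-left) eq of λ ())
    two (inj₂ eq) = ℕ.suc-injective (trans (sym one-left) eq)
    build : Star y x R₂ → Reducible x y x₁ x₂ R₂
    build (star {a} {b} {R₂ = R} p _ y≢a y≢b y∉R) with away p refl
    ... | x≢a , x≢b , x∉R = orient (frink h (TwoEdgeConnected-≈ (≈-prep (≈-prep (≈-prep p))) conn))
      where
      h : Hub x y x₁ x₂ a b R
      h = record { x≢y = x≢y ; x≢x₁ = x≢x₁ ; x≢x₂ = x≢x₂ ; x≢y₁ = x≢a ; x≢y₂ = x≢b
                 ; y≢x₁ = y≢x₁ ; y≢x₂ = y≢x₂ ; y≢y₁ = y≢a ; y≢y₂ = y≢b ; x∉R = x∉R ; y∉R = y∉R }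
      orient : _ → Reducible x y x₁ x₂ R₂
      orient (inj₁ good) = reducible p h good
      orient (inj₂ good) = reducible (≈-trans p ≈-swap) (hub-swap h) good

  record DigonAt : Set where
    constructor digonAt
    field
      {w} : Fin n
      {t v} : Bool
      {R} : List (Edge n)
      split : R₂ ≈ edge y w t v ∷ R
      isDigon : Digon x y x₁ w R

  reduce-digon : y ≡ x₂ → DigonAt
  reduce-digon refl = build (extract-at y R₂ (λ z → case trans (sym z) one of λ ()))
    where
    two-there : deg y (edge x x₁ s₁ r₁ ∷ edge x y sf rf ∷ edge x y s₂ r₂ ∷ R₂) ≡ 2 + deg y R₂
    two-there = trans (deg-none {R = edge x y sf rf ∷ edge x y s₂ r₂ ∷ R₂} (x≢y ∘ sym) y≢x₁)
      (cong (λ t → t + (t + deg y R₂)) (cong₂ _+_ (δ-≢ (x≢y ∘ sym)) (δ-refl y)))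
    one : deg y R₂ ≡ 1
    one with cubic .degrees y
    ... | inj₁ eq = ⊥-elim (case trans (sym two-there) eq of λ ())
    ... | inj₂ eq = ℕ.suc-injective (ℕ.suc-injective (trans (sym two-there) eq))
    build : (∃₂ λ w t → ∃₂ λ v R → R₂ ≈ edge y w t v ∷ R) → DigonAt
    build (w , t , v , R , p) = digonAt p (digon x≢y x≢x₁ y≢x₁ (δ-0 (proj₂ (sum-≡0 {δ x y} (proj₁ x-sum)))) y≢w (proj₂ x-sum)
        (ℕ.suc-injective (trans (sym (deg-one {R = R} y≢w)) (trans (sym (deg-≈ p y)) one))))
      where
      y≢w : y ≢ w
      y≢w = loopless (Cubic-≈ (proj₂ (shift p)) cubic) (TwoEdgeConnected-≈ (proj₂ (shift p)) conn)
      x-sum = sum-≡0 {inc x (edge y w false false)} (trans (sym (deg-≈ p x)) x∉R₂)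

-- 2-factors through prescribed edges

record TwoFactor {n : ℕ} (es : List (Edge n)) : Set where
  constructor twoFactor
  field
    {N} : List (Edge n)
    select : Select es N
    factor : Factor (λ _ → ⊥) es N

TwoFactor-≈ : {es fs : List (Edge n)} → es ≈ fs → TwoFactor fs → TwoFactor es
TwoFactor-≈ p (twoFactor S F) with Select-≈ p S
... | N , S′ , q = twoFactor S′ (Factor-≈ p q F)

TwoFactor-lift : {x y : Fin n} {es es′ : List (Edge n)} → Inserts x y es es′ →
                 (∀ {N′} → Select es′ N′ → Lifts x y es N′) → TwoFactor es′ → TwoFactor es
TwoFactor-lift ins lift (twoFactor S F) = twoFactor select (Factor-lift ins S degree F)
  where open Lifts (lift S)

-- The edge at which the reduction takes place: a required one if there is any, which leaves at most
-- one more.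
pick : (es : List (Edge n)) → ∑ required es ≤ 2 → es ≡ [] ⊎ ∃₂ λ e R → es ≈ e ∷ R × ∑ required R ≤ 1
pick [] few = inj₁ refl
pick (e ∷ es) few with ∑ required (e ∷ es) ℕ.≟ 0
... | yes none = inj₂ (e , es , ≈-refl , subst (_≤ 1) (sym (proj₂ (sum-≡0 {required e} none))) z≤n)
... | no some with extract required (e ∷ es) some
...   | f , R , p , nz = inj₂ (f , R , p , bound (required f) nz (subst (_≤ 2) (∑-≈ required-sym p) few))
  where
  bound : ∀ m {k} → m ≢ 0 → m + k ≤ 2 → k ≤ 1
  bound zero nz _ = ⊥-elim (nz refl)
  bound (suc m) _ (s≤s q) = ℕ.≤-trans (ℕ.m≤n+m _ m) q

∨-≤ : ∀ a b → ⟦ a ∨ b ⟧ ≤ ⟦ a ⟧ + ⟦ b ⟧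
∨-≤ false b = ℕ.≤-refl
∨-≤ true b = s≤s z≤n

module _ (k : ℕ) (ih : ∀ {n} (es : List (Edge n)) → length es < k → Cubic es → TwoEdgeConnected es →
                       ∑ required es ≤ 2 → TwoFactor es) where

  -- The new edge x₁y₁ is marked as required whatever r₁ is, since only then does the factor lift.
  two-factor-hub : {x y x₁ x₂ : Fin n} {s₁ r₁ sf s₂ r₂ : Bool} {R₂ : List (Edge n)} →
    Cubic (edge x x₁ s₁ r₁ ∷ edge x y sf false ∷ edge x x₂ s₂ r₂ ∷ R₂) →
    TwoEdgeConnected (edge x x₁ s₁ r₁ ∷ edge x y sf false ∷ edge x x₂ s₂ r₂ ∷ R₂) →
    3 + length R₂ ≤ k → ⟦ r₂ ⟧ + ∑ required R₂ ≤ 1 →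
    Reducible x y x₁ x₂ R₂ → TwoFactor (edge x x₁ s₁ r₁ ∷ edge x y sf false ∷ edge x x₂ s₂ r₂ ∷ R₂)
  two-factor-hub {r₂ = r₂} {R₂ = R₂} cubic conn short few (reducible {u₁ = u₁} {u₂ = u₂} {R} p h good) =
    TwoFactor-≈ q (TwoFactor-lift (hub-inserts h) hub-lift
      (ih _ (ℕ.≤-trans (s≤s (subst (_≤ 2 + length R₂) (≈-length p) (ℕ.m≤n+m _ 2))) short)
          (Cubic-reduced (hub-inserts h) (Cubic-≈ q cubic)) good′ (s≤s few′)))
    where
    q = ≈-prep (≈-prep (≈-prep p))
    good′ : TwoEdgeConnected (edge _ _ _ true ∷ edge _ _ _ (r₂ ∨ u₂) ∷ R)
    good′ .constant = good .constant
    -- The mark `u₁` is absorbed by x₁y₁, which is required anyway, and `r₂`, `u₂` merge into one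
    -- mark.
    few′ : ⟦ r₂ ∨ u₂ ⟧ + ∑ required R ≤ 1
    few′ = ℕ.≤-trans (ℕ.+-monoˡ-≤ (∑ required R) (∨-≤ r₂ u₂))
             (ℕ.≤-trans (ℕ.≤-reflexive (ℕ.+-assoc ⟦ r₂ ⟧ ⟦ u₂ ⟧ _))
               (ℕ.≤-trans (ℕ.+-monoʳ-≤ ⟦ r₂ ⟧ (ℕ.m≤n+m _ ⟦ u₁ ⟧))
                 (subst (λ t → ⟦ r₂ ⟧ + t ≤ 1) (∑-≈ required-sym p) few)))

  two-factor-digon : {x y u w : Fin n} {s₀ r₀ s₁ r₁ s₂ t v : Bool} {R R₂ : List (Edge n)} →
    Cubic (edge x u s₀ r₀ ∷ edge x y s₁ r₁ ∷ edge x y s₂ false ∷ R₂) →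
    TwoEdgeConnected (edge x u s₀ r₀ ∷ edge x y s₁ r₁ ∷ edge x y s₂ false ∷ R₂) →
    3 + length R₂ ≤ k → ∑ required R₂ ≤ 1 → R₂ ≈ edge y w t v ∷ R → Digon x y u w R →
    TwoFactor (edge x u s₀ r₀ ∷ edge x y s₁ r₁ ∷ edge x y s₂ false ∷ R₂)
  two-factor-digon {v = v} {R₂ = R₂} cubic conn short few p dig =
    TwoFactor-≈ q (TwoFactor-lift (digon-inserts dig) (digon-lift dig)
      (ih _ (ℕ.≤-trans (s≤s (subst (_≤ 2 + length R₂) (≈-length p) (ℕ.m≤n+m _ 2))) short)
          (Cubic-reduced (digon-inserts dig) (Cubic-≈ q cubic)) good
          (s≤s (ℕ.≤-trans (ℕ.m≤n+m _ ⟦ v ⟧) (subst (_≤ 1) (∑-≈ required-sym p) few)))))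
    where
    q = ≈-prep (≈-prep (≈-prep p))
    good : TwoEdgeConnected (edge _ _ _ true ∷ _)
    good .constant = digon-connected dig (TwoEdgeConnected-≈ q conn) .constant

  two-factor-theta : {x y : Fin n} {s₀ r₀ s₁ s₂ r₂ : Bool} {R : List (Edge n)} → x ≢ y →
    Cubic (edge x y s₀ r₀ ∷ edge x y s₁ false ∷ edge x y s₂ r₂ ∷ R) →
    TwoEdgeConnected (edge x y s₀ r₀ ∷ edge x y s₁ false ∷ edge x y s₂ r₂ ∷ R) → deg x R ≡ 0 →
    TwoFactor (edge x y s₀ r₀ ∷ edge x y s₁ false ∷ edge x y s₂ r₂ ∷ R)
  two-factor-theta {x = x} {y} x≢y cubic conn x∉R with refl ← theta-alone x≢y cubic conn x∉R =
    twoFactor (keep (drop refl (keep [])))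
      (Factor-lift {es′ = []} (inserts x≢y refl refl (λ v → lemma (δ v x) (δ v y))) {N′ = []} [] (λ v → lemma′ (δ v x) (δ v y))
                   (mkFactor λ v → inj₂ (refl , inj₁ refl)))
    where
    lemma : ∀ a b → (a + b) + ((a + b) + ((a + b) + 0)) ≡ 0 + (3 * a + 3 * b)
    lemma = solve-∀
    lemma′ : ∀ a b → (a + b) + ((a + b) + 0) ≡ 0 + (2 * a + 2 * b)
    lemma′ = solve-∀


  two-factor-step : {x x₁ : Fin n} {s r : Bool} {R : List (Edge n)} → 1 + length R ≤ k →
    Cubic (edge x x₁ s r ∷ R) → TwoEdgeConnected (edge x x₁ s r ∷ R) → ∑ required R ≤ 1 → TwoFactor (edge x x₁ s r ∷ R)
  two-factor-step {x = x} {x₁} {s} {r} {R} short cubic conn few = split (corner-of few cubic conn)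
    where
    split : Corner x x₁ R → TwoFactor (edge x x₁ s r ∷ R)
    split (corner {y} {x₂} {sf} {s₂} {r₂} {R₂} p x≢x₁ x≢y x≢x₂ x∉R₂ few₂) =
      TwoFactor-≈ q (go (y ≟ x₂) (y ≟ x₁) (x₂ ≟ x₁) (𝔹._≟_ r₂ false))
      where
      q = ≈-prep p
      cubic′ = Cubic-≈ q cubic
      conn′ = TwoEdgeConnected-≈ q conn
      short′ : 3 + length R₂ ≤ k
      short′ = subst (λ l → suc l ≤ k) (≈-length p) short
      few′ : ⟦ r₂ ⟧ + ∑ required R₂ ≤ 1
      few′ = ℕ.≤-trans few₂ few
      few″ : ∑ required R₂ ≤ 1
      few″ = ℕ.≤-trans (ℕ.m≤n+m _ ⟦ r₂ ⟧) few′
      go : Dec (y ≡ x₂) → Dec (y ≡ x₁) → Dec (x₂ ≡ x₁) → Dec (r₂ ≡ false) →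
           TwoFactor (edge x x₁ s r ∷ edge x y sf false ∷ edge x x₂ s₂ r₂ ∷ R₂)
      go (yes refl) (yes refl) _ _ = two-factor-theta x≢x₁ cubic′ conn′ x∉R₂
      -- The parallel edges are exchanged: `digon-lift` drops the last one, and f is the one known
      -- not to be required.
      go (yes refl) (no y≢x₁) _ _ with reduce-digon cubic′ conn′ x≢x₁ x≢y x≢x₂ x∉R₂ y≢x₁ refl
      ... | digonAt p′ dig = TwoFactor-≈ (≈-prep ≈-swap)
        (two-factor-digon (Cubic-≈ (≈-prep ≈-swap) cubic′) (TwoEdgeConnected-≈ (≈-prep ≈-swap) conn′) short′ few″ p′ dig)
      go (no y≢x₂) (no y≢x₁) _ _ =
        two-factor-hub cubic′ conn′ short′ few′ (reduce-hub cubic′ conn′ x≢x₁ x≢y x≢x₂ x∉R₂ y≢x₁ y≢x₂)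
      go (no y≢x₂) (yes refl) (yes refl) _ = ⊥-elim (y≢x₂ refl)
      go (no y≢x₂) (yes refl) (no x₂≢x₁) (yes refl) = TwoFactor-≈ (≈-prep ≈-swap)
        (two-factor-hub cubic″ conn″ short′ few″ (reduce-hub cubic″ conn″ x≢x₁ x≢x₂ x≢y x∉R₂ x₂≢x₁ x₂≢x₁))
        where
        cubic″ = Cubic-≈ (≈-prep ≈-swap) cubic′
        conn″ = TwoEdgeConnected-≈ (≈-prep ≈-swap) conn′
      -- Here xx₂ is required and must be kept, so it takes the role of e. The old e and f form a
      -- digon, of which f is dropped.
      go (no y≢x₂) (yes refl) (no x₂≢x₁) (no _) = TwoFactor-≈ rot (sub (reduce-digon cubic″ conn″ x≢x₂ x≢x₁ x≢x₁ x∉R₂ y≢x₂ refl))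
        where
        rot : edge x x₁ s r ∷ edge x x₁ sf false ∷ edge x x₂ s₂ r₂ ∷ R₂ ≈
              edge x x₂ s₂ r₂ ∷ edge x x₁ s r ∷ edge x x₁ sf false ∷ R₂
        rot = ≈-trans (≈-prep ≈-swap) ≈-swap
        cubic″ = Cubic-≈ rot cubic′
        conn″ = TwoEdgeConnected-≈ rot conn′
        sub : DigonAt cubic″ conn″ x≢x₂ x≢x₁ x≢x₁ x∉R₂ y≢x₂ →
              TwoFactor (edge x x₂ s₂ r₂ ∷ edge x x₁ s r ∷ edge x x₁ sf false ∷ R₂)
        sub (digonAt p′ dig) = two-factor-digon cubic″ conn″ short′ few″ p′ dig

two-factor-< : ∀ k (es : List (Edge n)) → length es < k → Cubic es → TwoEdgeConnected es → ∑ required es ≤ 2 → TwoFactor es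
two-factor-< zero es () cubic conn few
two-factor-< (suc k) es (s≤s short) cubic conn few with pick es few
... | inj₁ refl = twoFactor [] (mkFactor λ v → inj₂ (refl , inj₁ refl))
... | inj₂ (edge x x₁ s r , R , p , few′) =
  TwoFactor-≈ p (two-factor-step k (two-factor-< k) (subst (_≤ k) (≈-length p) short)
                                 (Cubic-≈ p cubic) (TwoEdgeConnected-≈ p conn) few′)

-- Plesník's theorem for two prescribed edges of the factor.
two-factor : (es : List (Edge n)) → Cubic es → TwoEdgeConnected es → ∑ required es ≤ 2 → TwoFactor es
two-factor es = two-factor-< _ es ℕ.≤-refl

-- Even factors of signed cubic graphs

private module Xor-Sum = Algebra.Properties.CommutativeMonoid.Sum (CommutativeRing.+-commutativeMonoid 𝔹.xor-∧-commutativeRing)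

abstract
  ⨁ : ∀ {m} → (Fin m → Bool) → Bool
  ⨁ = Xor-Sum.sum

  ⨁-nil : (f : Fin 0 → Bool) → ⨁ f ≡ false
  ⨁-nil f = refl

  ⨁-suc : ∀ {m} (f : Fin (suc m) → Bool) → ⨁ f ≡ f zero xor ⨁ (f ∘ suc)
  ⨁-suc f = refl

  ⨁-cong : ∀ {m} {f g : Fin m → Bool} → (∀ i → f i ≡ g i) → ⨁ f ≡ ⨁ g
  ⨁-cong = Xor-Sum.sum-cong-≗

  ⨁-false : ∀ {m} {f : Fin m → Bool} → (∀ i → f i ≡ false) → ⨁ f ≡ false
  ⨁-false {m} eq = trans (⨁-cong eq) (Xor-Sum.sum-replicate-zero m)

  ⨁-xor : ∀ {m} (f g : Fin m → Bool) → ⨁ (λ i → f i xor g i) ≡ ⨁ f xor ⨁ g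
  ⨁-xor = Xor-Sum.∑-distrib-+

  ⨁-comm : ∀ {m k} (f : Fin m → Fin k → Bool) → ⨁ (λ i → ⨁ (f i)) ≡ ⨁ (λ j → ⨁ (λ i → f i j))
  ⨁-comm = Xor-Sum.∑-comm

⨁-single : ∀ {m} (f : Fin m → Bool) (i : Fin m) → (∀ j → j ≢ i → f j ≡ false) → ⨁ f ≡ f i
⨁-single f zero off = trans (⨁-suc f) (trans (cong (f zero xor_) (⨁-false λ j → off (suc j) λ ())) (𝔹.xor-identityʳ (f zero)))
⨁-single f (suc i) off = trans (⨁-suc f) (trans (cong (_xor ⨁ (f ∘ suc)) (off zero λ ()))
  (⨁-single (f ∘ suc) i λ j ne → off (suc j) λ { refl → ne refl }))

⨁-δ : (g : Fin n → Bool) (b : Fin n) → ⨁ (λ v → g v ∧ odd (δ v b)) ≡ g b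
⨁-δ g b = trans (⨁-single _ b λ v ne → trans (cong (λ t → g v ∧ odd t) (δ-≢ ne)) (𝔹.∧-zeroʳ (g v)))
                (trans (cong (λ t → g b ∧ odd t) (δ-refl b)) (𝔹.∧-identityʳ (g b)))

-- The sum of the degrees over a colour class counts the edges inside the class twice and the cut
-- edges once.
cut-⨁ : (c : Fin n → Bool) (N : List (Edge n)) → odd (∑ (cut c) N) ≡ ⨁ (λ v → c v ∧ odd (deg v N))
cut-⨁ c [] = sym (⨁-false λ v → 𝔹.∧-zeroʳ (c v))
cut-⨁ {n} c (edge a b s r ∷ N) =
  trans (odd-∷ (c a xor c b) (∑ (cut c) N))
    (trans (cong₂ _xor_ (sym (cong₂ _xor_ (⨁-δ c a) (⨁-δ c b))) (cut-⨁ c N))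
      (sym (trans (⨁-cong expand) (trans (⨁-xor (λ v → at a v xor at b v) (λ v → c v ∧ odd (deg v N)))
                                         (cong (_xor ⨁ (λ v → c v ∧ odd (deg v N))) (⨁-xor (at a) (at b)))))))
  where
  at : Fin n → Fin n → Bool
  at a v = c v ∧ odd (δ v a)
  expand : ∀ v → c v ∧ odd (δ v a + δ v b + deg v N) ≡
                 ((c v ∧ odd (δ v a)) xor (c v ∧ odd (δ v b))) xor (c v ∧ odd (deg v N))
  expand v rewrite odd-+ (δ v a + δ v b) (deg v N) | odd-+ (δ v a) (δ v b) =
    trans (𝔹.∧-distribˡ-xor (c v) _ _) (cong (_xor (c v ∧ odd (deg v N))) (𝔹.∧-distribˡ-xor (c v) _ _))

even-cut : (c : Fin n → Bool) (N : List (Edge n)) → (∀ v → odd (deg v N) ≡ false) → odd (∑ (cut c) N) ≡ false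
even-cut c N even = trans (cut-⨁ c N) (⨁-false λ v → trans (cong (c v ∧_) (even v)) (𝔹.∧-zeroʳ (c v)))

⟦⟧-0 : ∀ b → ⟦ b ⟧ ≡ 0 → b ≡ false
⟦⟧-0 false eq = refl

xor-false : ∀ a b → a xor b ≡ false → a ≡ b
xor-false false false eq = refl
xor-false true true eq = refl

unviolated : (c : Fin n → Bool) (N : List (Edge n)) → ∑ (violated c) N ≡ 0 → ∑ negative N ≡ ∑ (cut c) N
unviolated c [] eq = refl
unviolated c (edge a b s r ∷ N) eq with p , q ← sum-≡0 eq =
  cong₂ _+_ (cong ⟦_⟧ (xor-false s (c a xor c b) (⟦⟧-0 _ p))) (unviolated c N q)

-- If c switches all edges of N to positive ones, then the negative edges of N are those that cross
-- the cut c, and an even subgraph crosses a cut an even number of times.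
even-sign : (c : Fin n → Bool) (N : List (Edge n)) → ∑ (violated c) N ≡ 0 → (∀ v → odd (deg v N) ≡ false) → oddly N ≡ false
even-sign c N eq even = trans (cong odd (unviolated c N eq)) (even-cut c N even)

Factor-even : {Z : Fin n → Set} {es N : List (Edge n)} → Factor Z es N → ∀ v → odd (deg v N) ≡ false
Factor-even factor v with factor .covers v
... | inj₁ eq = cong odd eq
... | inj₂ (eq , _) = cong odd eq

-- `missed` is a vertex that may be left out, not one that must be; a factor that covers everything
-- records an arbitrary vertex here.
record EvenFactor {n : ℕ} (es : List (Edge n)) : Set where
  constructor evenFactor
  field
    {N} : List (Edge n)
    missed : Fin n
    select : Select es N
    factor : Factor (_≡ missed) es N
    even : oddly N ≡ false

EvenFactor-≈ : {es fs : List (Edge n)} → es ≈ fs → EvenFactor fs → EvenFactor es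
EvenFactor-≈ p (evenFactor z S F even) with Select-≈ p S
... | N , S′ , q = evenFactor z S′ (Factor-≈ p q F) (trans (cong odd (∑-≈ negative-sym q)) even)

EvenFactor-lift : {x y : Fin n} {es es′ : List (Edge n)} → Inserts x y es es′ →
                 (∀ {N′} → Select es′ N′ → Lifts x y es N′) → EvenFactor es′ → EvenFactor es
EvenFactor-lift ins lift (evenFactor z S F even) = evenFactor z select (Factor-lift ins S degree F) (trans parity even)
  where open Lifts (lift S)

weaken : {z : Fin n} {es N : List (Edge n)} → Factor (λ _ → ⊥) es N → Factor (_≡ z) es N
weaken F .covers v with F .covers v
... | inj₁ eq = inj₁ eq
... | inj₂ (eq , inj₁ dead) = inj₂ (eq , inj₁ dead)

-- `colour` switches e into the only negative edge, so that every even subgraph through e is odd.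
record OnlyOdd {n : ℕ} (e : Edge n) (R : List (Edge n)) : Set where
  constructor onlyOdd
  field
    colour : Fin n → Bool
    odd-edge : violated colour e ≡ 1
    even-rest : ∑ (violated colour) R ≡ 0

onlyOdd? : (e : Edge n) (R : List (Edge n)) → Dec (OnlyOdd e R)
onlyOdd? e R = map′ (λ (c , p , q) → onlyOdd c p q) (λ (onlyOdd c p q) → c , p , q)
  (search (λ c → (violated c e ℕ.≟ 1) ×-dec (∑ (violated c) R ℕ.≟ 0)) ext)
  where
  ext : ∀ {c d} → (∀ v → c v ≡ d v) → violated c e ≡ 1 × ∑ (violated c) R ≡ 0 → violated d e ≡ 1 × ∑ (violated d) R ≡ 0
  ext eq (p , q) =
    trans (cong (λ t → ⟦ sgn e xor t ⟧) (sym (cong₂ _xor_ (eq _) (eq _)))) p ,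
    trans (sym (violated-cong R λ v _ → eq v)) q

OnlyOdd-≈ : {e : Edge n} {R R′ : List (Edge n)} → R ≈ R′ → OnlyOdd e R′ → OnlyOdd e R
OnlyOdd-≈ p (onlyOdd c odd-e rest) = onlyOdd c odd-e (trans (∑-≈ (violated-sym c) p) rest)

-- Switchings compose by addition: adding d to c changes the switched sign exactly at the edges of
-- the cut d.
violated-⊕ : (c d : Fin n → Bool) (a b : Fin n) (s : Bool) {p q : Bool} → s xor (c a xor c b) ≡ p → d a xor d b ≡ q →
             s xor ((c a xor d a) xor (c b xor d b)) ≡ p xor q
violated-⊕ c d a b s refl refl =
  solve 5 (λ s ca da cb db → (s :+ ((ca :+ da) :+ (cb :+ db))) := ((s :+ (ca :+ cb)) :+ (da :+ db))) refl s (c a) (d a) (c b) (d b)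
  where open xor-∧-Solver

violated-⊕-∑ : (c d : Fin n → Bool) (R : List (Edge n)) → ∑ (violated c) R ≡ 0 → ∑ (cut d) R ≡ 0 →
               ∑ (violated (λ v → c v xor d v)) R ≡ 0
violated-⊕-∑ c d [] _ _ = refl
violated-⊕-∑ c d (edge a b s r ∷ R) p q with p₁ , p₂ ← sum-≡0 p | q₁ , q₂ ← sum-≡0 q =
  cong₂ _+_ (cong ⟦_⟧ (violated-⊕ c d a b s (⟦⟧-0 _ p₁) (⟦⟧-0 _ q₁))) (violated-⊕-∑ c d R p₂ q₂)

module Slide {x y x₁ x₂ y₁ y₂ : Fin n} {s₁ sf s₂ t₁ t₂ : Bool} {R : List (Edge n)}
  (h : Hub x y x₁ x₂ y₁ y₂ R) (none : ∑ required R ≡ 0) where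
  open Hub h

  H H^ : List (Edge n)
  H = edge x x₁ s₁ true ∷ edge x y sf false ∷ edge x x₂ s₂ false ∷ edge y y₁ t₁ false ∷ edge y y₂ t₂ false ∷ R
  -- The end y of the edge g = yy₁ slides along f = xy into the middle of e = xx₁.
  H^ = edge y x false true ∷ edge y x₁ false true ∷ edge y y₁ false false ∷ edge x y₂ false false ∷ edge x x₂ false false ∷ R

  -- In `H^` the name y is reused for the vertex that subdivides e, while f and yy₂ have merged into
  -- xy₂. Thus all degrees are preserved.
  deg-slide : ∀ v → deg v H ≡ deg v H^
  deg-slide v = lemma (δ v x) (δ v y) (δ v x₁) (δ v x₂) (δ v y₁) (δ v y₂) (deg v R)
    where
    lemma : ∀ a b c d e f r → (a + c) + ((a + b) + ((a + d) + ((b + e) + ((b + f) + r)))) ≡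
                              (b + a) + ((b + c) + ((b + e) + ((a + f) + ((a + d) + r))))
    lemma = solve-∀

  -- If x and x₁ have the same colour, then y has it too, since a small cut cannot contain both
  -- halves of e; it is then equally small in `H`. Otherwise it contains exactly one half of e and
  -- no further edge.
  slide-cut : (X Y X₁ X₂ Y₁ Y₂ : Bool) (r : ℕ) →
    ⟦ Y xor X ⟧ + (⟦ Y xor X₁ ⟧ + (⟦ Y xor Y₁ ⟧ + (⟦ X xor Y₂ ⟧ + (⟦ X xor X₂ ⟧ + r)))) ≤ 1 →
    ⟦ X xor X₁ ⟧ + (⟦ X xor Y ⟧ + (⟦ X xor X₂ ⟧ + (⟦ Y xor Y₁ ⟧ + (⟦ Y xor Y₂ ⟧ + r)))) ≤ 1 ⊎
    (X₁ ≡ not X × X₂ ≡ X × Y₂ ≡ X × r ≡ 0)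
  slide-cut X Y X₁ X₂ Y₁ Y₂ r small = go X Y X₁ small
    where
    reorder : ∀ a b c r → a + (b + (c + r)) ≡ c + (a + (b + r))
    reorder = solve-∀
    rest : ∀ X Y X₁ → ⟦ Y xor Y₁ ⟧ + (⟦ X xor Y₂ ⟧ + (⟦ X xor X₂ ⟧ + r)) ≤ 0 → X₁ ≡ not X →
           X₁ ≡ not X × X₂ ≡ X × Y₂ ≡ X × r ≡ 0
    rest X Y X₁ zero-sum eq with _ , p ← sum-≡0 {⟦ Y xor Y₁ ⟧} (ℕ.n≤0⇒n≡0 zero-sum)
      with p₁ , p₂ ← sum-≡0 {⟦ X xor Y₂ ⟧} p with p₃ , p₄ ← sum-≡0 {⟦ X xor X₂ ⟧} p₂ =
      eq , sym (xor-false X X₂ (⟦⟧-0 _ p₃)) , sym (xor-false X Y₂ (⟦⟧-0 _ p₁)) , p₄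
    go : ∀ X Y X₁ → ⟦ Y xor X ⟧ + (⟦ Y xor X₁ ⟧ + (⟦ Y xor Y₁ ⟧ + (⟦ X xor Y₂ ⟧ + (⟦ X xor X₂ ⟧ + r)))) ≤ 1 →
      ⟦ X xor X₁ ⟧ + (⟦ X xor Y ⟧ + (⟦ X xor X₂ ⟧ + (⟦ Y xor Y₁ ⟧ + (⟦ Y xor Y₂ ⟧ + r)))) ≤ 1 ⊎
      (X₁ ≡ not X × X₂ ≡ X × Y₂ ≡ X × r ≡ 0)
    go false false false p = inj₁ (subst (_≤ 1) (reorder ⟦ Y₁ ⟧ ⟦ Y₂ ⟧ ⟦ X₂ ⟧ r) p)
    go true true true p = inj₁ (subst (_≤ 1) (reorder ⟦ not Y₁ ⟧ ⟦ not Y₂ ⟧ ⟦ not X₂ ⟧ r) p)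
    go false true false (s≤s ())
    go true false true (s≤s ())
    go false false true (s≤s p) = inj₂ (rest false false true p refl)
    go false true true (s≤s p) = inj₂ (rest false true true p refl)
    go true false false (s≤s p) = inj₂ (rest true false false p refl)
    go true true false (s≤s p) = inj₂ (rest true true false p refl)

  module _ (cubic : Cubic H) (conn : TwoEdgeConnected H)
           (no-odd : ¬ OnlyOdd (edge x x₁ s₁ true) (edge x y sf false ∷ edge x x₂ s₂ false ∷ edge y y₁ t₁ false ∷ edge y y₂ t₂ false ∷ R))
           (c : Fin n → Bool) (ve : s₁ xor (c x xor c x₁) ≡ false) (vf : sf xor (c x xor c y) ≡ false)
           (vk : s₂ xor (c x xor c x₂) ≡ false) (vg : t₁ xor (c y xor c y₁) ≡ true)
           (vy : t₂ xor (c y xor c y₂) ≡ false) (vR : ∑ (violated c) R ≡ 0) where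

    slide-cubic : Cubic H^
    slide-cubic .degrees v = subst (λ d → d ≡ 0 ⊎ d ≡ 3) (deg-slide v) (cubic .degrees v)

    -- Otherwise e and g form a 2-edge cut, and switching at it makes e the only negative edge.
    slide-connected : TwoEdgeConnected H^
    slide-connected .constant d small v w v-live w-live
      with slide-cut (d x) (d y) (d x₁) (d x₂) (d y₁) (d y₂) (∑ (cut d) R) small
    ... | inj₁ small′ = conn .constant d small′ v w (v-live ∘ trans (sym (deg-slide v))) (w-live ∘ trans (sym (deg-slide w)))
    ... | inj₂ (dx₁ , dx₂ , dy₂ , r) with d y₁ 𝔹.≟ d x
    -- With y coloured like x, the edge e alone is cut in `H`, so it would be a bridge.
    ...   | yes dy₁ = ⊥-elim (𝔹.not-¬ refl (trans (sym dx₂) (trans (hub-constant h conn (d x) (d x) d one x₂-live x₁-live) dx₁)))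
      where
      eq0 : ∀ {a} → a ≡ d x → ⟦ d x xor a ⟧ ≡ 0
      eq0 refl = cong ⟦_⟧ (𝔹.xor-same (d x))
      ≤1 : ∀ b {m} → m ≡ 0 → ⟦ b ⟧ + m ≤ 1
      ≤1 false refl = z≤n
      ≤1 true refl = s≤s z≤n
      one : ⟦ d x xor d x₁ ⟧ + (⟦ d x xor d x ⟧ + (⟦ d x xor d x₂ ⟧ + (⟦ d x xor d y₁ ⟧ + (⟦ d x xor d y₂ ⟧ + ∑ (cut d) R)))) ≤ 1
      one = ≤1 (d x xor d x₁) (cong₂ _+_ (eq0 refl) (cong₂ _+_ (eq0 dx₂) (cong₂ _+_ (eq0 dy₁) (cong₂ _+_ (eq0 dy₂) r))))
      x₁-live : deg x₁ (edge x₁ y₁ false false ∷ edge x₂ y₂ false false ∷ R) ≢ 0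
      x₁-live eq = δ-0 (proj₁ (sum-≡0 (proj₁ (sum-≡0 eq)))) refl
      x₂-live : deg x₂ (edge x₁ y₁ false false ∷ edge x₂ y₂ false false ∷ R) ≢ 0
      x₂-live eq = δ-0 (proj₁ (sum-≡0 (proj₁ (sum-≡0 (proj₂ (sum-≡0 {δ x₂ x₁ + δ x₂ y₁} eq)))))) refl
    ...   | no dy₁ = ⊥-elim (no-odd (onlyOdd (λ v → c v xor d′ v)
        (cong ⟦_⟧ (violated-⊕ c d′ x x₁ s₁ ve (opposite d′x (trans (off x≢x₁ y≢x₁) dx₁))))
        (cong₂ _+_ (cong ⟦_⟧ (violated-⊕ c d′ x y sf vf (equal d′x d′y)))
        (cong₂ _+_ (cong ⟦_⟧ (violated-⊕ c d′ x x₂ s₂ vk (equal d′x (trans (off x≢x₂ y≢x₂) dx₂))))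
        (cong₂ _+_ (cong ⟦_⟧ (violated-⊕ c d′ y y₁ t₁ vg (opposite d′y (trans (off x≢y₁ y≢y₁) (𝔹.¬-not dy₁)))))
        (cong₂ _+_ (cong ⟦_⟧ (violated-⊕ c d′ y y₂ t₂ vy (equal d′y (trans (off x≢y₂ y≢y₂) dy₂))))
        (violated-⊕-∑ c d′ R vR (trans (cut-recolour {x = x} {y} {d x} {d x} {d} R x∉R y∉R) r))))))))
      where
      d′ : Fin n → Bool
      d′ = recolour x y (d x) (d x) d
      d′x : d′ x ≡ d x
      d′x = recolour-x {x = x} {y} {d x} {d x} {d}
      d′y : d′ y ≡ d x
      d′y = recolour-y {x = x} {y} {d x} {d x} {d} x≢y
      off : ∀ {v} → x ≢ v → y ≢ v → d′ v ≡ d v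
      off = recolour-≢ {x = x} {y} {d x} {d x} {d}
      equal : ∀ {a b} → a ≡ d x → b ≡ d x → a xor b ≡ false
      equal refl refl = 𝔹.xor-same (d x)
      opposite : ∀ {a b} → a ≡ d x → b ≡ not (d x) → a xor b ≡ true
      opposite refl refl = trans (𝔹.xor-comm (d x) _) (xor-not (d x))
        where
        xor-not : ∀ b → not b xor b ≡ true
        xor-not false = refl
        xor-not true = refl

    -- The halves of e use up the degree of y in the factor, so g is left out; at x there is room
    -- for exactly one of xy₂ and xx₂. As g is the only edge that c violates, the result is even.
    slide-factor : TwoFactor H^ → EvenFactor H
    slide-factor (twoFactor (keep (keep (keep {N = N} S))) F) with F .covers y
    ... | inj₁ eq = ⊥-elim (absurd (δ-refl y) eq)
      where
      absurd : ∀ {t a b c m} → t ≡ 1 → (t + a) + ((t + b) + ((t + c) + m)) ≢ 2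
      absurd {a = a} {b} {c} {m} refl eq = case trans (sym (lemma a b c m)) eq of λ ()
        where
        lemma : ∀ a b c m → (1 + a) + ((1 + b) + ((1 + c) + m)) ≡ 3 + (a + b + c + m)
        lemma = solve-∀
    ... | inj₂ (eq , _) = ⊥-elim (δ-0 (proj₁ (sum-≡0 (proj₁ (sum-≡0 eq)))) refl)
    slide-factor (twoFactor (keep (keep (drop refl (keep (keep {N = N} S))))) F) with F .covers x
    ... | inj₁ eq = ⊥-elim (absurd (δ x y) (δ x y + δ x x₁) (δ x y₂) (δ x x₂) (deg x N) (δ-refl x) eq)
      where
      absurd : ∀ {t} a b c d m → t ≡ 1 → (a + t) + (b + ((t + c) + ((t + d) + m))) ≢ 2
      absurd a b c d m refl eq = case trans (sym (lemma a b c d m)) eq of λ ()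
        where
        lemma : ∀ a b c d m → (a + 1) + (b + ((1 + c) + ((1 + d) + m))) ≡ 3 + (a + b + c + d + m)
        lemma = solve-∀
    ... | inj₂ (eq , _) = ⊥-elim (δ-0 (proj₂ (sum-≡0 {δ x y} (proj₁ (sum-≡0 eq)))) refl)
    slide-factor (twoFactor (keep (keep (drop refl (drop refl (drop {N = N} refl S))))) F) with F .covers x
    ... | inj₁ eq = ⊥-elim (case trans (sym eq) one of λ ())
      where
      one : deg x (edge y x false false ∷ edge y x₁ false false ∷ N) ≡ 1
      one = cong₂ _+_ (cong₂ _+_ (δ-≢ x≢y) (δ-refl x)) (cong₂ _+_ (cong₂ _+_ (δ-≢ x≢y) (δ-≢ x≢x₁)) (Select-zero S x∉R))
    ... | inj₂ (eq , _) = ⊥-elim (δ-0 (proj₂ (sum-≡0 {δ x y} (proj₁ (sum-≡0 eq)))) refl)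
    -- The path x₁yxy₂ of `H^` becomes x₁xyy₂ in `H`, and every vertex is covered.
    slide-factor (twoFactor (keep (keep (drop refl (keep (drop {N = N} refl S))))) F) =
      evenFactor {N = N₁} x (keep (keep (drop refl (drop refl (keep S))))) factor′
        (even-sign c N₁ (cong₂ _+_ (cong ⟦_⟧ ve) (cong₂ _+_ (cong ⟦_⟧ vf) (cong₂ _+_ (cong ⟦_⟧ vy) (Select-zero S vR))))
                   (Factor-even factor′))
      where
      N₁ = edge x x₁ s₁ true ∷ edge x y sf false ∷ edge y y₂ t₂ false ∷ N
      factor′ : Factor (_≡ x) H N₁
      factor′ = Factor-deg deg-slide (λ v → lemma (δ v x) (δ v y) (δ v x₁) (δ v y₂) (deg v N)) (weaken F)
        where
        lemma : ∀ a b c f r → (a + c) + ((a + b) + ((b + f) + r)) ≡ (b + a) + ((b + c) + ((a + f) + r))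
        lemma = solve-∀
    -- The path x₁yxx₂ becomes x₁xx₂, and y is left out. This is the only source of a missed vertex.
    slide-factor (twoFactor (keep (keep (drop refl (drop refl (keep {N = N} S))))) F) =
      evenFactor {N = N₁} y (keep (drop refl (keep (drop refl (drop refl S))))) factor′
        (even-sign c N₁ (cong₂ _+_ (cong ⟦_⟧ ve) (cong₂ _+_ (cong ⟦_⟧ vk) (Select-zero S vR))) (Factor-even factor′))
      where
      N₁ = edge x x₁ s₁ true ∷ edge x x₂ s₂ false ∷ N
      drop-y : ∀ v → deg v (edge y x false false ∷ edge y x₁ false false ∷ edge x x₂ false false ∷ N) ≡
                     2 * δ v y + deg v N₁
      drop-y v = lemma (δ v x) (δ v y) (δ v x₁) (δ v x₂) (deg v N)
        where
        lemma : ∀ a b c d r → (b + a) + ((b + c) + ((a + d) + r)) ≡ 2 * b + ((a + c) + ((a + d) + r))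
        lemma = solve-∀
      factor′ : Factor (_≡ y) H N₁
      factor′ .covers v with v ≟ y
      ... | yes refl = inj₂ (cong₂ _+_ (cong₂ _+_ (δ-≢ (x≢y ∘ sym)) (δ-≢ y≢x₁))
                              (cong₂ _+_ (cong₂ _+_ (δ-≢ (x≢y ∘ sym)) (δ-≢ y≢x₂)) (Select-zero S y∉R)) , inj₂ refl)
      ... | no v≢y with F .covers v
      ...   | inj₁ eq = inj₁ (trans same eq)
        where same = trans (cong (λ t → 2 * t + deg v N₁) (sym (δ-≢ v≢y))) (sym (drop-y v))
      ...   | inj₂ (eq , inj₁ dead) =
        inj₂ (proj₂ (sum-≡0 {2 * δ v y} (trans (sym (drop-y v)) eq)) , inj₁ (trans (deg-slide v) dead))

    slide : EvenFactor H
    slide = slide-factor (two-factor H^ slide-cubic slide-connected (subst (λ t → 2 + t ≤ 2) (sym none) ℕ.≤-refl))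

required-none : {e : Edge n} {es R : List (Edge n)} → es ≈ e ∷ R → ∑ required es ≡ 0 → req e ≡ false × ∑ required R ≡ 0
required-none {e = e} p none with a , b ← sum-≡0 {required e} (trans (sym (∑-≈ required-sym p)) none) = ⟦⟧-0 _ a , b

module _ (k : ℕ) (ih : ∀ {n} (a b : Fin n) (s : Bool) (R : List (Edge n)) → length R < k →
                       Cubic (edge a b s true ∷ R) → TwoEdgeConnected (edge a b s true ∷ R) → ∑ required R ≡ 0 →
                       ¬ OnlyOdd (edge a b s true) R → EvenFactor (edge a b s true ∷ R)) where

  even-factor-hub : {x y x₁ x₂ : Fin n} {s₁ sf s₂ : Bool} {R₂ : List (Edge n)} →
    let R = edge x y sf false ∷ edge x x₂ s₂ false ∷ R₂ in
    Cubic (edge x x₁ s₁ true ∷ R) → TwoEdgeConnected (edge x x₁ s₁ true ∷ R) → ∑ required R₂ ≡ 0 →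
    ¬ OnlyOdd (edge x x₁ s₁ true) R → 2 + length R₂ ≤ k →
    Reducible x y x₁ x₂ R₂ → EvenFactor (edge x x₁ s₁ true ∷ R)
  even-factor-hub {n} {x} {y} {x₁} {x₂} {s₁} {sf} {s₂} {R₂} cubic conn none no-odd short
    (reducible {y₁} {y₂} {t₁} {u₁} {t₂} {u₂} {R} p h good)
    with refl , none′ ← required-none p none with refl , none″ ← required-none {e = edge y y₂ t₂ u₂} {R = R} ≈-refl none′ =
    EvenFactor-≈ q (decide (onlyOdd? (edge x₁ y₁ (s₁ xor (sf xor t₁)) true) (edge x₂ y₂ (s₂ xor (sf xor t₂)) false ∷ R)))
    where
    open Hub h
    q = ≈-prep (≈-prep (≈-prep p))
    H : List (Edge n)
    H = edge x x₁ s₁ true ∷ edge x y sf false ∷ edge x x₂ s₂ false ∷ edge y y₁ t₁ false ∷ edge y y₂ t₂ false ∷ R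
    decide : Dec (OnlyOdd (edge x₁ y₁ (s₁ xor (sf xor t₁)) true) (edge x₂ y₂ (s₂ xor (sf xor t₂)) false ∷ R)) → EvenFactor H
    decide (no fine) = EvenFactor-lift (hub-inserts h) hub-lift
      (ih x₁ y₁ _ _ (ℕ.≤-trans (s≤s (subst (1 + length R ≤_) (sym (≈-length p)) (ℕ.n≤1+n _))) (ℕ.≤-trans (ℕ.n≤1+n _) short))
          (Cubic-reduced (hub-inserts h) (Cubic-≈ q cubic)) (record { constant = good .constant }) none″ fine)
    decide (yes (onlyOdd c odd₁ even₂)) = go (s₁ xor (c′ x xor c′ x₁)) refl
      where
      open xor-∧-Solver using (solve; _:+_; _:=_; con)
      -- The colours of x and y that make xx₂ and yy₂ positive. Then f is positive because x₂y₂ is,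
      -- and exactly one of e and g = yy₁ is negative because x₁y₁ is negative. If it is e, the
      -- given graph is exceptional; if it is g, the slide applies.
      p′ q′ : Bool
      p′ = s₂ xor c x₂
      q′ = t₂ xor c y₂
      c′ : Fin n → Bool
      c′ = recolour x y p′ q′ c
      c′x : c′ x ≡ p′
      c′x = recolour-x {x = x} {y} {p′} {q′} {c}
      c′y : c′ y ≡ q′
      c′y = recolour-y {x = x} {y} {p′} {q′} {c} x≢y
      off : ∀ {v} → x ≢ v → y ≢ v → c′ v ≡ c v
      off = recolour-≢ {x = x} {y} {p′} {q′} {c}
      e₂ : (s₂ xor (sf xor t₂)) xor (c x₂ xor c y₂) ≡ false
      e₂ = ⟦⟧-0 _ (proj₁ (sum-≡0 even₂))
      vf : sf xor (c′ x xor c′ y) ≡ false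
      vf = trans (cong₂ (λ a b → sf xor (a xor b)) c′x c′y)
        (trans (solve 5 (λ f s t a b → (f :+ ((s :+ a) :+ (t :+ b))) := ((s :+ (f :+ t)) :+ (a :+ b))) refl sf s₂ t₂ (c x₂) (c y₂)) e₂)
      cancel : ∀ s a → s xor ((s xor a) xor a) ≡ false
      cancel = solve 2 (λ s a → (s :+ ((s :+ a) :+ a)) := con false) refl
      vk : s₂ xor (c′ x xor c′ x₂) ≡ false
      vk = trans (cong₂ (λ a b → s₂ xor (a xor b)) c′x (off x≢x₂ y≢x₂)) (cancel s₂ (c x₂))
      vy : t₂ xor (c′ y xor c′ y₂) ≡ false
      vy = trans (cong₂ (λ a b → t₂ xor (a xor b)) c′y (off x≢y₂ y≢y₂)) (cancel t₂ (c y₂))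
      vR : ∑ (violated c′) R ≡ 0
      vR = trans (violated-recolour {x = x} {y} {p′} {q′} {c} R x∉R y∉R) (proj₂ (sum-≡0 even₂))
      eg : (s₁ xor (c′ x xor c′ x₁)) xor (t₁ xor (c′ y xor c′ y₁)) ≡ true
      eg = trans (solve 7 (λ s f t a b d e → ((s :+ (a :+ d)) :+ (t :+ (b :+ e))) :=
                                             ((((s :+ (f :+ t)) :+ (d :+ e))) :+ (f :+ (a :+ b)))) refl
                    s₁ sf t₁ (c′ x) (c′ y) (c′ x₁) (c′ y₁))
             (trans (cong₂ _xor_ (cong₂ (λ a b → (s₁ xor (sf xor t₁)) xor (a xor b)) (off x≢x₁ y≢x₁) (off x≢y₁ y≢y₁)) vf)
                (trans (𝔹.xor-identityʳ _) (⟦⟧-1 _ odd₁)))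
        where
        ⟦⟧-1 : ∀ b → ⟦ b ⟧ ≡ 1 → b ≡ true
        ⟦⟧-1 true eq = refl
      go : ∀ r → s₁ xor (c′ x xor c′ x₁) ≡ r → EvenFactor H
      go false ve = Slide.slide h none″ (Cubic-≈ q cubic) (TwoEdgeConnected-≈ q conn) (no-odd ∘ OnlyOdd-≈ (≈-prep (≈-prep p)))
        c′ ve vf vk (trans (cong (_xor (t₁ xor (c′ y xor c′ y₁))) (sym ve)) eg) vy vR
      go true ve = ⊥-elim (no-odd (OnlyOdd-≈ (≈-prep (≈-prep p)) (onlyOdd c′ (cong ⟦_⟧ ve)
        (cong₂ _+_ (cong ⟦_⟧ vf) (cong₂ _+_ (cong ⟦_⟧ vk) (cong₂ _+_ (cong ⟦_⟧ vg) (cong₂ _+_ (cong ⟦_⟧ vy) vR)))))))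
        where
        vg : t₁ xor (c′ y xor c′ y₁) ≡ false
        vg = trans (sym (𝔹.not-involutive _)) (cong not (trans (cong (_xor (t₁ xor (c′ y xor c′ y₁))) (sym ve)) eg))

  even-factor-digon : {x y u w : Fin n} {s s₁ s₂ t v : Bool} {R R₂ : List (Edge n)} →
    let R′ = edge x y s₁ false ∷ edge x y s₂ false ∷ R₂ in
    Cubic (edge x u s true ∷ R′) → TwoEdgeConnected (edge x u s true ∷ R′) → ∑ required R₂ ≡ 0 →
    ¬ OnlyOdd (edge x u s true) R′ → 2 + length R₂ ≤ k → R₂ ≈ edge y w t v ∷ R → Digon x y u w R →
    EvenFactor (edge x u s true ∷ R′)
  even-factor-digon {n} {x} {y} {u} {w} {s} {s₁} {s₂} {t} {v} {R} {R₂} cubic conn none no-odd short p dig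
    with refl , none′ ← required-none p none = EvenFactor-≈ q (go (s₁ 𝔹.≟ s₂))
    where
    open Digon dig
    open xor-∧-Solver using (solve; _:+_; _:=_; con)
    q = ≈-prep (≈-prep (≈-prep p))
    H : List (Edge n)
    H = edge x u s true ∷ edge x y s₁ false ∷ edge x y s₂ false ∷ edge y w t false ∷ R
    reduced-cubic : Cubic (edge u w (s xor (s₁ xor t)) true ∷ R)
    reduced-cubic = Cubic-reduced (digon-inserts dig) (Cubic-≈ q cubic)
    reduced-conn : TwoEdgeConnected (edge u w (s xor (s₁ xor t)) true ∷ R)
    reduced-conn .constant = digon-connected dig (TwoEdgeConnected-≈ q conn) .constant
    go : Dec (s₁ ≡ s₂) → EvenFactor H
    go (yes refl) = EvenFactor-lift (digon-inserts dig) (digon-lift dig)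
      (ih u w _ R (ℕ.≤-trans (subst (_≤ 1 + length R₂) (≈-length p) (ℕ.n≤1+n _)) (ℕ.≤-trans (ℕ.n≤1+n _) short))
          reduced-cubic reduced-conn none′ fine)
      where
      -- Otherwise xu would be the only odd edge of `H`: the colours `q′` of y and `p′` of x make yw
      -- and both parallel edges positive, and xu takes over the switched sign of uw.
      fine : ¬ OnlyOdd (edge u w (s xor (s₁ xor t)) true) R
      fine (onlyOdd c odd₁ even₂) = no-odd (OnlyOdd-≈ (≈-prep (≈-prep p)) (onlyOdd c′
        (trans (cong ⟦_⟧ (trans (cong₂ (λ a b → s xor (a xor b)) c′x (off x≢u y≢u))
                           (solve 5 (λ s f t a b → (s :+ ((f :+ (t :+ b)) :+ a)) := ((s :+ (f :+ t)) :+ (a :+ b))) refl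
                              s s₁ t (c u) (c w)))) odd₁)
        (cong₂ _+_ (cong ⟦_⟧ vd) (cong₂ _+_ (cong ⟦_⟧ vd) (cong₂ _+_ (cong ⟦_⟧ vy)
          (trans (violated-recolour {x = x} {y} {p′} {q′} {c} R x∉R y∉R) even₂))))))
        where
        p′ q′ : Bool
        q′ = t xor c w
        p′ = s₁ xor q′
        c′ : Fin n → Bool
        c′ = recolour x y p′ q′ c
        c′x : c′ x ≡ p′
        c′x = recolour-x {x = x} {y} {p′} {q′} {c}
        c′y : c′ y ≡ q′
        c′y = recolour-y {x = x} {y} {p′} {q′} {c} x≢y
        off : ∀ {v} → x ≢ v → y ≢ v → c′ v ≡ c v
        off = recolour-≢ {x = x} {y} {p′} {q′} {c}
        cancel : ∀ s a → s xor ((s xor a) xor a) ≡ false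
        cancel = solve 2 (λ s a → (s :+ ((s :+ a) :+ a)) := con false) refl
        vd : s₁ xor (c′ x xor c′ y) ≡ false
        vd = trans (cong₂ (λ a b → s₁ xor (a xor b)) c′x c′y) (cancel s₁ q′)
        vy : t xor (c′ y xor c′ w) ≡ false
        vy = trans (cong₂ (λ a b → t xor (a xor b)) c′y (off x≢w y≢w)) (cancel t (c w))
    -- The two edges of the digon have opposite signs, so one of them gives the factor the right parity.
    go (no s₁≢s₂) = choose (two-factor (edge u w (s xor (s₁ xor t)) true ∷ R) reduced-cubic reduced-conn
                                       (subst (λ m → 1 + m ≤ 2) (sym none′) (s≤s z≤n)))
      where
      choose : TwoFactor (edge u w (s xor (s₁ xor t)) true ∷ R) → EvenFactor H
      choose (twoFactor (keep {N = N} S) F) with (s xor (s₁ xor t)) xor oddly N in eq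
      ... | false = evenFactor x (Lifts.select ℓ) (Factor-lift (digon-inserts dig) {N′ = e ∷ N} (keep S) (Lifts.degree ℓ) (weaken F))
                               (trans (Lifts.parity ℓ) (trans (oddly-∷ e N) eq))
        where
        e : Edge n
        e = edge u w (s xor (s₁ xor t)) true
        ℓ : Lifts x y H (e ∷ N)
        ℓ = digon-lift dig (keep S)
      ... | true = EvenFactor-≈ (≈-prep ≈-swap)
        (evenFactor x (Lifts.select ℓ) (Factor-lift (digon-inserts dig) {N′ = e ∷ N} (keep S) (Lifts.degree ℓ)
                                          (mkFactor (weaken {es = edge u w _ true ∷ R} F .covers)))
                    (trans (Lifts.parity ℓ) (trans (oddly-∷ e N) flipped)))
        where
        e : Edge n
        e = edge u w (s xor (s₂ xor t)) true
        ℓ : Lifts x y (edge x u s true ∷ edge x y s₂ false ∷ edge x y s₁ false ∷ edge y w t false ∷ R) (e ∷ N)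
        ℓ = digon-lift dig (keep S)
        flipped : (s xor (s₂ xor t)) xor oddly N ≡ false
        flipped = trans (cong (λ b → (s xor (b xor t)) xor oddly N) (𝔹.¬-not (s₁≢s₂ ∘ sym)))
          (trans (cong (λ b → (s xor b) xor oddly N) (sym (𝔹.not-distribˡ-xor s₁ t)))
            (trans (cong (_xor oddly N) (sym (𝔹.not-distribʳ-xor s (s₁ xor t))))
              (trans (sym (𝔹.not-distribˡ-xor (s xor (s₁ xor t)) (oddly N))) (cong not eq))))

  -- Together with a parallel edge of the same sign, e forms an even cycle. If both other edges have
  -- the opposite sign, switching at one end makes e the only negative edge.
  even-factor-theta : {x y : Fin n} {s s₁ s₂ : Bool} {R : List (Edge n)} → x ≢ y →
    let R′ = edge x y s₁ false ∷ edge x y s₂ false ∷ R in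
    Cubic (edge x y s true ∷ R′) → TwoEdgeConnected (edge x y s true ∷ R′) → deg x R ≡ 0 →
    ¬ OnlyOdd (edge x y s true) R′ → EvenFactor (edge x y s true ∷ R′)
  even-factor-theta {n} {x} {y} {s} {s₁} {s₂} x≢y cubic conn x∉R no-odd
    with refl ← theta-alone x≢y cubic conn x∉R = go (s 𝔹.≟ s₁) (s 𝔹.≟ s₂)
    where
    H : List (Edge n)
    H = edge x y s true ∷ edge x y s₁ false ∷ edge x y s₂ false ∷ []
    cycle : ∀ {r r′ b b′} → Factor (_≡ x) H (edge x y b r ∷ edge x y b′ r′ ∷ [])
    cycle = Factor-lift {es′ = []} (inserts x≢y refl refl (λ v → lemma (δ v x) (δ v y))) {N′ = []} []
              (λ v → lemma′ (δ v x) (δ v y)) (mkFactor λ v → inj₂ (refl , inj₁ refl))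
      where
      lemma : ∀ a b → (a + b) + ((a + b) + ((a + b) + 0)) ≡ 0 + (3 * a + 3 * b)
      lemma = solve-∀
      lemma′ : ∀ a b → (a + b) + ((a + b) + 0) ≡ 0 + (2 * a + 2 * b)
      lemma′ = solve-∀
    double : ∀ b → odd (⟦ b ⟧ + (⟦ b ⟧ + 0)) ≡ false
    double false = refl
    double true = refl
    go : Dec (s ≡ s₁) → Dec (s ≡ s₂) → EvenFactor H
    go (yes refl) _ = evenFactor x (keep (keep (drop refl []))) cycle (double s)
    go (no _) (yes refl) = evenFactor x (keep (drop refl (keep []))) cycle (double s)
    go (no s≢s₁) (no s≢s₂) = ⊥-elim (no-odd (onlyOdd c (cong ⟦_⟧ (trans (at s) (opposite s s₁ s≢s₁)))
      (cong₂ _+_ (cong ⟦_⟧ (trans (at s₁) (𝔹.xor-same s₁)))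
      (cong₂ _+_ (cong ⟦_⟧ (trans (at s₂) (trans (cong (_xor s₁) (trans (𝔹.¬-not (s≢s₂ ∘ sym)) (sym (𝔹.¬-not (s≢s₁ ∘ sym)))))
                                                 (𝔹.xor-same s₁)))) refl))))
      where
      c : Fin n → Bool
      c = recolour x y false s₁ (λ _ → false)
      at : ∀ b → b xor (c x xor c y) ≡ b xor s₁
      at b = cong (b xor_) (cong₂ _xor_ (recolour-x {x = x} {y} {false} {s₁} {λ _ → false})
                                        (recolour-y {x = x} {y} {false} {s₁} {λ _ → false} x≢y))
      opposite : ∀ a b → a ≢ b → a xor b ≡ true
      opposite false false ne = ⊥-elim (ne refl)
      opposite false true ne = refl
      opposite true false ne = refl
      opposite true true ne = ⊥-elim (ne refl)

  even-factor-step : (x x₁ : Fin n) (s : Bool) (R : List (Edge n)) → length R ≤ k →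
    Cubic (edge x x₁ s true ∷ R) → TwoEdgeConnected (edge x x₁ s true ∷ R) → ∑ required R ≡ 0 →
    ¬ OnlyOdd (edge x x₁ s true) R → EvenFactor (edge x x₁ s true ∷ R)
  even-factor-step x x₁ s R short cubic conn none no-odd =
    split (corner-of (subst (_≤ 1) (sym none) z≤n) cubic conn)
    where
    split : Corner x x₁ R → EvenFactor (edge x x₁ s true ∷ R)
    split (corner {y} {x₂} {sf} {s₂} {r₂} {R₂} p x≢x₁ x≢y x≢x₂ x∉R₂ few)
      with refl , none₂ ← required-none {e = edge x x₂ s₂ r₂} {R = R₂} ≈-refl (proj₂ (required-none p none)) =
      EvenFactor-≈ q (go (y ≟ x₂) (y ≟ x₁))
      where
      q = ≈-prep p
      cubic′ = Cubic-≈ q cubic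
      conn′ = TwoEdgeConnected-≈ q conn
      no-odd′ = no-odd ∘ OnlyOdd-≈ p
      short′ : 2 + length R₂ ≤ k
      short′ = subst (_≤ k) (≈-length p) short
      go : Dec (y ≡ x₂) → Dec (y ≡ x₁) → EvenFactor (edge x x₁ s true ∷ edge x y sf false ∷ edge x x₂ s₂ false ∷ R₂)
      go (yes refl) (yes refl) = even-factor-theta x≢x₁ cubic′ conn′ x∉R₂ no-odd′
      go (yes refl) (no y≢x₁) with reduce-digon cubic′ conn′ x≢x₁ x≢y x≢x₂ x∉R₂ y≢x₁ refl
      ... | digonAt p′ dig = even-factor-digon cubic′ conn′ none₂ no-odd′ short′ p′ dig
      go (no y≢x₂) (no y≢x₁) =
        even-factor-hub cubic′ conn′ none₂ no-odd′ short′ (reduce-hub cubic′ conn′ x≢x₁ x≢y x≢x₂ x∉R₂ y≢x₁ y≢x₂)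
      -- f is parallel to e, but xx₂ is not and can take its role.
      go (no y≢x₂) (yes refl) = EvenFactor-≈ (≈-prep ≈-swap)
        (even-factor-hub cubic″ conn″ none₂ (no-odd′ ∘ OnlyOdd-≈ ≈-swap) short′
          (reduce-hub cubic″ conn″ x≢x₁ x≢x₂ x≢y x∉R₂ (y≢x₂ ∘ sym) (y≢x₂ ∘ sym)))
        where
        cubic″ = Cubic-≈ (≈-prep ≈-swap) cubic′
        conn″ = TwoEdgeConnected-≈ (≈-prep ≈-swap) conn′

even-factor-< : ∀ k (a b : Fin n) (s : Bool) (R : List (Edge n)) → length R < k →
  Cubic (edge a b s true ∷ R) → TwoEdgeConnected (edge a b s true ∷ R) → ∑ required R ≡ 0 →
  ¬ OnlyOdd (edge a b s true) R → EvenFactor (edge a b s true ∷ R)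
even-factor-< (suc k) a b s R (s≤s short) = even-factor-step k (even-factor-< k) a b s R short

-- Homology of the projective plane

xor-interchange : ∀ a b c d → (a xor b) xor (c xor d) ≡ (a xor c) xor (b xor d)
xor-interchange = solve 4 (λ a b c d → ((a :+ b) :+ (c :+ d)) := ((a :+ c) :+ (b :+ d))) refl
  where open xor-∧-Solver using (solve; _:+_; _:=_)

-- An injective linear map over the field with two elements.
record Linear {k m : ℕ} (A : (Fin k → Bool) → Fin m → Bool) : Set where
  field
    ext : ∀ {s t} → (∀ i → s i ≡ t i) → ∀ e → A s e ≡ A t e
    additive : ∀ s t e → A (λ i → s i xor t i) e ≡ A s e xor A t e
    injective : ∀ t → (∀ e → A t e ≡ false) → ∀ i → t i ≡ false

-- `ι` selects k rows of the matrix of A that form an invertible square matrix. For the coboundary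
-- of a connected graph these are the edges of a spanning tree.
record Pivots {k m : ℕ} (A : (Fin k → Bool) → Fin m → Bool) : Set where
  field
    ι : Fin k → Fin m
    solve : (Fin k → Bool) → Fin k → Bool
    solves : ∀ t j → A (solve t) (ι j) ≡ t j

-- Gaussian elimination
pivots : ∀ {k m} {A : (Fin k → Bool) → Fin m → Bool} → Linear A → Pivots A
pivots {zero} lin = record { ι = λ () ; solve = λ t () ; solves = λ t () }
pivots {suc k} {m} {A} lin = pivot (any? λ p → A unit p 𝔹.≟ true)
  where
  open Linear lin
  unit : Fin (suc k) → Bool
  unit = true ◂ λ _ → false
  pivot : Dec (∃ λ p → A unit p ≡ true) → Pivots A
  pivot (no none) = case injective unit (λ e → 𝔹.¬-not λ eq → none (e , eq)) zero of λ ()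
  pivot (yes (p , pivot-p)) = record { ι = p ◂ ι ; solve = solve′ ; solves = check }
    where
    -- The coefficient of `unit` is chosen so that the image vanishes at the pivot p.
    eliminate : (Fin k → Bool) → Fin (suc k) → Bool
    eliminate t = A (false ◂ t) p ◂ t
    cons-ext : ∀ {b b′} {s t : Fin k → Bool} → b ≡ b′ → (∀ i → s i ≡ t i) → ∀ i → (b ◂ s) i ≡ (b′ ◂ t) i
    cons-ext eq eqs zero = eq
    cons-ext eq eqs (suc i) = eqs i
    cons-xor : ∀ b b′ (s t : Fin k → Bool) i → ((b xor b′) ◂ λ i → s i xor t i) i ≡ (b ◂ s) i xor (b′ ◂ t) i
    cons-xor b b′ s t zero = refl
    cons-xor b b′ s t (suc i) = refl
    head : ∀ b t e → A (b ◂ t) e ≡ (b ∧ A unit e) xor A (false ◂ t) e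
    head false t e = refl
    head true t e = trans (ext (λ i → trans (cons-ext refl (λ _ → refl) i) (cons-xor true false (λ _ → false) t i)) e)
                          (additive unit (false ◂ t) e)
    eliminated : ∀ t → A (eliminate t) p ≡ false
    eliminated t = trans (head (A (false ◂ t) p) t p)
      (trans (cong (_xor A (false ◂ t) p) (trans (cong (A (false ◂ t) p ∧_) pivot-p) (𝔹.∧-identityʳ _))) (𝔹.xor-same (A (false ◂ t) p)))
    rest : Linear (A ∘ eliminate)
    rest .Linear.ext eq = ext (cons-ext (ext (cons-ext refl eq) p) eq)
    rest .Linear.additive s t e = trans (ext (λ i → trans (cons-ext (trans (ext (cons-xor false false s t) p)
        (additive (false ◂ s) (false ◂ t) p)) (λ _ → refl) i) (cons-xor _ _ s t i)) e) (additive (eliminate s) (eliminate t) e)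
    rest .Linear.injective t zeros i = injective (eliminate t) zeros (suc i)
    open Pivots (pivots rest)
    residue : (Fin (suc k) → Bool) → Fin k → Bool
    residue t j = t (suc j) xor (t zero ∧ A unit (ι j))
    -- The multiple of `unit` settles the row p. `residue` subtracts its effect on the other rows,
    -- and the remaining system is solved by vectors that do not disturb p.
    solve′ : (Fin (suc k) → Bool) → Fin (suc k) → Bool
    solve′ t i = (t zero ∧ unit i) xor eliminate (solve (residue t)) i
    scaled : ∀ b e → A (λ i → b ∧ unit i) e ≡ b ∧ A unit e
    scaled true e = refl
    scaled false e = trans (additive (λ _ → false) (λ _ → false) e) (𝔹.xor-same (A (λ _ → false) e))
    value : ∀ t e → A (solve′ t) e ≡ (t zero ∧ A unit e) xor A (eliminate (solve (residue t))) e
    value t e = trans (additive (λ i → t zero ∧ unit i) (eliminate (solve (residue t))) e)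
                      (cong (_xor A (eliminate (solve (residue t))) e) (scaled (t zero) e))
    cancel : ∀ x y → x xor (y xor x) ≡ y
    cancel x y = trans (cong (x xor_) (𝔹.xor-comm y x)) (trans (sym (𝔹.xor-assoc x x y)) (cong (_xor y) (𝔹.xor-same x)))
    check : ∀ t j → A (solve′ t) ((p ◂ ι) j) ≡ t j
    check t zero = trans (value t p) (trans (cong₂ _xor_ (trans (cong (t zero ∧_) pivot-p) (𝔹.∧-identityʳ (t zero)))
                                                         (eliminated (solve (residue t)))) (𝔹.xor-identityʳ (t zero)))
    check t (suc j) = trans (value t (ι j)) (trans (cong ((t zero ∧ A unit (ι j)) xor_) (solves (residue t) j))
                                                   (cancel (t zero ∧ A unit (ι j)) (t (suc j))))


-- Finite sums, the handshake lemma and sets of edges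

private module ℕ-Sum = Algebra.Properties.CommutativeMonoid.Sum ℕ.+-0-commutativeMonoid
open ℕ-Sum using (sum; sum-cong-≗; ∑-distrib-+)

sum-const : ∀ m k → sum {m} (λ _ → k) ≡ m * k
sum-const zero k = refl
sum-const (suc m) k = cong (k +_) (sum-const m k)

sum-mono : ∀ {m} {f g : Fin m → ℕ} → (∀ i → f i ≤ g i) → sum f ≤ sum g
sum-mono {zero} le = z≤n
sum-mono {suc m} le = ℕ.+-mono-≤ (le zero) (sum-mono (le ∘ suc))

sum-single : ∀ {m} (f : Fin m → ℕ) (i : Fin m) → (∀ j → j ≢ i → f j ≡ 0) → sum f ≡ f i
sum-single {suc m} f zero off = trans (cong (f zero +_) (trans (sum-cong-≗ (λ j → off (suc j) λ ()))
  (trans (sum-const m 0) (ℕ.*-zeroʳ m)))) (ℕ.+-identityʳ (f zero))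
sum-single {suc m} f (suc i) off = trans (cong (_+ sum (f ∘ suc)) (off zero λ ()))
  (sum-single (f ∘ suc) i λ j ne → off (suc j) λ { refl → ne refl })

sum-one : ∀ {m} (f : Fin m → ℕ) (i : Fin m) → f i ≤ sum f
sum-one f zero = ℕ.m≤m+n _ _
sum-one f (suc i) = ℕ.≤-trans (sum-one (f ∘ suc) i) (ℕ.m≤n+m _ _)

sum-two : ∀ {m} (f : Fin m → ℕ) {i j : Fin m} → i ≢ j → f i + f j ≤ sum f
sum-two f {zero} {zero} ne = ⊥-elim (ne refl)
sum-two f {zero} {suc j} ne = ℕ.+-monoʳ-≤ (f zero) (sum-one (f ∘ suc) j)
sum-two f {suc i} {zero} ne = subst (_≤ sum f) (ℕ.+-comm (f zero) (f (suc i))) (ℕ.+-monoʳ-≤ (f zero) (sum-one (f ∘ suc) i))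
sum-two f {suc i} {suc j} ne = ℕ.≤-trans (sum-two (f ∘ suc) (ne ∘ cong suc)) (ℕ.m≤n+m _ (f zero))

sum-δ : (a : Fin n) → sum (λ v → δ v a) ≡ 1
sum-δ a = trans (sum-single _ a λ v → δ-≢) (δ-refl a)

handshake : (N : List (Edge n)) → sum (λ v → deg v N) ≡ 2 * length N
handshake {n} [] = trans (sum-const n 0) (ℕ.*-zeroʳ n)
handshake (edge a b s r ∷ N) = trans (∑-distrib-+ (λ v → δ v a + δ v b) (λ v → deg v N))
  (trans (cong₂ _+_ (trans (∑-distrib-+ (λ v → δ v a) (λ v → δ v b)) (cong₂ _+_ (sum-δ a) (sum-δ b))) (handshake N))
         (lemma (length N)))
  where
  lemma : ∀ l → 2 + 2 * l ≡ 2 * (1 + l)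
  lemma = solve-∀

∑-tabulate : ∀ {m} (φ : Edge n → ℕ) (f : Fin m → Edge n) → ∑ φ (tabulate f) ≡ sum (φ ∘ f)
∑-tabulate {m = zero} φ f = refl
∑-tabulate {m = suc m} φ f = cong (φ (f zero) +_) (∑-tabulate φ (f ∘ suc))

chosen : ∀ {m} → (Fin m → Edge n) → (Fin m → Bool) → List (Edge n)
chosen {m = zero} f g = []
chosen {m = suc m} f g with g zero
... | true = f zero ∷ chosen (f ∘ suc) (g ∘ suc)
... | false = chosen (f ∘ suc) (g ∘ suc)

odd-chosen : ∀ {m} (φ : Edge n → ℕ) (f : Fin m → Edge n) (g : Fin m → Bool) →
             odd (∑ φ (chosen f g)) ≡ ⨁ (λ e → g e ∧ odd (φ (f e)))
odd-chosen {m = zero} φ f g = sym (⨁-nil _)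
odd-chosen {m = suc m} φ f g = trans (first (g zero) refl) (sym (⨁-suc λ e → g e ∧ odd (φ (f e))))
  where
  first : ∀ b → g zero ≡ b → odd (∑ φ (chosen f g)) ≡ (g zero ∧ odd (φ (f zero))) xor ⨁ (λ e → g (suc e) ∧ odd (φ (f (suc e))))
  first true eq rewrite eq = trans (odd-+ (φ (f zero)) (∑ φ (chosen (f ∘ suc) (g ∘ suc))))
    (cong (odd (φ (f zero)) xor_) (odd-chosen φ (f ∘ suc) (g ∘ suc)))
  first false eq rewrite eq = odd-chosen φ (f ∘ suc) (g ∘ suc)

length-chosen : ∀ {m} (f : Fin m → Edge n) (g : Fin m → Bool) → length (chosen f g) ≡ ∣ Vec.tabulate g ∣
length-chosen {m = zero} f g = refl
length-chosen {m = suc m} f g with g zero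
... | true = cong suc (length-chosen (f ∘ suc) (g ∘ suc))
... | false = length-chosen (f ∘ suc) (g ∘ suc)

length-tabulate : ∀ {m} (f : Fin m → Edge n) → length (tabulate f) ≡ m
length-tabulate {m = zero} f = refl
length-tabulate {m = suc m} f = cong suc (length-tabulate (f ∘ suc))

Select-chosen : ∀ {m} (f : Fin m → Edge n) {N : List (Edge n)} → Select (tabulate f) N → ∃ λ g → chosen f g ≡ N
Select-chosen {m = zero} f [] = (λ ()) , refl
Select-chosen {m = suc m} f (keep S) with g , refl ← Select-chosen (f ∘ suc) S = (true ◂ g) , refl
Select-chosen {m = suc m} f (drop _ S) with g , refl ← Select-chosen (f ∘ suc) S = (false ◂ g) , refl

-- Two missed points, added to κ, would embed m + 2 points into m + 1.
almost-onto : ∀ {m k} (κ : Fin m → Fin k) → (∀ {i j} → κ i ≡ κ j → i ≡ j) → k ≡ suc m →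
              ∃ λ z → ∀ e → e ≢ z → ∃ λ i → κ i ≡ e
almost-onto {m} κ inj refl with any? (λ z → ¬? (any? (λ i → κ i ≟ z)))
... | no all = zero , λ e _ → decidable-stable (any? λ i → κ i ≟ e) λ none → all (e , none)
... | yes (z , z∉) = z , λ e e≢z → decidable-stable (any? λ i → κ i ≟ e) λ e∉ →
  ℕ.1+n≰n (injective⇒≤ {f = z ◂ (e ◂ κ)} (inj′ e e≢z e∉))
  where
  inj′ : ∀ e → e ≢ z → ¬ (∃ λ i → κ i ≡ e) → ∀ {i j} → (z ◂ (e ◂ κ)) i ≡ (z ◂ (e ◂ κ)) j → i ≡ j
  inj′ e e≢z e∉ {zero} {zero} eq = refl
  inj′ e e≢z e∉ {zero} {suc zero} eq = ⊥-elim (e≢z (sym eq))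
  inj′ e e≢z e∉ {zero} {suc (suc j)} eq = ⊥-elim (z∉ (j , sym eq))
  inj′ e e≢z e∉ {suc zero} {zero} eq = ⊥-elim (e≢z eq)
  inj′ e e≢z e∉ {suc zero} {suc zero} eq = refl
  inj′ e e≢z e∉ {suc zero} {suc (suc j)} eq = ⊥-elim (e∉ (j , sym eq))
  inj′ e e≢z e∉ {suc (suc i)} {zero} eq = ⊥-elim (z∉ (i , eq))
  inj′ e e≢z e∉ {suc (suc i)} {suc zero} eq = ⊥-elim (e∉ (i , eq))
  inj′ e e≢z e∉ {suc (suc i)} {suc (suc j)} eq = cong (λ i → suc (suc i)) (inj eq)

-- b₀, b₁, b₂ are the boundary edges of a face.
record Triangulation (V E F : ℕ) : Set where
  field
    end₁ end₂ : Fin E → Fin V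
    side₁ side₂ : Fin E → Fin F
    b₀ b₁ b₂ : Fin F → Fin E

  coboundary : (Fin V → Bool) → Fin E → Bool
  coboundary c e = c (end₁ e) xor c (end₂ e)

  field
    no-loop : ∀ e → end₁ e ≢ end₂ e
    connected₁ : ∀ (c : Fin V → Bool) → (∀ e → c (end₁ e) ≡ c (end₂ e)) → ∀ v w → c v ≡ c w
    connected₂ : ∀ (c : Fin F → Bool) → (∀ e → c (side₁ e) ≡ c (side₂ e)) → ∀ v w → c v ≡ c w
    incidence : ∀ f e → δ f (side₁ e) + δ f (side₂ e) ≡ δ e (b₀ f) + (δ e (b₁ f) + δ e (b₂ f))
    triangle : ∀ c f → coboundary c (b₀ f) xor (coboundary c (b₁ f) xor coboundary c (b₂ f)) ≡ false
    euler : V + F ≡ E + 1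

-- The signed dual graph, cocycles and their pairing with cuts

module Dual {V E F : ℕ} (T : Triangulation V E F) where
  open Triangulation T

  -- A cut of the dual graph. In the triangulation it is the sum of the boundaries of the faces of
  -- colour `true`.
  cocoboundary : (Fin F → Bool) → Fin E → Bool
  cocoboundary c e = c (side₁ e) xor c (side₂ e)

  dual : (Fin E → Bool) → Fin E → Edge F
  dual s e = edge (side₁ e) (side₂ e) (s e) false

  unsigned : Fin E → Bool
  unsigned _ = false

  pairing : (Fin E → Bool) → (Fin E → Bool) → Bool
  pairing g h = ⨁ (λ e → g e ∧ h e)

  -- Hence the even subgraphs of the dual are the cocycles of the triangulation.
  odd-degree : ∀ s g f → odd (deg f (chosen (dual s) g)) ≡ g (b₀ f) xor (g (b₁ f) xor g (b₂ f))
  odd-degree s g f = trans (odd-chosen (inc f) (dual s) g) (trans (⨁-cong expand)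
    (trans (⨁-xor (at b₀) (λ e → at b₁ e xor at b₂ e)) (cong₂ _xor_ (⨁-δ g (b₀ f))
      (trans (⨁-xor (at b₁) (at b₂)) (cong₂ _xor_ (⨁-δ g (b₁ f)) (⨁-δ g (b₂ f)))))))
    where
    at : (Fin F → Fin E) → Fin E → Bool
    at b e = g e ∧ odd (δ e (b f))
    expand : ∀ e → g e ∧ odd (δ f (side₁ e) + δ f (side₂ e)) ≡ at b₀ e xor (at b₁ e xor at b₂ e)
    expand e rewrite incidence f e | odd-+ (δ e (b₀ f)) (δ e (b₁ f) + δ e (b₂ f)) | odd-+ (δ e (b₁ f)) (δ e (b₂ f)) =
      trans (𝔹.∧-distribˡ-xor (g e) _ _) (cong (at b₀ e xor_) (𝔹.∧-distribˡ-xor (g e) _ _))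

  cut-chosen : ∀ s g c → odd (∑ (cut c) (chosen (dual s) g)) ≡ pairing g (cocoboundary c)
  cut-chosen s g c = trans (odd-chosen (cut c) (dual s) g) (⨁-cong λ e → cong (g e ∧_) (odd-⟦⟧ _))

  cocycle-pairing : ∀ s g c → (∀ f → odd (deg f (chosen (dual s) g)) ≡ false) → pairing g (cocoboundary c) ≡ false
  cocycle-pairing s g c even = trans (sym (cut-chosen s g c)) (even-cut c (chosen (dual s) g) even)

  orthogonal : ∀ a c → pairing (coboundary a) (cocoboundary c) ≡ false
  orthogonal a c = cocycle-pairing unsigned (coboundary a) c λ f → trans (odd-degree unsigned (coboundary a) f) (triangle a f)

  degree-three : ∀ s f → deg f (tabulate (dual s)) ≡ 3
  degree-three s f = trans (∑-tabulate (inc f) (dual s)) (trans (sum-cong-≗ (incidence f))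
    (trans (∑-distrib-+ (λ e → δ e (b₀ f)) _) (cong₂ _+_ (sum-δ (b₀ f))
      (trans (∑-distrib-+ (λ e → δ e (b₁ f)) _) (cong₂ _+_ (sum-δ (b₁ f)) (sum-δ (b₂ f)))))))

  dual-cubic : ∀ s → Cubic (tabulate (dual s))
  dual-cubic s .degrees f = inj₂ (degree-three s f)

  -- A bridge of the dual graph would be a loop, since cuts of the dual graph are orthogonal to vertex stars.
  dual-connected : ∀ s → TwoEdgeConnected (tabulate (dual s))
  dual-connected s .constant c small v w _ _ with any? (λ e → cocoboundary c e 𝔹.≟ true)
  ... | no none = connected₂ c (λ e → xor-false _ _ (𝔹.¬-not λ eq → none (e , eq))) v w
  ... | yes (e , crosses) = ⊥-elim (case trans (sym (orthogonal atEnd c)) one of λ ())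
    where
    atEnd : Fin V → Bool
    atEnd = indicator (end₁ e)
    only : ∀ j → j ≢ e → cocoboundary c j ≡ false
    only j ne = ⟦⟧-0 _ (ℕ.n≤0⇒n≡0 (s≤s⁻¹ (subst (λ t → t + ⟦ cocoboundary c j ⟧ ≤ 1) (cong ⟦_⟧ crosses)
      (ℕ.≤-trans (sum-two (λ e → ⟦ cocoboundary c e ⟧) (ne ∘ sym)) (subst (_≤ 1) (∑-tabulate (cut c) (dual s)) small)))))
    one : pairing (coboundary atEnd) (cocoboundary c) ≡ true
    one = trans (⨁-single _ e λ j ne → trans (cong (coboundary atEnd j ∧_) (only j ne)) (𝔹.∧-zeroʳ _))
      (cong₂ _∧_ (cong₂ _xor_ (indicator-refl (end₁ e)) (indicator-≢ (no-loop e ∘ sym))) crosses)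

coboundary-⨁ : ∀ {m k} (g : Fin k → Bool) (a : Fin k → Fin m → Bool) (v w : Fin m) →
               ⨁ (λ i → g i ∧ a i v) xor ⨁ (λ i → g i ∧ a i w) ≡ ⨁ (λ i → g i ∧ (a i v xor a i w))
coboundary-⨁ g a v w = sym (trans (⨁-cong λ i → 𝔹.∧-distribˡ-xor (g i) (a i v) (a i w)) (⨁-xor (λ i → g i ∧ a i v) (λ i → g i ∧ a i w)))

-- A set P of v edges (a spanning tree) and a set P′ of f edges (a spanning tree of the dual, disjoint from P) leave
-- a single edge z. Modulo coboundaries a cocycle vanishes on P, and it is then determined by its value at z.
module Homology {v f E : ℕ} (T : Triangulation (suc v) E (suc f)) where
  open Triangulation T
  open Dual T

  -- Colourings modulo constants: fixing one colour makes the coboundary of a connected graph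
  -- injective.
  grounded : {m : ℕ} → (Fin m → Bool) → Fin (suc m) → Bool
  grounded t = false ◂ t

  private
    xor-grounded : ∀ {m} (s t : Fin m → Bool) i → grounded (λ i → s i xor t i) i ≡ grounded s i xor grounded t i
    xor-grounded s t zero = refl
    xor-grounded s t (suc i) = refl

    cong-grounded : ∀ {m} {s t : Fin m → Bool} → (∀ i → s i ≡ t i) → ∀ i → grounded s i ≡ grounded t i
    cong-grounded eq zero = refl
    cong-grounded eq (suc i) = eq i

    -- Used twice: for the graph with all edges, and for the dual with `mask` restricting to the
    -- edges outside the tree.
    δ-linear : {m : ℕ} (p q : Fin E → Fin (suc m)) (mask : Fin E → Bool) →
      (∀ t → (∀ e → mask e ∧ (grounded t (p e) xor grounded t (q e)) ≡ false) → ∀ v w → grounded t v ≡ grounded t w) →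
      Linear (λ t e → mask e ∧ (grounded t (p e) xor grounded t (q e)))
    δ-linear p q mask conn .Linear.ext eq e =
      cong (mask e ∧_) (cong₂ _xor_ (cong-grounded eq (p e)) (cong-grounded eq (q e)))
    δ-linear p q mask conn .Linear.additive s t e =
      trans (cong (mask e ∧_) (trans (cong₂ _xor_ (xor-grounded s t (p e)) (xor-grounded s t (q e)))
              (xor-interchange (grounded s (p e)) (grounded t (p e)) (grounded s (q e)) (grounded t (q e)))))
            (𝔹.∧-distribˡ-xor (mask e) _ _)
    δ-linear p q mask conn .Linear.injective t zeros i = conn t zeros (suc i) zero

  tree : Pivots (λ t e → true ∧ coboundary (grounded t) e)
  tree = pivots (δ-linear end₁ end₂ (λ _ → true) λ t zeros → connected₁ (grounded t) λ e → xor-false _ _ (zeros e))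

  open Pivots tree renaming (ι to ι₁; solve to solve₁; solves to solves₁)

  private
    unit : {m : ℕ} → Fin m → Fin m → Bool
    unit i j = does (j ≟ i)

    unit-≢ : {m : ℕ} {i j : Fin m} → j ≢ i → unit i j ≡ false
    unit-≢ {i = i} {j} ne = dec-false (j ≟ i) ne

    unit-refl : {m : ℕ} (i : Fin m) → unit i i ≡ true
    unit-refl i = dec-true (i ≟ i) refl

  inTree? : (e : Fin E) → Dec (∃ λ i → ι₁ i ≡ e)
  inTree? e = any? λ i → ι₁ i ≟ e

  outside : Fin E → Bool
  outside e = not (does (inTree? e))

  outside-true : ∀ {e} → ¬ (∃ λ i → ι₁ i ≡ e) → outside e ≡ true
  outside-true {e} none = cong not (dec-false (inTree? e) none)

  -- Its coboundary is the fundamental cut of the i-th tree edge, which meets the tree in this edge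
  -- only.
  star₁ : Fin v → Fin (suc v) → Bool
  star₁ i = grounded (solve₁ (unit i))

  -- The dual remains connected without the tree edges. A dual cut inside the tree, paired with the
  -- fundamental cut of a tree edge, leaves only its value on that edge, which is `false` by
  -- orthogonality.
  cotree-constant : ∀ c → (∀ e → outside e ∧ cocoboundary c e ≡ false) → ∀ v w → c v ≡ c w
  cotree-constant c zeros = connected₂ c λ e → xor-false _ _ (vanish e (inTree? e))
    where
    off : ∀ e → ¬ (∃ λ i → ι₁ i ≡ e) → cocoboundary c e ≡ false
    off e none = trans (cong (_∧ cocoboundary c e) (sym (outside-true none))) (zeros e)
    vanish : ∀ e → Dec (∃ λ i → ι₁ i ≡ e) → cocoboundary c e ≡ false
    vanish e (no none) = off e none
    vanish e (yes (i , refl)) = trans (cong (_∧ cocoboundary c (ι₁ i)) (sym (trans (solves₁ (unit i) i) (unit-refl i))))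
      (trans (sym (⨁-single (λ e → coboundary (star₁ i) e ∧ cocoboundary c e) (ι₁ i) λ e ne → other e ne (inTree? e)))
             (orthogonal (star₁ i) c))
      where
      other : ∀ e → e ≢ ι₁ i → Dec (∃ λ j → ι₁ j ≡ e) → coboundary (star₁ i) e ∧ cocoboundary c e ≡ false
      other e ne (no none) = trans (cong (coboundary (star₁ i) e ∧_) (off e none)) (𝔹.∧-zeroʳ _)
      other e ne (yes (j , refl)) = cong (_∧ cocoboundary c (ι₁ j)) (trans (solves₁ (unit i) j) (unit-≢ {i = i} {j} λ { refl → ne refl }))

  cotree : Pivots (λ t e → outside e ∧ cocoboundary (grounded t) e)
  cotree = pivots (δ-linear side₁ side₂ outside λ t zeros → cotree-constant (grounded t) zeros)

  open Pivots cotree renaming (ι to ι₂; solve to solve₂; solves to solves₂)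

  -- Its dual cut meets the cotree in the i-th edge only; on the tree it is arbitrary.
  star₂ : Fin f → Fin (suc f) → Bool
  star₂ i = grounded (solve₂ (unit i))

  ∧-true : ∀ a b → a ∧ b ≡ true → a ≡ true × b ≡ true
  ∧-true true true eq = refl , refl

  cotree-unit : ∀ j → outside (ι₂ j) ≡ true × cocoboundary (star₂ j) (ι₂ j) ≡ true
  cotree-unit j = ∧-true (outside (ι₂ j)) (cocoboundary (star₂ j) (ι₂ j)) (trans (solves₂ (unit j) j) (unit-refl j))

  disjoint : ∀ i j → ι₁ i ≢ ι₂ j
  disjoint i j eq = case trans (sym (proj₁ (cotree-unit j))) (cong not (dec-true (inTree? (ι₂ j)) (i , eq))) of λ ()

  unit-injective : {m : ℕ} {A : (Fin m → Bool) → Fin E → Bool} (P : Pivots A) →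
                   ∀ {i j} → Pivots.ι P i ≡ Pivots.ι P j → i ≡ j
  unit-injective {A = A} P {i} {j} eq with i ≟ j
  ... | yes i≡j = i≡j
  ... | no i≢j = ⊥-elim (case trans (sym (trans (Pivots.solves P (unit i) i) (unit-refl i)))
      (trans (cong (A (Pivots.solve P (unit i))) eq) (trans (Pivots.solves P (unit i) j) (unit-≢ (i≢j ∘ sym)))) of λ ())

  κ : Fin (v + f) → Fin E
  κ k = [ ι₁ , ι₂ ]′ (splitAt v k)

  κ-injective : ∀ {k l} → κ k ≡ κ l → k ≡ l
  κ-injective {k} {l} eq = trans (sym (join-splitAt v f k)) (trans (cong (join v f) (go (splitAt v k) (splitAt v l) eq)) (join-splitAt v f l))
    where
    go : ∀ p q → [ ι₁ , ι₂ ]′ p ≡ [ ι₁ , ι₂ ]′ q → p ≡ q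
    go (inj₁ i) (inj₁ j) eq = cong inj₁ (unit-injective tree eq)
    go (inj₁ i) (inj₂ j) eq = ⊥-elim (disjoint i j eq)
    go (inj₂ i) (inj₁ j) eq = ⊥-elim (disjoint j i (sym eq))
    go (inj₂ i) (inj₂ j) eq = cong inj₂ (unit-injective cotree eq)

  remaining : ∃ λ z → ∀ e → e ≢ z → (∃ λ i → ι₁ i ≡ e) ⊎ (∃ λ j → ι₂ j ≡ e)
  remaining with almost-onto κ κ-injective size
    where
    size : E ≡ suc (v + f)
    size = ℕ.suc-injective (trans (ℕ.+-comm 1 E) (trans (sym euler) (cong suc (ℕ.+-suc v f))))
  ... | z , onto = z , λ e ne → let k , eq = onto e ne in side (splitAt v k) eq
    where
    side : ∀ {e} p → [ ι₁ , ι₂ ]′ p ≡ e → (∃ λ i → ι₁ i ≡ e) ⊎ (∃ λ j → ι₂ j ≡ e)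
    side (inj₁ i) eq = inj₁ (i , eq)
    side (inj₂ j) eq = inj₂ (j , eq)

  z : Fin E
  z = proj₁ remaining

  -- The combination of fundamental cuts whose coboundary agrees with g on the tree.
  correction : (Fin E → Bool) → Fin (suc v) → Bool
  correction g w = ⨁ (λ i → g (ι₁ i) ∧ star₁ i w)

  -- The functional g ↦ corrected g z, see `pairing-signs`.
  signs : Fin E → Bool
  signs e = unit z e xor ⨁ (λ i → unit (ι₁ i) e ∧ coboundary (star₁ i) z)

  corrected : (Fin E → Bool) → Fin E → Bool
  corrected g e = g e xor coboundary (correction g) e

  coboundary-correction : ∀ g e → coboundary (correction g) e ≡ ⨁ (λ i → g (ι₁ i) ∧ coboundary (star₁ i) e)
  coboundary-correction g e = coboundary-⨁ (g ∘ ι₁) star₁ (end₁ e) (end₂ e)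

  pairing-signs : ∀ g → pairing g signs ≡ corrected g z
  pairing-signs g = trans (⨁-cong λ e → 𝔹.∧-distribˡ-xor (g e) (unit z e) _)
    (trans (⨁-xor (λ e → g e ∧ unit z e) (λ e → g e ∧ ⨁ (λ i → unit (ι₁ i) e ∧ κ′ i)))
      (cong₂ _xor_ at-z (trans (⨁-cong λ e → ∧-⨁ (g e) (λ i → unit (ι₁ i) e ∧ κ′ i))
        (trans (⨁-comm (λ e i → g e ∧ (unit (ι₁ i) e ∧ κ′ i)))
          (trans (⨁-cong at-tree) (sym (coboundary-correction g z)))))))
    where
    κ′ : Fin v → Bool
    κ′ i = coboundary (star₁ i) z
    ∧-⨁ : ∀ {k} b (h : Fin k → Bool) → b ∧ ⨁ h ≡ ⨁ (λ i → b ∧ h i)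
    ∧-⨁ true h = refl
    ∧-⨁ false h = sym (⨁-false {f = λ i → false ∧ h i} λ _ → refl)
    at-z : ⨁ (λ e → g e ∧ unit z e) ≡ g z
    at-z = trans (⨁-single _ z λ e ne → trans (cong (g e ∧_) (unit-≢ ne)) (𝔹.∧-zeroʳ (g e)))
                 (trans (cong (g z ∧_) (unit-refl z)) (𝔹.∧-identityʳ (g z)))
    at-tree : ∀ i → ⨁ (λ e → g e ∧ (unit (ι₁ i) e ∧ κ′ i)) ≡ g (ι₁ i) ∧ κ′ i
    at-tree i = trans (⨁-single _ (ι₁ i) λ e ne → trans (cong (λ b → g e ∧ (b ∧ κ′ i)) (unit-≢ ne)) (𝔹.∧-zeroʳ (g e)))
                      (cong (λ b → g (ι₁ i) ∧ (b ∧ κ′ i)) (unit-refl (ι₁ i)))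

  -- The cocycle `corrected g` vanishes on the tree by construction and at z by the sign condition.
  -- Its pairing with the dual cut of `star₂ j` is zero and reduces to the value at the j-th cotree
  -- edge, so it vanishes there too.
  exact : ∀ s g → (∀ w → odd (deg w (chosen (dual s) g)) ≡ false) → pairing g signs ≡ false →
          ∀ e → g e ≡ coboundary (correction g) e
  exact s g even sign e = xor-false _ _ (vanishes e)
    where
    on-tree : ∀ i → corrected g (ι₁ i) ≡ false
    on-tree i = trans (cong (g (ι₁ i) xor_) (trans (coboundary-correction g (ι₁ i))
      (trans (⨁-single _ i λ j ne → trans (cong (g (ι₁ j) ∧_) (trans (solves₁ (unit j) i) (unit-≢ (ne ∘ sym)))) (𝔹.∧-zeroʳ _))
             (trans (cong (g (ι₁ i) ∧_) (trans (solves₁ (unit i) i) (unit-refl i))) (𝔹.∧-identityʳ _)))))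
      (𝔹.xor-same (g (ι₁ i)))
    on-z : corrected g z ≡ false
    on-z = trans (sym (pairing-signs g)) sign
    on-cotree : ∀ j → corrected g (ι₂ j) ≡ false
    on-cotree j = trans (sym (trans (⨁-single _ (ι₂ j) elsewhere)
        (trans (cong (corrected g (ι₂ j) ∧_) (proj₂ (cotree-unit j))) (𝔹.∧-identityʳ _)))) cocycle
      where
      cocycle : ⨁ (λ e → corrected g e ∧ cocoboundary (star₂ j) e) ≡ false
      cocycle = trans (⨁-cong λ e → 𝔹.∧-distribʳ-xor (cocoboundary (star₂ j) e) (g e) _)
        (trans (⨁-xor (λ e → g e ∧ cocoboundary (star₂ j) e) (λ e → coboundary (correction g) e ∧ cocoboundary (star₂ j) e))
          (cong₂ _xor_ (cocycle-pairing s g (star₂ j) even) (orthogonal (correction g) (star₂ j))))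
      elsewhere : ∀ e → e ≢ ι₂ j → corrected g e ∧ cocoboundary (star₂ j) e ≡ false
      elsewhere e ne with e ≟ z
      ... | yes refl = cong (_∧ cocoboundary (star₂ j) z) on-z
      ... | no e≢z with proj₂ remaining e e≢z
      ...   | inj₁ (i , refl) = cong (_∧ cocoboundary (star₂ j) (ι₁ i)) (on-tree i)
      ...   | inj₂ (i , refl) = trans (cong (corrected g (ι₂ i) ∧_) (trans (cong (_∧ cocoboundary (star₂ j) (ι₂ i))
                (sym (proj₁ (cotree-unit i))))
                (trans (solves₂ (unit j) i) (unit-≢ {i = j} {i} λ { refl → ne refl })))) (𝔹.∧-zeroʳ _)
    vanishes : ∀ e → corrected g e ≡ false
    vanishes e with e ≟ z
    ... | yes refl = on-z
    ... | no e≢z with proj₂ remaining e e≢z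
    ...   | inj₁ (i , refl) = on-tree i
    ...   | inj₂ (j , refl) = on-cotree j

-- If the edge ab is the only odd edge, then any 2-factor through the two other edges at a avoids it and is even.
even-factor : {a b : Fin n} {s : Bool} {R : List (Edge n)} → ∑ required R ≡ 0 → Cubic (edge a b s false ∷ R) →
              TwoEdgeConnected (edge a b s false ∷ R) → EvenFactor (edge a b s false ∷ R)
even-factor {n} {a} {b} {s} {R} none cubic conn = go (onlyOdd? (edge a b s true) R)
  where
  relabel : Cubic (edge a b s true ∷ R) × TwoEdgeConnected (edge a b s true ∷ R)
  relabel = mkCubic (cubic .degrees) , mkConnected (conn .constant)
  go : Dec (OnlyOdd (edge a b s true) R) → EvenFactor (edge a b s false ∷ R)
  go (no fine) = unmark (even-factor-< (suc (length R)) a b s R ℕ.≤-refl (proj₁ relabel) (proj₂ relabel) none fine)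
    where
    unmark : EvenFactor (edge a b s true ∷ R) → EvenFactor (edge a b s false ∷ R)
    unmark (evenFactor {N = _ ∷ N} z (keep S) F even) =
      evenFactor {N = edge a b s false ∷ N} z (keep S) (mkFactor (F .covers)) even
  go (yes (onlyOdd c odd-e rest)) = through (star-of cubic conn)
    where
    through : Star a b R → EvenFactor (edge a b s false ∷ R)
    through (star {p} {q} {s₁} {r₁} {s₂} {r₂} {R₂} split a≢b a≢p a≢q a∉R₂)
      with refl , none₁ ← required-none split none
      with refl , none₂ ← required-none {e = edge a q s₂ r₂} {R = R₂} ≈-refl none₁ =
      EvenFactor-≈ (≈-prep split) (build (two-factor (edge a b s false ∷ edge a p s₁ true ∷ edge a q s₂ true ∷ R₂)
        (mkCubic (Cubic-≈ (≈-prep split) cubic .degrees)) (mkConnected (TwoEdgeConnected-≈ (≈-prep split) conn .constant))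
        (subst (λ t → 2 + t ≤ 2) (sym none₂) ℕ.≤-refl)))
      where
      build : TwoFactor (edge a b s false ∷ edge a p s₁ true ∷ edge a q s₂ true ∷ R₂) →
              EvenFactor (edge a b s false ∷ edge a p s₁ false ∷ edge a q s₂ false ∷ R₂)
      build (twoFactor (keep (keep (keep {N = N} S))) F) with F .covers a
      ... | inj₁ eq = ⊥-elim (absurd (δ a b) (δ a p) (δ a q) (deg a N) (δ-refl a) eq)
        where
        absurd : ∀ {t} x y z m → t ≡ 1 → (t + x) + ((t + y) + ((t + z) + m)) ≢ 2
        absurd x y z m refl eq = case trans (sym (lemma x y z m)) eq of λ ()
          where
          lemma : ∀ a b c m → (1 + a) + ((1 + b) + ((1 + c) + m)) ≡ 3 + (a + b + c + m)
          lemma = solve-∀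
      ... | inj₂ (eq , _) = ⊥-elim (δ-0 (proj₁ (sum-≡0 (proj₁ (sum-≡0 eq)))) refl)
      build (twoFactor (drop refl (keep (keep {N = N} S))) F) =
        evenFactor {N = edge a p s₁ false ∷ edge a q s₂ false ∷ N} a (drop refl (keep (keep S))) (mkFactor (weaken F .covers))
          (even-sign c (edge a p s₁ false ∷ edge a q s₂ false ∷ N)
            (Select-zero {φ = violated c} {es = edge a p s₁ false ∷ edge a q s₂ false ∷ R₂} (keep (keep S))
              (trans (sym (∑-≈ (violated-sym c) split)) rest))
            (Factor-even F))

-- From an even factor of the dual to a large cut

module Count {V E f : ℕ} (T : Triangulation V E (suc f)) (signs : Fin E → Bool) where
  open Dual T

  module _ (found : EvenFactor (tabulate (dual signs))) where
    open EvenFactor found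

    edges : Fin E → Bool
    edges = proj₁ (Select-chosen (dual signs) select)

    chosen-N : chosen (dual signs) edges ≡ N
    chosen-N = proj₂ (Select-chosen (dual signs) select)

    count-faces : 3 * suc f ≡ 2 * E
    count-faces = trans (ℕ.*-comm 3 (suc f)) (trans (sym (trans (sum-cong-≗ (degree-three signs)) (sum-const (suc f) 3)))
      (trans (handshake (tabulate (dual signs))) (cong (2 *_) (length-tabulate (dual signs)))))

    -- Adding 2 at `missed` brings every degree up to at least 2; both sides are then summed over
    -- the faces and halved.
    count-factor : suc f ≤ suc (length N)
    count-factor = ℕ.*-cancelˡ-≤ 2 (subst₂ _≤_ (trans (sum-const (suc f) 2) (ℕ.*-comm (suc f) 2)) total (sum-mono nearly))
      where
      nearly : ∀ w → 2 ≤ 2 * δ w missed + deg w N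
      nearly w with factor .covers w
      ... | inj₁ eq = subst (λ t → 2 ≤ 2 * δ w missed + t) (sym eq) (ℕ.m≤n+m 2 _)
      ... | inj₂ (_ , inj₁ eq) = ⊥-elim (case trans (sym (degree-three signs w)) eq of λ ())
      ... | inj₂ (_ , inj₂ refl) = subst (λ t → 2 ≤ 2 * t + deg w N) (sym (δ-refl w)) (ℕ.m≤m+n 2 _)
      total : sum (λ w → 2 * δ w missed + deg w N) ≡ 2 * suc (length N)
      total = trans (∑-distrib-+ (λ w → 2 * δ w missed) (λ w → deg w N))
        (trans (cong₂ _+_ (trans (sum-single _ missed λ w ne → cong (2 *_) (δ-≢ ne)) (cong (2 *_) (δ-refl missed))) (handshake N))
               (sym (ℕ.*-suc 2 (length N))))

    even-degrees : ∀ w → odd (deg w (chosen (dual signs) edges)) ≡ false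
    even-degrees w = trans (cong (λ L → odd (deg w L)) chosen-N) (Factor-even factor w)

    even-pairing : pairing edges signs ≡ false
    even-pairing = trans (⨁-cong λ e → cong (edges e ∧_) (sym (odd-⟦⟧ (signs e))))
      (trans (sym (odd-chosen negative (dual signs) edges)) (trans (cong oddly chosen-N) even))

    bound : 2 * E ≤ 3 * ∣ Vec.tabulate edges ∣ + 3
    bound = subst₂ _≤_ count-faces (lemma _)
      (ℕ.*-monoʳ-≤ 3 (subst (λ l → suc f ≤ suc l) (trans (cong length (sym chosen-N)) (length-chosen (dual signs) edges)) count-factor))
      where
      lemma : ∀ l → 3 * suc l ≡ 3 * l + 3
      lemma = solve-∀

unrequired : ∀ {m n} (h : Fin m → Edge n) → (∀ i → req (h i) ≡ false) → ∑ required (tabulate h) ≡ 0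
unrequired {zero} h eq = refl
unrequired {suc m} h eq = cong₂ _+_ (cong ⟦_⟧ (eq zero)) (unrequired (h ∘ suc) (eq ∘ suc))

-- The successors supply an edge from which `even-factor` starts, and the vertex and the face that
-- are grounded.
large-cut : {v E f : ℕ} (T : Triangulation (suc v) (suc E) (suc f)) →
            ∃₂ λ c g → (∀ e → g e ≡ Triangulation.coboundary T c e) × 2 * suc E ≤ 3 * ∣ Vec.tabulate g ∣ + 3
large-cut T = finish (even-factor (unrequired (dual signs ∘ suc) (λ _ → refl)) (dual-cubic signs) (dual-connected signs))
  where
  open Dual T
  open Homology T using (signs; correction; exact)
  finish : EvenFactor (tabulate (dual signs)) → _
  finish found = correction (edges found) , edges found , exact signs (edges found) (even-degrees found) (even-pairing found) , bound found
    where open Count T signs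

-- Combinatorial maps

module Flags (M : Map) (simple : Simple M) (triangular : AllFacesTriangles M) (projective : OnProjectivePlane M) where

  private
    Flag : Set
    Flag = Fin (nFlags M)

    a₀ a₁ a₂ ρ : Flag → Flag
    a₀ = α₀ M
    a₁ = α₁ M
    a₂ = α₂ M
    ρ x = a₁ (a₀ x)

    vtx-a₁ : ∀ x → vtx M (a₁ x) ≡ vtx M x
    vtx-a₁ x = sym (Equivalence.from (vtx-orb M x (a₁ x)) (step a₁ (hd refl) here))

    vtx-a₂ : ∀ x → vtx M (a₂ x) ≡ vtx M x
    vtx-a₂ x = sym (Equivalence.from (vtx-orb M x (a₂ x)) (step a₂ (tl (hd refl)) here))

    edg-a₀ : ∀ x → edg M (a₀ x) ≡ edg M x
    edg-a₀ x = sym (Equivalence.from (edg-orb M x (a₀ x)) (step a₀ (hd refl) here))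

    edg-a₂ : ∀ x → edg M (a₂ x) ≡ edg M x
    edg-a₂ x = sym (Equivalence.from (edg-orb M x (a₂ x)) (step a₂ (tl (hd refl)) here))

    fac-a₀ : ∀ x → fac M (a₀ x) ≡ fac M x
    fac-a₀ x = sym (Equivalence.from (fac-orb M x (a₀ x)) (step a₀ (hd refl) here))

    fac-a₁ : ∀ x → fac M (a₁ x) ≡ fac M x
    fac-a₁ x = sym (Equivalence.from (fac-orb M x (a₁ x)) (step a₁ (tl (hd refl)) here))

    -- α₀ and α₂ are commuting involutions, so these four flags exhaust the orbit.
    data EdgeFlag (x : Flag) : Flag → Set where
      itself : EdgeFlag x x
      via₀ : EdgeFlag x (a₀ x)
      via₂ : EdgeFlag x (a₂ x)
      via₀₂ : EdgeFlag x (a₀ (a₂ x))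

    edge-flag : ∀ {x y} → edg M x ≡ edg M y → EdgeFlag x y
    edge-flag {x} {y} eq = go (Equivalence.to (edg-orb M x y) eq)
      where
      by₀ : ∀ {y} → EdgeFlag x y → EdgeFlag x (a₀ y)
      by₀ itself = via₀
      by₀ via₀ = subst (EdgeFlag x) (sym (α₀-inv M x)) itself
      by₀ via₂ = via₀₂
      by₀ via₀₂ = subst (EdgeFlag x) (sym (α₀-inv M (a₂ x))) via₂
      by₂ : ∀ {y} → EdgeFlag x y → EdgeFlag x (a₂ y)
      by₂ itself = via₂
      by₂ via₀ = subst (EdgeFlag x) (α₀α₂-comm M x) via₀₂
      by₂ via₂ = subst (EdgeFlag x) (sym (α₂-inv M x)) itself
      by₂ via₀₂ = subst (EdgeFlag x) (sym (trans (sym (α₀α₂-comm M (a₂ x))) (cong a₀ (α₂-inv M x)))) via₀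
      go : ∀ {y} → Orb (a₀ ∷ a₂ ∷ []) x y → EdgeFlag x y
      go here = itself
      go (step _ (hd refl) o) = by₀ (go o)
      go (step _ (tl (hd refl)) o) = by₂ (go o)

    ρ³ : ∀ x → ρ (ρ (ρ x)) ≡ x
    ρ³ x = proj₁ (triangular x)

    ρ≢ : ∀ x → ρ x ≢ x
    ρ≢ x = proj₂ (triangular x)

    -- The rotation ρ has period 3, so the orbit consists of the three rotations of x and their
    -- images under α₀.
    data FaceFlag (x : Flag) : Flag → Set where
      p₀ : FaceFlag x x
      q₀ : FaceFlag x (a₀ x)
      p₁ : FaceFlag x (ρ x)
      q₁ : FaceFlag x (a₀ (ρ x))
      p₂ : FaceFlag x (ρ (ρ x))
      q₂ : FaceFlag x (a₀ (ρ (ρ x)))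

    face-flag : ∀ {x y} → fac M x ≡ fac M y → FaceFlag x y
    face-flag {x} {y} eq = go (Equivalence.to (fac-orb M x y) eq)
      where
      by₀ : ∀ {y} → FaceFlag x y → FaceFlag x (a₀ y)
      by₀ p₀ = q₀
      by₀ q₀ = subst (FaceFlag x) (sym (α₀-inv M _)) p₀
      by₀ p₁ = q₁
      by₀ q₁ = subst (FaceFlag x) (sym (α₀-inv M _)) p₁
      by₀ p₂ = q₂
      by₀ q₂ = subst (FaceFlag x) (sym (α₀-inv M _)) p₂
      by₁ : ∀ {y} → FaceFlag x y → FaceFlag x (a₁ y)
      by₁ p₀ = subst (FaceFlag x) (trans (sym (α₁-inv M _)) (cong a₁ (ρ³ x))) q₂
      by₁ q₀ = p₁
      by₁ p₁ = subst (FaceFlag x) (sym (α₁-inv M _)) q₀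
      by₁ q₁ = p₂
      by₁ p₂ = subst (FaceFlag x) (sym (α₁-inv M _)) q₁
      by₁ q₂ = subst (FaceFlag x) (sym (ρ³ x)) p₀
      go : ∀ {y} → Orb (a₀ ∷ a₁ ∷ []) x y → FaceFlag x y
      go here = p₀
      go (step _ (hd refl) o) = by₀ (go o)
      go (step _ (tl (hd refl)) o) = by₁ (go o)

    r : Fin (E M) → Flag
    r e = proj₁ (edg-surj M e)

    edg-r : ∀ e → edg M (r e) ≡ e
    edg-r e = proj₂ (edg-surj M e)

    base : Fin (F M) → Flag
    base f = proj₁ (fac-surj M f)

    fac-base : ∀ f → fac M (base f) ≡ f
    fac-base f = proj₂ (fac-surj M f)

    flag-ends : ∀ x → (vtx M x ≡ vtx M (r (edg M x)) × vtx M (a₀ x) ≡ vtx M (a₀ (r (edg M x)))) ⊎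
                      (vtx M x ≡ vtx M (a₀ (r (edg M x))) × vtx M (a₀ x) ≡ vtx M (r (edg M x)))
    flag-ends x = go (edge-flag (edg-r (edg M x)))
      where
      go : ∀ {x r} → EdgeFlag r x → (vtx M x ≡ vtx M r × vtx M (a₀ x) ≡ vtx M (a₀ r)) ⊎
                                    (vtx M x ≡ vtx M (a₀ r) × vtx M (a₀ x) ≡ vtx M r)
      go itself = inj₁ (refl , refl)
      go via₀ = inj₂ (refl , cong (vtx M) (α₀-inv M _))
      go {r = r} via₂ = inj₁ (vtx-a₂ r , trans (cong (vtx M) (α₀α₂-comm M r)) (vtx-a₂ (a₀ r)))
      go {r = r} via₀₂ = inj₂ (trans (cong (vtx M) (α₀α₂-comm M r)) (vtx-a₂ (a₀ r)) ,
                               trans (cong (vtx M) (α₀-inv M _)) (vtx-a₂ r))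

    flag-sides : ∀ x → (fac M x ≡ fac M (r (edg M x)) × fac M (a₂ x) ≡ fac M (a₂ (r (edg M x)))) ⊎
                       (fac M x ≡ fac M (a₂ (r (edg M x))) × fac M (a₂ x) ≡ fac M (r (edg M x)))
    flag-sides x = go (edge-flag (edg-r (edg M x)))
      where
      go : ∀ {x r} → EdgeFlag r x → (fac M x ≡ fac M r × fac M (a₂ x) ≡ fac M (a₂ r)) ⊎
                                    (fac M x ≡ fac M (a₂ r) × fac M (a₂ x) ≡ fac M r)
      go itself = inj₁ (refl , refl)
      go {r = r} via₀ = inj₁ (fac-a₀ r , trans (cong (fac M) (sym (α₀α₂-comm M r))) (fac-a₀ (a₂ r)))
      go via₂ = inj₂ (refl , cong (fac M) (α₂-inv M _))
      go {r = r} via₀₂ = inj₂ (fac-a₀ (a₂ r) , trans (cong (fac M) (trans (sym (α₀α₂-comm M (a₂ r))) (cong a₀ (α₂-inv M r)))) (fac-a₀ r))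

    invariant : (h : Flag → Bool) → (∀ x → h (a₀ x) ≡ h x) → (∀ x → h (a₁ x) ≡ h x) → (∀ x → h (a₂ x) ≡ h x) →
                ∀ x y → h x ≡ h y
    invariant h i₀ i₁ i₂ x y = go (connected M x y)
      where
      go : ∀ {y} → Orb (a₀ ∷ a₁ ∷ a₂ ∷ []) x y → h x ≡ h y
      go here = refl
      go (step {y} _ (hd refl) o) = trans (go o) (sym (i₀ y))
      go (step {y} _ (tl (hd refl)) o) = trans (go o) (sym (i₁ y))
      go (step {y} _ (tl (tl (hd refl))) o) = trans (go o) (sym (i₂ y))

    vertices-connected : ∀ (c : Fin (V M) → Bool) → (∀ e → c (vtx M (r e)) ≡ c (vtx M (a₀ (r e)))) → ∀ v w → c v ≡ c w
    vertices-connected c eq v w with vtx-surj M v | vtx-surj M w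
    ... | x , refl | y , refl = invariant (c ∘ vtx M) across (cong c ∘ vtx-a₁) (cong c ∘ vtx-a₂) x y
      where
      across : ∀ x → c (vtx M (a₀ x)) ≡ c (vtx M x)
      across x with flag-ends x
      ... | inj₁ (p , q) = trans (cong c q) (trans (sym (eq _)) (cong c (sym p)))
      ... | inj₂ (p , q) = trans (cong c q) (trans (eq _) (cong c (sym p)))

    faces-connected : ∀ (c : Fin (F M) → Bool) → (∀ e → c (fac M (r e)) ≡ c (fac M (a₂ (r e)))) → ∀ v w → c v ≡ c w
    faces-connected c eq v w with fac-surj M v | fac-surj M w
    ... | x , refl | y , refl = invariant (c ∘ fac M) (cong c ∘ fac-a₀) (cong c ∘ fac-a₁) across x y
      where
      across : ∀ x → c (fac M (a₂ x)) ≡ c (fac M x)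
      across x with flag-sides x
      ... | inj₁ (p , q) = trans (cong c q) (trans (sym (eq _)) (cong c (sym p)))
      ... | inj₂ (p , q) = trans (cong c q) (trans (eq _) (cong c (sym p)))

    ∂ : (Fin (V M) → Bool) → Fin (E M) → Bool
    ∂ c e = c (vtx M (r e)) xor c (vtx M (a₀ (r e)))

  ∂-flag : ∀ c x → ∂ c (edg M x) ≡ c (vtx M x) xor c (vtx M (a₀ x))
  ∂-flag c x with flag-ends x
  ... | inj₁ (p , q) = cong₂ _xor_ (cong c (sym p)) (cong c (sym q))
  ... | inj₂ (p , q) = trans (cong₂ _xor_ (cong c (sym q)) (cong c (sym p))) (𝔹.xor-comm (c (vtx M (a₀ x))) (c (vtx M x)))

  private
    ∂-triangle : ∀ c x → ∂ c (edg M x) xor (∂ c (edg M (ρ x)) xor ∂ c (edg M (ρ (ρ x)))) ≡ false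
    ∂-triangle c x = trans (cong₂ _xor_ (side x) (cong₂ _xor_ (side (ρ x)) (trans (side (ρ (ρ x))) (cong (λ z → at (ρ (ρ x)) xor at z) (ρ³ x)))))
      (solve 3 (λ a b d → ((a :+ b) :+ ((b :+ d) :+ (d :+ a))) := con false) refl (at x) (at (ρ x)) (at (ρ (ρ x))))
      where
      open xor-∧-Solver using (solve; _:+_; _:=_; con)
      at : Flag → Bool
      at x = c (vtx M x)
      side : ∀ x → ∂ c (edg M x) ≡ at x xor at (ρ x)
      side x = trans (∂-flag c x) (cong (λ v → at x xor c v) (sym (vtx-a₁ (a₀ x))))

    -- How often x is listed among the six flags of the face of y. They are distinct, so the value
    -- is 1 for every flag of the face, and incidences can be counted flag by flag.
    occurrences : Flag → Flag → ℕ
    occurrences y x = (δ x y + δ x (a₀ y)) + ((δ x (ρ y) + δ x (a₀ (ρ y))) + (δ x (ρ (ρ y)) + δ x (a₀ (ρ (ρ y)))))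

    a₀-injective : ∀ {x y} → a₀ x ≡ a₀ y → x ≡ y
    a₀-injective {x} {y} eq = trans (sym (α₀-inv M x)) (trans (cong a₀ eq) (α₀-inv M y))

    x≢ρρ : ∀ y → y ≢ ρ (ρ y)
    x≢ρρ y eq = ρ≢ y (trans (cong ρ eq) (ρ³ y))

    a₀≢ρ : ∀ y → a₀ y ≢ ρ y
    a₀≢ρ y eq = α₁-fpf M (a₀ y) (sym eq)

    a₀≢ρρ : ∀ y → a₀ y ≢ ρ (ρ y)
    a₀≢ρρ y eq = α₀-fpf M (ρ y) (sym (trans (cong a₁ eq) (α₁-inv M (a₀ (ρ y)))))

    occurs-p : ∀ y → occurrences y y ≡ 1
    occurs-p y = cong₂ _+_ (cong₂ _+_ (δ-refl y) (δ-≢ (α₀-fpf M y ∘ sym)))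
      (cong₂ _+_ (cong₂ _+_ (δ-≢ (ρ≢ y ∘ sym)) (δ-≢ λ eq → a₀≢ρ y (trans (cong a₀ eq) (α₀-inv M (ρ y)))))
                 (cong₂ _+_ (δ-≢ (x≢ρρ y)) (δ-≢ λ eq → a₀≢ρρ y (trans (cong a₀ eq) (α₀-inv M (ρ (ρ y)))))))

    occurs-q : ∀ y → occurrences y (a₀ y) ≡ 1
    occurs-q y = cong₂ _+_ (cong₂ _+_ (δ-≢ (α₀-fpf M y)) (δ-refl (a₀ y)))
      (cong₂ _+_ (cong₂ _+_ (δ-≢ (a₀≢ρ y)) (δ-≢ (ρ≢ y ∘ sym ∘ a₀-injective)))
                 (cong₂ _+_ (δ-≢ (a₀≢ρρ y)) (δ-≢ (x≢ρρ y ∘ a₀-injective))))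

    occurrences-ρ : ∀ y x → occurrences (ρ y) x ≡ occurrences y x
    occurrences-ρ y x = trans (cong (λ z → (δ x (ρ y) + δ x (a₀ (ρ y))) + ((δ x (ρ (ρ y)) + δ x (a₀ (ρ (ρ y)))) + (δ x z + δ x (a₀ z)))) (ρ³ y))
      (rotate (δ x (ρ y) + δ x (a₀ (ρ y))) (δ x (ρ (ρ y)) + δ x (a₀ (ρ (ρ y)))) (δ x y + δ x (a₀ y)))
      where
      rotate : ∀ a b c → a + (b + c) ≡ c + (a + b)
      rotate = solve-∀

    occurs : ∀ {y x} → FaceFlag y x → occurrences y x ≡ 1
    occurs {y} p₀ = occurs-p y
    occurs {y} q₀ = occurs-q y
    occurs {y} p₁ = trans (sym (occurrences-ρ y _)) (occurs-p (ρ y))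
    occurs {y} q₁ = trans (sym (occurrences-ρ y _)) (occurs-q (ρ y))
    occurs {y} p₂ = trans (sym (occurrences-ρ y _)) (trans (sym (occurrences-ρ (ρ y) _)) (occurs-p (ρ (ρ y))))
    occurs {y} q₂ = trans (sym (occurrences-ρ y _)) (trans (sym (occurrences-ρ (ρ y) _)) (occurs-q (ρ (ρ y))))

    face-occurrences : ∀ f x → δ f (fac M x) ≡ occurrences (base f) x
    face-occurrences f x with f ≟ fac M x
    ... | yes refl = trans (δ-refl f) (sym (occurs (face-flag (fac-base f))))
    ... | no ne = trans (δ-≢ ne) (sym (cong₂ _+_ (cong₂ _+_ (off refl) (off (fac-a₀ _)))
        (cong₂ _+_ (cong₂ _+_ (off (fac-ρ y)) (off (trans (fac-a₀ _) (fac-ρ y))))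
                   (cong₂ _+_ (off (trans (fac-ρ _) (fac-ρ y))) (off (trans (fac-a₀ _) (trans (fac-ρ _) (fac-ρ y))))))))
      where
      y = base f
      fac-ρ : ∀ x → fac M (ρ x) ≡ fac M x
      fac-ρ x = trans (fac-a₁ (a₀ x)) (fac-a₀ x)
      off : ∀ {z} → fac M z ≡ fac M y → δ x z ≡ 0
      off eq = δ-≢ λ x≡z → ne (sym (trans (cong (fac M) x≡z) (trans eq (fac-base f))))

    -- y and α₀ y are the two flags on one side of their edge, while `r e` and its image under α₂
    -- represent the two sides of e, one flag each.
    edge-occurrences : ∀ e y → δ e (edg M y) ≡ (δ (r e) y + δ (r e) (a₀ y)) + (δ (a₂ (r e)) y + δ (a₂ (r e)) (a₀ y))
    edge-occurrences e y with e ≟ edg M y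
    ... | yes refl = trans (δ-refl e) (sym (go (edge-flag (edg-r e))))
      where
      go : ∀ {x y} → EdgeFlag x y → (δ x y + δ x (a₀ y)) + (δ (a₂ x) y + δ (a₂ x) (a₀ y)) ≡ 1
      go {x} itself = cong₂ _+_ (cong₂ _+_ (δ-refl x) (δ-≢ (α₀-fpf M x ∘ sym)))
        (cong₂ _+_ (δ-≢ (α₂-fpf M x)) (δ-≢ λ eq → α₀α₂-fpf M x (trans (cong a₀ eq) (α₀-inv M x))))
      go {x} via₀ = cong₂ _+_ (cong₂ _+_ (δ-≢ (α₀-fpf M x ∘ sym)) (trans (cong (δ x) (α₀-inv M x)) (δ-refl x)))
        (cong₂ _+_ (δ-≢ λ eq → α₀α₂-fpf M x (trans (cong a₀ eq) (α₀-inv M x)))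
                   (trans (cong (δ (a₂ x)) (α₀-inv M x)) (δ-≢ (α₂-fpf M x))))
      go {x} via₂ = cong₂ _+_ (cong₂ _+_ (δ-≢ (α₂-fpf M x ∘ sym)) (δ-≢ (α₀α₂-fpf M x ∘ sym)))
        (cong₂ _+_ (δ-refl (a₂ x)) (δ-≢ (α₀-fpf M (a₂ x) ∘ sym)))
      go {x} via₀₂ = cong₂ _+_ (cong₂ _+_ (δ-≢ (α₀α₂-fpf M x ∘ sym))
                                          (trans (cong (δ x) (α₀-inv M (a₂ x))) (δ-≢ (α₂-fpf M x ∘ sym))))
        (cong₂ _+_ (δ-≢ (α₀-fpf M (a₂ x) ∘ sym)) (trans (cong (δ (a₂ x)) (α₀-inv M (a₂ x))) (δ-refl (a₂ x))))
    ... | no ne = trans (δ-≢ ne) (sym (cong₂ _+_ (cong₂ _+_ (off (edg-r e) refl) (off (edg-r e) (edg-a₀ y)))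
                                                 (cong₂ _+_ (off edg-ar refl) (off edg-ar (edg-a₀ y)))))
      where
      edg-ar : edg M (a₂ (r e)) ≡ e
      edg-ar = trans (edg-a₂ (r e)) (edg-r e)
      off : ∀ {x z} → edg M x ≡ e → edg M z ≡ edg M y → δ x z ≡ 0
      off p q = δ-≢ λ x≡z → ne (trans (sym p) (trans (cong (edg M) x≡z) q))

    -- Both sides count the coincidences between two flags, one on each side of e, and the six flags
    -- of f, which are grouped by the three boundary edges on the right. A face on both sides of e
    -- is thereby counted twice.
    flag-incidence : ∀ f e → δ f (fac M (r e)) + δ f (fac M (a₂ (r e))) ≡
      δ e (edg M (base f)) + (δ e (edg M (ρ (base f))) + δ e (edg M (ρ (ρ (base f)))))
    flag-incidence f e = trans (cong₂ _+_ (face-occurrences f (r e)) (face-occurrences f (a₂ (r e))))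
      (trans (shuffle (δ (r e) y + δ (r e) (a₀ y)) (δ (r e) (ρ y) + δ (r e) (a₀ (ρ y))) (δ (r e) (ρ (ρ y)) + δ (r e) (a₀ (ρ (ρ y)))) _ _ _)
        (sym (cong₂ _+_ (edge-occurrences e y) (cong₂ _+_ (edge-occurrences e (ρ y)) (edge-occurrences e (ρ (ρ y)))))))
      where
      y = base f
      shuffle : ∀ a b c a′ b′ c′ → (a + (b + c)) + (a′ + (b′ + c′)) ≡ (a + a′) + ((b + b′) + (c + c′))
      shuffle = solve-∀

  triangulation : Triangulation (V M) (E M) (F M)
  triangulation = record
    { end₁ = vtx M ∘ r
    ; end₂ = vtx M ∘ a₀ ∘ r
    ; side₁ = fac M ∘ r
    ; side₂ = fac M ∘ a₂ ∘ r
    ; b₀ = edg M ∘ base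
    ; b₁ = edg M ∘ ρ ∘ base
    ; b₂ = edg M ∘ ρ ∘ ρ ∘ base
    ; no-loop = proj₁ simple ∘ r
    ; connected₁ = vertices-connected
    ; connected₂ = faces-connected
    ; incidence = flag-incidence
    ; triangle = λ c f → ∂-triangle c (base f)
    ; euler = projective
    }

  -- The axioms of a map admit an empty flag set; Euler's equation excludes it, since V + F ≡ E + 1
  -- forces a vertex or a face to exist.
  some-flag : Flag
  some-flag = pick-cell (V M) (F M) (E M) projective (proj₁ ∘ vtx-surj M) (proj₁ ∘ fac-surj M)
    where
    pick-cell : ∀ v f e → v + f ≡ e + 1 → (Fin v → Flag) → (Fin f → Flag) → Flag
    pick-cell (suc v) f e eq at-v at-f = at-v zero
    pick-cell zero (suc f) e eq at-v at-f = at-f zero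
    pick-cell zero zero e eq at-v at-f = ⊥-elim (case trans eq (ℕ.+-comm e 1) of λ ())

inhabited-large-cut : {v e f : ℕ} → Fin v → Fin e → Fin f → (T : Triangulation v e f) →
  ∃₂ λ c g → (∀ e → g e ≡ Triangulation.coboundary T c e) × 2 * e ≤ 3 * ∣ Vec.tabulate g ∣ + 3
inhabited-large-cut {suc _} {suc _} {suc _} _ _ _ = large-cut

theorem1p8 : (T : TriangulationOfProjectivePlane) →
    let G = TriangulationOfProjectivePlane.map T in
    Σ (Subset (E G)) λ S → BipartiteEdgeSet G S × (2 * E G ≤ 3 * ∣ S ∣ + 3)
theorem1p8 T = finish (inhabited-large-cut (vtx G some-flag) (edg G some-flag) (fac G some-flag) triangulation)
  where
  open TriangulationOfProjectivePlane T renaming (map to G)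
  open Flags G simple triangular projective
  finish : (∃₂ λ c g → (∀ e → g e ≡ Triangulation.coboundary triangulation c e) × 2 * E G ≤ 3 * ∣ Vec.tabulate g ∣ + 3) →
           Σ (Subset (E G)) λ S → BipartiteEdgeSet G S × (2 * E G ≤ 3 * ∣ S ∣ + 3)
  finish (c , g , exact , large) = Vec.tabulate g , (c , λ x x∈S same → case
      trans (sym ([]=⇒lookup x∈S)) (trans (lookup∘tabulate g (edg G x)) (trans (exact (edg G x)) (trans (∂-flag c x)
        (trans (cong (_xor c (vtx G (α₀ G x))) same) (𝔹.xor-same (c (vtx G (α₀ G x)))))))) of λ ()) , large
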